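{- Let $M$ be a matroid on a nonempty finite ground set with a cycle system $\mathcal{C}=\{C_1,\dots,C_g\}$, where $g=g(M)$. 1. There exists an element $e\in E(M)$ such that both the deletion $M\setminus e$ and the contraction $M/e$ admit cycle systems. 2. If $M$ is connected, then each $C_i$ is a circuit of $M$. 3. If $M$ is not connected, then the connected components can be ordered so that, writing $M=M_1\oplus\cdots\oplus M_k$ for the decomposition of $M$ into connected components in this order, there are circuit systems $\mathcal{C}^{(i)}$ for $M_i$ $(1\le i\le k)$ such that $\mathcal{C}$ is the disjoint union of sets $\widetilde{\mathcal{C}}^{(1)},\dots,\widetilde{\mathcal{C}}^{(k)}$ of the form $$\widetilde{\mathcal{C}}^{(i)}=\{K_C\cup C : C\in\mathcal{C}^{(i)}\},$$ where each $K_C$ is either empty or a cycle contained in $\bigoplus_{j=1}^{i-1}M_j$. In particular $\widetilde{\mathcal{C}}^{(1)}=\mathcal{C}^{(1)}$. 4. If $M$ is connected and binary, then $\mathcal{C}$ is a basis for the circuit space of $M$; that is, the indicator vectors of $C_1,\dots,C_g$ form a basis of the circuit space of $M$.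
   Context: Matroids are on finite ground sets; $E(M)$ is the ground set, $r(M)$ the rank, and $g(M)=|E(M)|-r(M)$ the corank. A *cycle* of $M$ is a union of circuits of $M$ (equivalently, a subset $K\subseteq E(M)$ such that the restriction $M|K$ has no bridges (coloops)). For a loop $e$, $M/e$ means $M\setminus e$. Unique union: for a family $\mathcal{A}=\{A_1,\dots,A_g\}$ of subsets of a set and $\sigma\subseteq[g]=\{1,\dots,g\}$, $\mathcal{A}_\sigma$ is the set of elements $e\in\bigcup_{i\in\sigma}A_i$ for which there is exactly one $i\in\sigma$ with $e\in A_i$. A *cycle system* for $M$ is a collection $\mathcal{C}=\{C_1,\dots,C_g\}$ of cycles of $M$ with $g=g(M)$ such that for every nonempty $\sigma\subseteq[g]$ the unique union $\mathcal{C}_\sigma$ is dependent in $M$. A *circuit system* is a cycle system all of whose elements are circuits. $M$ is *connected* if any two distinct elements of $E(M)$ lie in a common circuit; a connected component is a maximal subset $T$ of the ground set such that $M|T$ is connected, and $M$ is the direct sum of the restrictions to its connected components. The *circuit space* of $M$ is the subspace of the $\mathbb{F}_2$-vector space with basis $E(M)$ spanned by the indicator vectors of circuits of $M$. -}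

module Defs where

open import Algebra.Bundles using (CommutativeRing)
open import Data.Bool.Base using (Bool; false; _∧_)
open import Data.Bool.Properties using (xor-∧-commutativeRing)
open import Data.Empty using (⊥-elim)
open import Data.Fin.Base using (Fin; Fin′; zero; suc; inject; toℕ)
open import Data.Fin.Properties using (any?; all?; toℕ-inject; toℕ-injective)
  renaming (_≟_ to _≟ᶠ_)
open import Data.Fin.Subset
open import Data.Fin.Subset.Properties
open import Data.List.Base as List using (List; filter; _++_)
open import Data.List.Extrema.Nat using (max)
open import Data.List.Relation.Unary.All using (All)
open import Data.Nat.Base using (ℕ; zero; suc; _+_; _∸_; _≤_; _<_; z≤n; s≤s)
import Data.Nat.Properties as ℕ
open import Data.Product using (∃; ∃!; ∃-syntax; _×_; _,_; proj₁; proj₂)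
open import Data.Sum.Base using (_⊎_; inj₁; inj₂; [_,_]′)
open import Data.Vec.Base as Vec using ([]; _∷_; lookup; here; there)
open import Data.Vec.Functional using (Vector)
open import Data.Vec.Properties using ([]=⇒lookup; lookup⇒[]=; lookup∘tabulate)
open import Function.Base using (_∘_)
open import Function.Bundles using (_⇔_; mk⇔)
open import Function.Definitions using (Injective)
open import Level using (0ℓ)
open import Relation.Binary.PropositionalEquality
open import Relation.Nullary
open import Relation.Nullary.Decidable using (map′; dec-true)
open import Relation.Unary using (Pred; Decidable)

private
  variable
    n g k : ℕ

comprehension : {P : Pred (Fin n) 0ℓ} → Decidable P → Subset n
comprehension P? = Vec.tabulate (does ∘ P?)

∈-comprehension : {P : Pred (Fin n) 0ℓ} (P? : Decidable P) {e : Fin n} →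
                  e ∈ comprehension P? ⇔ P e
∈-comprehension P? {e} = mk⇔ to from
  where
  to : e ∈ comprehension P? → _
  to e∈ with P? e | trans (sym (lookup∘tabulate (does ∘ P?) e)) ([]=⇒lookup e∈)
  ... | yes p | _ = p
  from : _ → e ∈ comprehension P?
  from p = lookup⇒[]= e _ (trans (lookup∘tabulate (does ∘ P?) e) (dec-true (P? e) p))

∃!? : {P : Pred (Fin n) 0ℓ} → Decidable P → Dec (∃! _≡_ P)
∃!? P? = map′ (λ (x , p , u) → x , p , λ {y} → u y) (λ (x , p , u) → x , p , λ y → u {y})
  (any? λ x → P? x ×-dec all? λ y → P? y →-dec (x ≟ᶠ y))

subsets : ∀ n → List (Subset n)
subsets zero    = List.[ [] ]
subsets (suc n) = List.map (outside ∷_) (subsets n) ++ List.map (inside ∷_) (subsets n)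

⋃ᶠ : (Fin k → Subset n) → Subset n
⋃ᶠ A = ⋃ (List.tabulate A)

Range : {A : Set} → (Fin k → A) → Pred A 0ℓ
Range f x = ∃[ i ] f i ≡ x

private
  ∈⋃ᶠ⁻ : (A : Fin k → Subset n) {x : Fin n} → x ∈ ⋃ᶠ A → ∃[ j ] x ∈ A j
  ∈⋃ᶠ⁻ {zero}  A x∈ = ⊥-elim (∉⊥ x∈)
  ∈⋃ᶠ⁻ {suc k} A x∈ with x∈p∪q⁻ (A zero) _ x∈
  ... | inj₁ x∈₀ = zero , x∈₀
  ... | inj₂ x∈₁ with ∈⋃ᶠ⁻ (A ∘ suc) x∈₁
  ...   | j , p = suc j , p

  ∈⋃ᶠ⁺ : (A : Fin k → Subset n) (j : Fin k) {x : Fin n} → x ∈ A j → x ∈ ⋃ᶠ A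
  ∈⋃ᶠ⁺ A zero    x∈ = x∈p∪q⁺ (inj₁ x∈)
  ∈⋃ᶠ⁺ A (suc j) x∈ = x∈p∪q⁺ {p = A zero} (inj₂ (∈⋃ᶠ⁺ (A ∘ suc) j x∈))

  ∣∪∣-disjoint : (p q : Subset n) → (∀ {x} → x ∈ p → x ∉ q) → ∣ p ∪ q ∣ ≡ ∣ p ∣ + ∣ q ∣
  ∣∪∣-disjoint []            []            dis = refl
  ∣∪∣-disjoint (outside ∷ p) (outside ∷ q) dis =
    ∣∪∣-disjoint p q (λ a b → dis (there a) (there b))
  ∣∪∣-disjoint (outside ∷ p) (inside  ∷ q) dis = trans
    (cong suc (∣∪∣-disjoint p q (λ a b → dis (there a) (there b))))
    (sym (ℕ.+-suc _ _))
  ∣∪∣-disjoint (inside  ∷ p) (outside ∷ q) dis =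
    cong suc (∣∪∣-disjoint p q (λ a b → dis (there a) (there b)))
  ∣∪∣-disjoint (inside  ∷ p) (inside  ∷ q) dis = ⊥-elim (dis here here)

  ∣p∪⁅x⁆∣ : (p : Subset n) (x : Fin n) → x ∉ p → ∣ p ∪ ⁅ x ⁆ ∣ ≡ suc ∣ p ∣
  ∣p∪⁅x⁆∣ p x x∉p = trans
    (∣∪∣-disjoint p ⁅ x ⁆ λ y∈p y∈x → x∉p (subst (_∈ p) (x∈⁅y⁆⇒x≡y x y∈x) y∈p))
    (trans (cong (∣ p ∣ +_) (∣⁅x⁆∣≡1 x)) (ℕ.+-comm ∣ p ∣ 1))

  ∪-monoˡ-⊆ : (p q r : Subset n) → p ⊆ q → p ∪ r ⊆ q ∪ r
  ∪-monoˡ-⊆ p q r p⊆q x∈ = x∈p∪q⁺ ([ inj₁ ∘ p⊆q , inj₂ ]′ (x∈p∪q⁻ p r x∈))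

  ∩-monoˡ-⊆ : (p q r : Subset n) → p ⊆ q → p ∩ r ⊆ q ∩ r
  ∩-monoˡ-⊆ p q r p⊆q x∈ with x∈p∩q⁻ p r x∈
  ... | a , b = x∈p∩q⁺ (p⊆q a , b)

  ∣∩⋃ᶠ∣-mono : (A : Fin k → Subset n) (I J : Subset n) →
               (∀ {i j} → i ≢ j → ∀ {x} → x ∈ A i → x ∉ A j) →
               (∀ j → ∣ J ∩ A j ∣ ≤ ∣ I ∩ A j ∣) → ∣ J ∩ ⋃ᶠ A ∣ ≤ ∣ I ∩ ⋃ᶠ A ∣
  ∣∩⋃ᶠ∣-mono {zero} {n} A I J dis h =
    ℕ.≤-trans (∣p∩q∣≤∣q∣ J ⊥) (subst (_≤ ∣ I ∩ ⊥ ∣) (sym (∣⊥∣≡0 n)) z≤n)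
  ∣∩⋃ᶠ∣-mono {suc k} A I J dis h = begin
    ∣ J ∩ (A zero ∪ R) ∣           ≡⟨ split J ⟩
    ∣ J ∩ A zero ∣ + ∣ J ∩ R ∣     ≤⟨ ℕ.+-mono-≤ (h zero)
                                        (∣∩⋃ᶠ∣-mono (A ∘ suc) I J (λ ne → dis (ne ∘ suc-inj)) (h ∘ suc)) ⟩
    ∣ I ∩ A zero ∣ + ∣ I ∩ R ∣     ≡⟨ split I ⟨
    ∣ I ∩ (A zero ∪ R) ∣           ∎
    where
    open ℕ.≤-Reasoning
    R = ⋃ᶠ (A ∘ suc)
    suc-inj : ∀ {i j : Fin k} → Fin.suc i ≡ suc j → i ≡ j
    suc-inj refl = refl
    split : ∀ X → ∣ X ∩ (A zero ∪ R) ∣ ≡ ∣ X ∩ A zero ∣ + ∣ X ∩ R ∣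
    split X = trans (cong ∣_∣ (∩-distribˡ-∪ X (A zero) R))
      (∣∪∣-disjoint (X ∩ A zero) (X ∩ R) apart)
      where
      apart : ∀ {x} → x ∈ X ∩ A zero → x ∉ X ∩ R
      apart a b with ∈⋃ᶠ⁻ (A ∘ suc) (proj₂ (x∈p∩q⁻ X R b))
      ... | j , x∈j = dis {zero} {suc j} (λ ()) (proj₂ (x∈p∩q⁻ X (A zero) a)) x∈j

-- The ground set E is a subset of an ambient Fin n, so that minors and
-- restrictions of M live on honest subsets of E M.  Independence is
-- decidable, as it is classically for every matroid on a finite set.

record Matroid (n : ℕ) : Set₁ where
  field
    E          : Subset n
    Indep      : Pred (Subset n) 0ℓ
    Indep?     : Decidable Indep
    indep⊆E    : ∀ {I} → Indep I → I ⊆ E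
    indep-⊥    : Indep ⊥
    hereditary : ∀ {I J} → Indep I → J ⊆ I → Indep J
    augment    : ∀ {I J} → Indep I → Indep J → ∣ I ∣ < ∣ J ∣ →
                 ∃[ e ] e ∈ J × e ∉ I × Indep (I ∪ ⁅ e ⁆)

open Matroid public

infix 4 _≈_

_≈_ : Matroid n → Matroid n → Set
M ≈ N = E M ≡ E N × (∀ I → Indep M I ⇔ Indep N I)

rank : Matroid n → ℕ
rank {n} M = max 0 (List.map ∣_∣ (filter (Indep? M) (subsets n)))

corank : Matroid n → ℕ
corank M = ∣ E M ∣ ∸ rank M

Dependent : Matroid n → Pred (Subset n) 0ℓ
Dependent M X = X ⊆ E M × ¬ Indep M X

IsCircuit : Matroid n → Pred (Subset n) 0ℓ
IsCircuit M C = Dependent M C × (∀ {D} → D ⊂ C → Indep M D)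

-- The empty union is allowed, so ⊥ is a cycle.
IsCycle : Matroid n → Pred (Subset n) 0ℓ
IsCycle M K = ∃[ Cs ] All (IsCircuit M) Cs × ⋃ Cs ≡ K

infixl 7 _↾_ _∖_ _⧸_

_↾_ : Matroid n → Subset n → Matroid n
M ↾ T = record
  { E          = E M ∩ T
  ; Indep      = λ I → Indep M I × I ⊆ T
  ; Indep?     = λ I → Indep? M I ×-dec (I ⊆? T)
  ; indep⊆E    = λ (i , I⊆T) x∈ → x∈p∩q⁺ (indep⊆E M i x∈ , I⊆T x∈)
  ; indep-⊥    = indep-⊥ M , ⊆-min T
  ; hereditary = λ (i , I⊆T) J⊆I → hereditary M i J⊆I , λ x∈ → I⊆T (J⊆I x∈)
  ; augment    = aug
  }
  where
  aug : ∀ {I J} → Indep M I × I ⊆ T → Indep M J × J ⊆ T → ∣ I ∣ < ∣ J ∣ →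
        ∃[ e ] e ∈ J × e ∉ I × Indep M (I ∪ ⁅ e ⁆) × I ∪ ⁅ e ⁆ ⊆ T
  aug {I} {J} (i , I⊆T) (j , J⊆T) lt with augment M i j lt
  ... | e , e∈J , e∉I , ie = e , e∈J , e∉I , ie , λ x∈ →
    [ I⊆T , (λ x∈e → subst (_∈ T) (sym (x∈⁅y⁆⇒x≡y e x∈e)) (J⊆T e∈J)) ]′ (x∈p∪q⁻ I ⁅ e ⁆ x∈)

_∖_ : Matroid n → Fin n → Matroid n
M ∖ e = M ↾ (E M - e)

contractNonloop : (M : Matroid n) (e : Fin n) → Indep M ⁅ e ⁆ → Matroid n
contractNonloop M e indep-e = record
  { E          = E M - e
  ; Indep      = λ I → e ∉ I × Indep M (I ∪ ⁅ e ⁆)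
  ; Indep?     = λ I → ¬? (e ∈? I) ×-dec Indep? M (I ∪ ⁅ e ⁆)
  ; indep⊆E    = λ {I} (e∉I , i) x∈ →
                   x∈p∧x≢y⇒x∈p-y (indep⊆E M i (p⊆p∪q ⁅ e ⁆ x∈)) (λ { refl → e∉I x∈ })
  ; indep-⊥    = ∉⊥ , subst (Indep M) (sym (∪-identityˡ ⁅ e ⁆)) indep-e
  ; hereditary = λ {I} {J} (e∉I , i) J⊆I →
                   (λ e∈J → e∉I (J⊆I e∈J)) , hereditary M i (∪-monoˡ-⊆ J I ⁅ e ⁆ J⊆I)
  ; augment    = aug
  }
  where
  aug : ∀ {I J} → e ∉ I × Indep M (I ∪ ⁅ e ⁆) → e ∉ J × Indep M (J ∪ ⁅ e ⁆) → ∣ I ∣ < ∣ J ∣ →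
        ∃[ f ] f ∈ J × f ∉ I × e ∉ I ∪ ⁅ f ⁆ × Indep M ((I ∪ ⁅ f ⁆) ∪ ⁅ e ⁆)
  aug {I} {J} (e∉I , i) (e∉J , j) lt
    with augment M i j (subst₂ _<_ (sym (∣p∪⁅x⁆∣ I e e∉I)) (sym (∣p∪⁅x⁆∣ J e e∉J)) (s≤s lt))
  ... | f , f∈J∪e , f∉I∪e , k =
    f
    , [ (λ f∈J → f∈J) , (λ f∈e → ⊥-elim (f∉I∪e (x∈p∪q⁺ (inj₂ f∈e)))) ]′ (x∈p∪q⁻ J ⁅ e ⁆ f∈J∪e)
    , (λ f∈I → f∉I∪e (x∈p∪q⁺ (inj₁ f∈I)))
    , (λ e∈ → [ e∉I , (λ e∈f → f∉I∪e (x∈p∪q⁺ (inj₂ (subst (_∈ ⁅ e ⁆) (x∈⁅y⁆⇒x≡y f e∈f) (x∈⁅x⁆ e))))) ]′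
                (x∈p∪q⁻ I ⁅ f ⁆ e∈))
    , subst (Indep M) swap k
    where
    swap : (I ∪ ⁅ e ⁆) ∪ ⁅ f ⁆ ≡ (I ∪ ⁅ f ⁆) ∪ ⁅ e ⁆
    swap = trans (∪-assoc I ⁅ e ⁆ ⁅ f ⁆)
      (trans (cong (I ∪_) (∪-comm ⁅ e ⁆ ⁅ f ⁆)) (sym (∪-assoc I ⁅ f ⁆ ⁅ e ⁆)))

_⧸_ : Matroid n → Fin n → Matroid n
M ⧸ e with Indep? M ⁅ e ⁆
... | yes indep-e = contractNonloop M e indep-e
... | no  _       = M ∖ e

PairwiseDisjoint : (Fin k → Matroid n) → Set
PairwiseDisjoint Ms = ∀ {i j} → i ≢ j → ∀ {e} → e ∈ E (Ms i) → e ∉ E (Ms j)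

⨁ : (Ms : Fin k → Matroid n) → PairwiseDisjoint Ms → Matroid n
⨁ {k} {n} Ms disjoint = record
  { E          = ⋃ᶠ (E ∘ Ms)
  ; Indep      = Ind
  ; Indep?     = λ I → (I ⊆? ⋃ᶠ (E ∘ Ms)) ×-dec all? (λ j → Indep? (Ms j) (I ∩ E (Ms j)))
  ; indep⊆E    = proj₁
  ; indep-⊥    = ⊆-min _ , λ j → hereditary (Ms j) (indep-⊥ (Ms j)) (p∩q⊆p ⊥ (E (Ms j)))
  ; hereditary = λ {I} {J} (I⊆E , i) J⊆I →
                   (λ x∈ → I⊆E (J⊆I x∈)) ,
                   λ j → hereditary (Ms j) (i j) (∩-monoˡ-⊆ J I (E (Ms j)) J⊆I)
  ; augment    = aug
  }
  where
  Ind : Pred (Subset n) 0ℓ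
  Ind I = I ⊆ ⋃ᶠ (E ∘ Ms) × (∀ j → Indep (Ms j) (I ∩ E (Ms j)))

  absorb : ∀ X → X ⊆ ⋃ᶠ (E ∘ Ms) → X ∩ ⋃ᶠ (E ∘ Ms) ≡ X
  absorb X X⊆ = ⊆-antisym (p∩q⊆p X _) (λ x∈ → x∈p∩q⁺ (x∈ , X⊆ x∈))

  aug : ∀ {I J} → Ind I → Ind J → ∣ I ∣ < ∣ J ∣ → ∃[ e ] e ∈ J × e ∉ I × Ind (I ∪ ⁅ e ⁆)
  aug {I} {J} (I⊆E , i) (J⊆E , j) lt
    with any? (λ l → ∣ I ∩ E (Ms l) ∣ ℕ.<? ∣ J ∩ E (Ms l) ∣)
  ... | no none = ⊥-elim (ℕ.<⇒≱ lt (subst₂ _≤_ (cong ∣_∣ (absorb J J⊆E)) (cong ∣_∣ (absorb I I⊆E))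
                    (∣∩⋃ᶠ∣-mono (E ∘ Ms) I J disjoint (λ l → ℕ.≮⇒≥ (λ lt′ → none (l , lt′))))))
  ... | yes (l , lt′) with augment (Ms l) (i l) (j l) lt′
  ...   | e , e∈J∩E , e∉I∩E , ie = e , proj₁ e∈ , e∉I , I∪e⊆E , ind
    where
    e∈ = x∈p∩q⁻ J (E (Ms l)) e∈J∩E
    e∈E = proj₂ e∈

    e∉I : e ∉ I
    e∉I e∈I = e∉I∩E (x∈p∩q⁺ (e∈I , e∈E))

    I∪e⊆E : I ∪ ⁅ e ⁆ ⊆ ⋃ᶠ (E ∘ Ms)
    I∪e⊆E x∈ with x∈p∪q⁻ I ⁅ e ⁆ x∈
    ... | inj₁ x∈I = I⊆E x∈I
    ... | inj₂ x∈e = J⊆E (subst (_∈ J) (sym (x∈⁅y⁆⇒x≡y e x∈e)) (proj₁ e∈))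

    ind : ∀ m → Indep (Ms m) ((I ∪ ⁅ e ⁆) ∩ E (Ms m))
    ind m with l ≟ᶠ m
    ... | yes refl = hereditary (Ms l) ie sub
      where
      sub : (I ∪ ⁅ e ⁆) ∩ E (Ms l) ⊆ (I ∩ E (Ms l)) ∪ ⁅ e ⁆
      sub x∈ with x∈p∩q⁻ (I ∪ ⁅ e ⁆) _ x∈
      ... | x∈I∪e , x∈E = x∈p∪q⁺ ([ (λ x∈I → inj₁ (x∈p∩q⁺ (x∈I , x∈E))) , inj₂ ]′ (x∈p∪q⁻ I ⁅ e ⁆ x∈I∪e))
    ... | no l≢m = hereditary (Ms m) (i m) sub
      where
      sub : (I ∪ ⁅ e ⁆) ∩ E (Ms m) ⊆ I ∩ E (Ms m)
      sub x∈ with x∈p∩q⁻ (I ∪ ⁅ e ⁆) _ x∈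
      ... | x∈I∪e , x∈E with x∈p∪q⁻ I ⁅ e ⁆ x∈I∪e
      ...   | inj₁ x∈I = x∈p∩q⁺ (x∈I , x∈E)
      ...   | inj₂ x∈e = ⊥-elim (disjoint l≢m e∈E (subst (_∈ E (Ms m)) (x∈⁅y⁆⇒x≡y e x∈e) x∈E))

Connected : Matroid n → Set
Connected M = ∀ {e f} → e ∈ E M → f ∈ E M → e ≢ f → ∃[ C ] IsCircuit M C × e ∈ C × f ∈ C

IsComponent : Matroid n → Pred (Subset n) 0ℓ
IsComponent M T = T ⊆ E M × Connected (M ↾ T) ×
  (∀ {S} → S ⊆ E M → Connected (M ↾ S) → T ⊆ S → S ≡ T)

record ComponentDecomposition (M : Matroid n) : Set where
  field
    size       : ℕ
    T          : Fin size → Subset n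
    components : ∀ S → IsComponent M S ⇔ Range T S
    injective  : Injective _≡_ _≡_ T

  summand : Fin size → Matroid n
  summand i = M ↾ T i

  field
    disjoint   : PairwiseDisjoint summand
    isSum      : M ≈ ⨁ summand disjoint

  precedingSum : Fin size → Matroid n
  precedingSum i = ⨁ (λ (j : Fin′ i) → summand (inject j)) λ j≢l → disjoint (j≢l ∘ inject-injective)
    where
    inject-injective : {j l : Fin′ i} → inject j ≡ inject l → j ≡ l
    inject-injective {j} {l} eq =
      toℕ-injective (trans (sym (toℕ-inject j)) (trans (cong toℕ eq) (toℕ-inject l)))

uniqueUnion : (Fin g → Subset n) → Subset g → Subset n
uniqueUnion A σ = comprehension λ e → ∃!? λ i → (i ∈? σ) ×-dec (e ∈? A i)

-- Since 𝒞 i is always different from 𝒞 j for i ≢ j (otherwise the unique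
-- union over {i , j} would be empty), families and sets are the same here.

IsCycleSystem : (M : Matroid n) → Pred (Fin (corank M) → Subset n) 0ℓ
IsCycleSystem M 𝒞 = (∀ i → IsCycle M (𝒞 i)) × (∀ σ → Nonempty σ → Dependent M (uniqueUnion 𝒞 σ))

IsCircuitSystem : (M : Matroid n) → Pred (Fin (corank M) → Subset n) 0ℓ
IsCircuitSystem M 𝒞 = IsCycleSystem M 𝒞 × (∀ i → IsCircuit M (𝒞 i))

𝔽₂ : Set
𝔽₂ = Bool

open import Algebra.Properties.Monoid.Sum
  (CommutativeRing.+-monoid xor-∧-commutativeRing) using (sum)

linComb : Vector 𝔽₂ k → Vector (Vector 𝔽₂ n) k → Vector 𝔽₂ n
linComb a v e = sum (λ i → a i ∧ v i e)

IsZero : Pred (Vector 𝔽₂ n) 0ℓ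
IsZero v = ∀ e → v e ≡ false

LinIndep : Pred (Vector (Vector 𝔽₂ n) k) 0ℓ
LinIndep v = ∀ a → IsZero (linComb a v) → IsZero a

LinIndepOn : Subset k → Pred (Vector (Vector 𝔽₂ n) k) 0ℓ
LinIndepOn I v = ∀ a → (∀ i → i ∉ I → a i ≡ false) → IsZero (linComb a v) → IsZero a

Span : Pred (Vector 𝔽₂ n) 0ℓ → Pred (Vector 𝔽₂ n) 0ℓ
Span {n} S w = ∃[ m ] ∃[ v ] (∀ i → S (v i)) × ∃[ a ] linComb {k = m} a v ≗ w

IsBasis : Pred (Vector 𝔽₂ n) 0ℓ → Pred (Vector (Vector 𝔽₂ n) k) 0ℓ
IsBasis W v = (∀ i → W (v i)) × LinIndep v × (∀ w → W w → ∃[ a ] linComb a v ≗ w)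

-- Subset n is Vec Bool n, so lookup gives the indicator vector.
indicator : Subset n → Vector 𝔽₂ n
indicator = lookup

-- A subspace of 𝔽₂ⁿ rather than of 𝔽₂ᴱ; its elements vanish outside E M.
CircuitSpace : Matroid n → Pred (Vector 𝔽₂ n) 0ℓ
CircuitSpace M = Span λ v → ∃[ C ] IsCircuit M C × v ≗ indicator C

-- M is represented over 𝔽₂ by the columns ρ e, e ∈ E M.
IsBinary : Matroid n → Set
IsBinary {n} M = ∃[ m ] ∃[ ρ ] ∀ I → I ⊆ E M → Indep M I ⇔ LinIndepOn {k = n} {n = m} I ρ

{-# OPTIONS --safe #-}
-- The proof runs on the nullity ν(X) = |X| - r(X), which is supermodular: a circuit is a set of nullity 1
-- without coloops, deletion shrinks the ground set, and contracting a nonloop e replaces ν(X) by ν(X ∪ e).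
-- The unique union of the whole family contains an element e lying in exactly one cycle C j; dropping
-- C j gives a cycle system of M \ e, and removing e from every cycle gives one of M / e.
-- The key claim is that some connected component Q, of nullity q say, contains q of the cycles, all of
-- them circuits.  By induction it holds for M / e; if the component found there is a proper part of N - e,
-- N the component of M containing e, then C j is among its circuits and Tutte's theorem makes N \ e
-- connected, so the claim for M \ e finishes the argument.  Splitting off Q leaves a cycle system of the
-- rest: given an index set τ avoiding Q, indices inside Q can be added to τ so that the trace
-- on Q becomes independent, which forces dependence outside Q.  The same elimination, run modulo 2, shows
-- that a vector of the circuit space of a binary matroid is a combination of the cycles.

module Submission where

open import Defs
open import Algebra.Bundles using (CommutativeRing)
open import Data.Bool.Base using (true; false; _∧_; _xor_)
import Data.Bool.Properties as Bool
open import Data.Empty using (⊥-elim)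
open import Data.Fin.Base using (Fin; Fin′; zero; suc; toℕ; inject; fromℕ<)
open import Data.Fin.Properties using (any?; all?; suc-injective; toℕ-inject; toℕ-injective; toℕ-fromℕ<)
  renaming (_≟_ to _≟ᶠ_)
open import Data.Fin.Subset renaming (⋃ to ⋃ₛ)
open import Data.Fin.Subset.Properties
open import Data.List.Base as List using (List; []; _∷_; filter)
open import Data.List.Membership.Propositional using () renaming (_∈_ to _∈ₗ_)
open import Data.List.Membership.Propositional.Properties using (∈-map⁺; ∈-map⁻; ∈-filter⁺; ∈-filter⁻; ∈-++⁺ˡ; ∈-++⁺ʳ)
open import Data.List.Relation.Unary.All as All using (All; []; _∷_)
open import Data.List.Relation.Unary.Any as Any using ()
open import Data.Nat.Base using (ℕ; zero; suc; _+_; _∸_; _≤_; _<_; z≤n; s≤s; s≤s⁻¹)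
import Data.Nat.Properties as ℕ
open import Data.List.Extrema ℕ.≤-totalOrder using (argmax-sel; xs≤max)
open import Data.Nat.Tactic.RingSolver using (solve-∀)
open import Data.Product using (Σ-syntax; ∃-syntax; _×_; _,_; proj₁; proj₂)
open import Data.Sum.Base using (_⊎_; inj₁; inj₂; [_,_]′)
open import Data.Vec.Base using ([]; _∷_; here; there; tabulate; lookup)
open import Data.Vec.Functional using (Vector)
open import Data.Vec.Properties using ([]=⇒lookup; lookup⇒[]=; lookup∘tabulate)
open import Function.Base using (_∘_; case_of_)
open import Function.Bundles using (_⇔_; mk⇔; module Equivalence)
open import Relation.Binary.PropositionalEquality
open import Relation.Nullary using (¬_; Dec; yes; no; contradiction)
open import Relation.Nullary.Decidable using (_×-dec_; ¬?)
open import Relation.Unary using (_≐_; ⋃) renaming (_⊥_ to _disjointFrom_)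
open import Algebra.Properties.Monoid.Sum (CommutativeRing.+-monoid Bool.xor-∧-commutativeRing) using (sum)

-- Working with `ν` on all subsets of `Fin n` keeps the types fixed through the induction: deletion
-- changes only the ground set `E`, contraction only the function, and the cycles retain their index
-- type while the set `σ` of live indices shrinks. Matroids reappear only when the results are
-- translated back. Neither minor suffices for the key claim. A component of the contraction may be
-- a mere piece of a component once `e` returns. A component of the deletion may grow when `e`
-- returns, and nothing in the deletion says that `C j`, the cycle needed to match the extra unit of
-- nullity, is a circuit inside it. Each minor repairs the defect of the other: the contraction
-- certifies that `C j` has nullity one, the deletion supplies the component and its remaining
-- circuits. The certificate is a count: a set of nullity `q` contains at most `q` cycles of the
-- family. The connectivity argument is also a count: two uncrossed separations lose one unit of
-- nullity in total, whereas the failure of both corners would lose two.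

private
  variable
    n g k : ℕ

-- Subsets of Fin n

x∈p─q⇒x∉q : (p q : Subset n) {x : Fin n} → x ∈ p ─ q → x ∉ q
x∈p─q⇒x∉q (_ ∷ p) (inside ∷ q)  (there x∈) (there x∈q) = x∈p─q⇒x∉q p q x∈ x∈q
x∈p─q⇒x∉q (_ ∷ p) (outside ∷ q) (there x∈) (there x∈q) = x∈p─q⇒x∉q p q x∈ x∈q

x∈p─q⁻ : (p q : Subset n) {x : Fin n} → x ∈ p ─ q → x ∈ p × x ∉ q
x∈p─q⁻ p q x∈ = p─q⊆p p q x∈ , x∈p─q⇒x∉q p q x∈

x∈p-y⁻ : (p : Subset n) (y : Fin n) {x : Fin n} → x ∈ p - y → x ∈ p × x ≢ y
x∈p-y⁻ p y x∈ with x∈p─q⁻ p ⁅ y ⁆ x∈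
... | x∈p , x∉y = x∈p , x∉⁅y⁆⇒x≢y x∉y

x∈p∪⁅y⁆⁻ : (p : Subset n) (y : Fin n) {x : Fin n} → x ∈ p ∪ ⁅ y ⁆ → x ∈ p ⊎ x ≡ y
x∈p∪⁅y⁆⁻ p y x∈ with x∈p∪q⁻ p ⁅ y ⁆ x∈
... | inj₁ x∈p = inj₁ x∈p
... | inj₂ x∈y = inj₂ (x∈⁅y⁆⇒x≡y y x∈y)

x∈p⇒x∈p∪q : {p q : Subset n} {x : Fin n} → x ∈ p → x ∈ p ∪ q
x∈p⇒x∈p∪q x∈ = x∈p∪q⁺ (inj₁ x∈)

y∈p∪⁅y⁆ : (p : Subset n) (y : Fin n) → y ∈ p ∪ ⁅ y ⁆
y∈p∪⁅y⁆ p y = q⊆p∪q p ⁅ y ⁆ (x∈⁅x⁆ y)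

p∪⁅y⁆⊆q : {p q : Subset n} {y : Fin n} → p ⊆ q → y ∈ q → p ∪ ⁅ y ⁆ ⊆ q
p∪⁅y⁆⊆q {p = p} {y = y} p⊆q y∈q x∈ with x∈p∪⁅y⁆⁻ p y x∈
... | inj₁ x∈p = p⊆q x∈p
... | inj₂ refl = y∈q

⁅x⁆⊆p : {p : Subset n} {x : Fin n} → x ∈ p → ⁅ x ⁆ ⊆ p
⁅x⁆⊆p {p = p} {x} x∈p y∈ = subst (_∈ p) (sym (x∈⁅y⁆⇒x≡y x y∈)) x∈p

p∪⁅y⁆-mono : {p q : Subset n} (y : Fin n) → p ⊆ q → p ∪ ⁅ y ⁆ ⊆ q ∪ ⁅ y ⁆
p∪⁅y⁆-mono {q = q} y p⊆q = p∪⁅y⁆⊆q (x∈p⇒x∈p∪q ∘ p⊆q) (y∈p∪⁅y⁆ q y)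

p⊆q∪⁅y⁆ : {p q : Subset n} (y : Fin n) → (∀ {x} → x ∈ p → x ≢ y → x ∈ q) → p ⊆ q ∪ ⁅ y ⁆
p⊆q∪⁅y⁆ {q = q} y h {x} x∈p with x ≟ᶠ y
... | yes refl = y∈p∪⁅y⁆ q y
... | no x≢y   = x∈p⇒x∈p∪q (h x∈p x≢y)

y∉p-y : (p : Subset n) (y : Fin n) → y ∉ p - y
y∉p-y p y y∈ = proj₂ (x∈p-y⁻ p y y∈) refl

∣p∣≡suc∣p-x∣ : {p : Subset n} {x : Fin n} → x ∈ p → ∣ p ∣ ≡ suc ∣ p - x ∣
∣p∣≡suc∣p-x∣ {p = inside ∷ p} here = cong (λ q → suc ∣ q ∣) (sym (p─⊥≡p p))
∣p∣≡suc∣p-x∣ {p = inside ∷ p} (there x∈) = cong suc (∣p∣≡suc∣p-x∣ x∈)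
∣p∣≡suc∣p-x∣ {p = outside ∷ p} (there x∈) = ∣p∣≡suc∣p-x∣ x∈

∣p∪⁅x⁆∣≡suc∣p∣ : (p : Subset n) {x : Fin n} → x ∉ p → ∣ p ∪ ⁅ x ⁆ ∣ ≡ suc ∣ p ∣
∣p∪⁅x⁆∣≡suc∣p∣ p {x} x∉p = trans (∣p∣≡suc∣p-x∣ (y∈p∪⁅y⁆ p x)) (cong (suc ∘ ∣_∣) (⊆-antisym
  (λ y∈ → let a , b = x∈p-y⁻ (p ∪ ⁅ x ⁆) x y∈ in [ (λ c → c) , (λ c → contradiction c b) ]′ (x∈p∪⁅y⁆⁻ p x a))
  (λ y∈ → x∈p∧x≢y⇒x∈p-y (x∈p⇒x∈p∪q y∈) λ { refl → x∉p y∈ })))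

∣q∣≡∣p∣+∣q─p∣ : (p q : Subset n) → p ⊆ q → ∣ q ∣ ≡ ∣ p ∣ + ∣ q ─ p ∣
∣q∣≡∣p∣+∣q─p∣ [] [] h = refl
∣q∣≡∣p∣+∣q─p∣ (outside ∷ p) (outside ∷ q) h = ∣q∣≡∣p∣+∣q─p∣ p q (drop-∷-⊆ h)
∣q∣≡∣p∣+∣q─p∣ (outside ∷ p) (inside ∷ q)  h = trans (cong suc (∣q∣≡∣p∣+∣q─p∣ p q (drop-∷-⊆ h))) (sym (ℕ.+-suc _ _))
∣q∣≡∣p∣+∣q─p∣ (inside ∷ p)  (outside ∷ q) h with () ← h here
∣q∣≡∣p∣+∣q─p∣ (inside ∷ p)  (inside ∷ q)  h = cong suc (∣q∣≡∣p∣+∣q─p∣ p q (drop-∷-⊆ h))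

∣p∪q∣+∣p∩q∣ : (p q : Subset n) → ∣ p ∪ q ∣ + ∣ p ∩ q ∣ ≡ ∣ p ∣ + ∣ q ∣
∣p∪q∣+∣p∩q∣ []            []            = refl
∣p∪q∣+∣p∩q∣ (outside ∷ p) (outside ∷ q) = ∣p∪q∣+∣p∩q∣ p q
∣p∪q∣+∣p∩q∣ (outside ∷ p) (inside ∷ q)  = trans (cong suc (∣p∪q∣+∣p∩q∣ p q)) (sym (ℕ.+-suc _ _))
∣p∪q∣+∣p∩q∣ (inside ∷ p)  (outside ∷ q) = cong suc (∣p∪q∣+∣p∩q∣ p q)
∣p∪q∣+∣p∩q∣ (inside ∷ p)  (inside ∷ q)  =
  cong suc (trans (ℕ.+-suc _ _) (trans (cong suc (∣p∪q∣+∣p∩q∣ p q)) (sym (ℕ.+-suc _ _))))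

∣p∣<∣q∣⇒∃ : (p q : Subset n) → ∣ p ∣ < ∣ q ∣ → ∃[ x ] x ∈ q × x ∉ p
∣p∣<∣q∣⇒∃ p q lt with nonempty? (q ─ p)
... | yes (x , x∈) = x , x∈p─q⁻ q p x∈
... | no none = contradiction lt (ℕ.≤⇒≯ (p⊆q⇒∣p∣≤∣q∣ q⊆p))
  where
  q⊆p : q ⊆ p
  q⊆p {x} x∈q with x ∈? p
  ... | yes x∈p = x∈p
  ... | no  x∉p = ⊥-elim (none (x , x∈p∧x∉q⇒x∈p─q x∈q x∉p))

Nonempty⇒0<∣p∣ : {p : Subset n} → Nonempty p → 0 < ∣ p ∣
Nonempty⇒0<∣p∣ (x , x∈) = subst (0 <_) (sym (∣p∣≡suc∣p-x∣ x∈)) ℕ.0<1+n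

0<∣p∣⇒Nonempty : (p : Subset n) → 0 < ∣ p ∣ → Nonempty p
0<∣p∣⇒Nonempty {n} p lt with ∣p∣<∣q∣⇒∃ ⊥ p (subst (_< ∣ p ∣) (sym (∣⊥∣≡0 n)) lt)
... | x , x∈ , _ = x , x∈

-- Unique unions and abstract nullity functions

∈uniqueUnion⁻ : (A : Fin g → Subset n) (σ : Subset g) {x : Fin n} → x ∈ uniqueUnion A σ →
                ∃[ i ] i ∈ σ × x ∈ A i × (∀ {k} → k ∈ σ → x ∈ A k → k ≡ i)
∈uniqueUnion⁻ A σ {x} x∈
  with Equivalence.to (∈-comprehension (λ e → ∃!? λ i → (i ∈? σ) ×-dec (e ∈? A i))) x∈
... | i , (i∈ , x∈i) , u = i , i∈ , x∈i , λ k∈ x∈k → sym (u (k∈ , x∈k))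

∈uniqueUnion⁺ : (A : Fin g → Subset n) (σ : Subset g) {x : Fin n} {i : Fin g} →
                i ∈ σ → x ∈ A i → (∀ {k} → k ∈ σ → x ∈ A k → k ≡ i) → x ∈ uniqueUnion A σ
∈uniqueUnion⁺ A σ {x} {i} i∈ x∈i u =
  Equivalence.from (∈-comprehension (λ e → ∃!? λ i → (i ∈? σ) ×-dec (e ∈? A i)))
    (i , (i∈ , x∈i) , λ (k∈ , x∈k) → sym (u k∈ x∈k))

-- `ν-super` accepts any superset `U` of both sets and any superset `I` of their intersection. Given
-- `ν-mono` this is ordinary supermodularity, but no set identity has to be proved where it is
-- applied. `ν-step` is relaxed in the same way: `Y` need only lie in `X` together with `e`.
record Nullity (n : ℕ) : Set where
  field
    ν       : Subset n → ℕ
    ν-⊥     : ν ⊥ ≡ 0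
    ν-mono  : ∀ {X Y} → X ⊆ Y → ν X ≤ ν Y
    ν-step  : ∀ {X Y} e → (∀ {y} → y ∈ Y → y ≢ e → y ∈ X) → ν Y ≤ suc (ν X)
    ν-super : ∀ X Y U I → X ⊆ U → Y ⊆ U → (∀ {x} → x ∈ X → x ∈ Y → x ∈ I) →
              ν X + ν Y ≤ ν U + ν I

  ν-Nonempty : ∀ X → 0 < ν X → Nonempty X
  ν-Nonempty X 0<ν with nonempty? X
  ... | yes ne = ne
  ... | no  ¬ne = contradiction (trans (cong ν (Empty-unique ¬ne)) ν-⊥) (ℕ.>⇒≢ 0<ν)

open Nullity using (ν)

private
  variable
    N : Nullity n
    C : Fin g → Subset n
    σ : Subset g

-- The element `e` remains in `Fin n`; its removal is recorded in the separate ground set. For a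
-- loop the formula would give the empty set nullity 1, hence the nonloop hypothesis.
contract : (N : Nullity n) (e : Fin n) → ν N ⁅ e ⁆ ≡ 0 → Nullity n
contract N e nonloop = record
  { ν       = λ X → ν N (X ∪ ⁅ e ⁆)
  ; ν-⊥     = trans (cong (ν N) (∪-identityˡ ⁅ e ⁆)) nonloop
  ; ν-mono  = λ X⊆Y → ν-mono (p∪⁅y⁆-mono e X⊆Y)
  ; ν-step  = λ {X} {Y} f h → ν-step f λ y∈ y≢f →
      [ (λ y∈Y → x∈p⇒x∈p∪q (h y∈Y y≢f)) , (λ { refl → y∈p∪⁅y⁆ X e }) ]′ (x∈p∪⁅y⁆⁻ Y e y∈)
  ; ν-super = λ X Y U I X⊆U Y⊆U h → ν-super (X ∪ ⁅ e ⁆) (Y ∪ ⁅ e ⁆) (U ∪ ⁅ e ⁆) (I ∪ ⁅ e ⁆)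
      (p∪⁅y⁆-mono e X⊆U) (p∪⁅y⁆-mono e Y⊆U)
      λ x∈X x∈Y → p⊆q∪⁅y⁆ {p = (X ∪ ⁅ e ⁆) ∩ (Y ∪ ⁅ e ⁆)} e
        (λ x∈ x≢e → let a , b = x∈p∩q⁻ (X ∪ ⁅ e ⁆) (Y ∪ ⁅ e ⁆) x∈ in h (strip X a x≢e) (strip Y b x≢e))
        (x∈p∩q⁺ (x∈X , x∈Y))
  }
  where
  open Nullity N hiding (ν)
  strip : ∀ X {x} → x ∈ X ∪ ⁅ e ⁆ → x ≢ e → x ∈ X
  strip X x∈ x≢e = [ (λ x∈X → x∈X) , (λ x≡e → contradiction x≡e x≢e) ]′ (x∈p∪⁅y⁆⁻ X e x∈)

-- One inequality is enough: the opposite one is supermodularity, `split-≥`.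
record Separator (N : Nullity n) (E X : Subset n) : Set where
  constructor mkSep
  field
    ⊆E    : X ⊆ E
    split : ν N E ≤ ν N X + ν N (E ─ X)

record Component (N : Nullity n) (E Q : Subset n) : Set where
  field
    nonempty : Nonempty Q
    sep      : Separator N E Q
    minimal  : ∀ {X} → X ⊆ Q → Nonempty X → Separator N E X → Q ⊆ X
  open Separator sep public

-- Absence of coloops. For the nullity of a matroid, `cycle-cyclic` and `cyclic-cycle` identify
-- these sets, inside the ground set, with the unions of circuits.
Cyclic : Nullity n → Subset n → Set
Cyclic N K = ∀ {x} → x ∈ K → ν N (K - x) < ν N K

record Family (N : Nullity n) (C : Fin g → Subset n) (σ : Subset g) : Set where
  field
    cyclic    : ∀ {i} → i ∈ σ → Cyclic N (C i)
    dependent : ∀ τ → τ ⊆ σ → Nonempty τ → 0 < ν N (uniqueUnion C τ)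

record System (N : Nullity n) (E : Subset n) (C : Fin g → Subset n) (σ : Subset g) : Set where
  field
    family : Family N C σ
    C⊆E    : ∀ {i} → i ∈ σ → C i ⊆ E
    size   : ν N E ≡ ∣ σ ∣
  open Family family public

-- `τ` may be empty, so that a single coloop also counts as a block; see `coloop-block`.
record Block (N : Nullity n) (E : Subset n) (C : Fin g → Subset n) (σ : Subset g) : Set where
  field
    Q         : Subset n
    τ         : Subset g
    component : Component N E Q
    τ⊆σ       : τ ⊆ σ
    size      : ν N Q ≡ ∣ τ ∣
    C⊆Q       : ∀ {i} → i ∈ τ → C i ⊆ Q
    νC≡1      : ∀ {i} → i ∈ τ → ν N (C i) ≡ 1

Family-⊆ : {τ : Subset g} → τ ⊆ σ → Family N C σ → Family N C τ
Family-⊆ τ⊆σ F = record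
  { cyclic    = λ i∈ → cyclic (τ⊆σ i∈)
  ; dependent = λ ρ ρ⊆ → dependent ρ (τ⊆σ ∘ ρ⊆)
  }
  where open Family F

record Pick (C : Fin g → Subset n) (σ : Subset g) : Set where
  field
    e      : Fin n
    j      : Fin g
    j∈σ    : j ∈ σ
    e∈Cj   : e ∈ C j
    unique : ∀ {i} → i ∈ σ → e ∈ C i → i ≡ j

pick : {N : Nullity n} → Family N C σ → Nonempty σ → Pick C σ
pick {C = C} {σ = σ} {N = N} F ne
  with ∈uniqueUnion⁻ C σ (proj₂ (Nullity.ν-Nonempty N _ (Family.dependent F σ (λ i∈ → i∈) ne)))
... | j , j∈ , e∈ , u = record { j∈σ = j∈ ; e∈Cj = e∈ ; unique = u }

-- Separators and minors of a nullity function

module _ (N : Nullity n) where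
  open Nullity N hiding (ν)

  -- By supermodularity the loss of nullity caused by removing `x` can only increase when the set
  -- around `x` grows, so a non-coloop of `K` is a non-coloop of `E`.
  cyclic-delete : ∀ {K E} → Cyclic N K → K ⊆ E → ∀ {x} → x ∈ K → ν N (E - x) < ν N E
  cyclic-delete {K} {E} cyc K⊆E {x} x∈ =
    arith (ν N (K - x)) (ν N (E - x)) (cyc x∈)
      (ν-super K (E - x) E (K - x) K⊆E (p─q⊆p E _)
        λ y∈K y∈E → x∈p∧x≢y⇒x∈p-y y∈K (proj₂ (x∈p-y⁻ E x y∈E)))
    where
    arith : ∀ a b {c d} → a < c → c + b ≤ d + a → b < d
    arith a b {c} {d} a<c h = ℕ.+-cancelˡ-≤ a (suc b) d (begin
      a + suc b ≡⟨ ℕ.+-suc a b ⟩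
      suc a + b ≤⟨ ℕ.+-monoˡ-≤ b a<c ⟩
      c + b     ≤⟨ h ⟩
      d + a     ≡⟨ ℕ.+-comm d a ⟩
      a + d     ∎)
      where open ℕ.≤-Reasoning

  ν-delete : ∀ {E} x → ν N (E - x) < ν N E → ν N E ≡ suc (ν N (E - x))
  ν-delete {E} x lt = ℕ.≤-antisym (ν-step x λ y∈ y≢x → x∈p∧x≢y⇒x∈p-y y∈ y≢x) lt

  -- Supermodularity is used twice, for `Y` with `X` and for `Y ∪ X` with `E ─ X`. In the sum with
  -- `split` the terms for `Y ∪ X`, `X`, `E ─ X` and `E` all cancel.
  split-⊆ : ∀ {E X Y} → Separator N E X → Y ⊆ E → ν N Y ≤ ν N (Y ∩ X) + ν N (Y ─ X)
  split-⊆ {E} {X} {Y} s Y⊆E = arith (ν N Y) (ν N X)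
    (ν-super Y X (Y ∪ X) (Y ∩ X) (p⊆p∪q X) (q⊆p∪q Y X) λ a b → x∈p∩q⁺ (a , b))
    (ν-super (Y ∪ X) (E ─ X) E (Y ─ X)
      ([ Y⊆E , ⊆E ]′ ∘ x∈p∪q⁻ Y X) (p─q⊆p E X) inner)
    split
    where
    open Separator s
    inner : ∀ {x} → x ∈ Y ∪ X → x ∈ E ─ X → x ∈ Y ─ X
    inner a b with x∈p─q⁻ E X b | x∈p∪q⁻ Y X a
    ... | _ , x∉X | inj₁ x∈Y = x∈p∧x∉q⇒x∈p─q x∈Y x∉X
    ... | _ , x∉X | inj₂ x∈X = contradiction x∈X x∉X
    arith : ∀ a x {u i w t d} → a + x ≤ u + i → u + w ≤ t + d → t ≤ x + w → a ≤ i + d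
    arith a x {u} {i} {w} {t} {d} p q r = ℕ.+-cancelˡ-≤ (x + u + w + t) a (i + d)
      (subst₂ _≤_ (lhs a x u w t) (rhs x u w t i d) (ℕ.+-mono-≤ (ℕ.+-mono-≤ p q) r))
      where
      lhs : ∀ a x u w t → ((a + x) + (u + w)) + t ≡ (x + u + w + t) + a
      lhs = solve-∀
      rhs : ∀ x u w t i d → ((u + i) + (t + d)) + (x + w) ≡ (x + u + w + t) + (i + d)
      rhs = solve-∀

  split-≥ : ∀ {E} X Y → X ⊆ E → Y ⊆ E → (∀ {x} → x ∈ X → x ∉ Y) → ν N X + ν N Y ≤ ν N E
  split-≥ {E} X Y X⊆E Y⊆E dis = ℕ.≤-trans
    (ν-super X Y E ⊥ X⊆E Y⊆E (λ a b → ⊥-elim (dis a b)))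
    (ℕ.≤-reflexive (trans (cong (ν N E +_) ν-⊥) (ℕ.+-identityʳ _)))

  split-≡ : ∀ {E X} → Separator N E X → ν N E ≡ ν N X + ν N (E ─ X)
  split-≡ {E} {X} s = ℕ.≤-antisym split
    (split-≥ X (E ─ X) ⊆E (p─q⊆p E X) λ a b → x∈p─q⇒x∉q E X b a)
    where open Separator s

  separator-restrict : ∀ {E X Y Z} → Separator N E X → Y ⊆ E → Z ⊆ Y → Z ⊆ X →
                       (∀ {x} → x ∈ Y → x ∈ X → x ∈ Z) → Separator N Y Z
  separator-restrict {E} {X} {Y} {Z} s Y⊆E Z⊆Y Z⊆X h = mkSep Z⊆Y
    (ℕ.≤-trans (split-⊆ s Y⊆E) (ℕ.+-mono-≤
      (ν-mono λ x∈ → let a , b = x∈p∩q⁻ Y X x∈ in h a b)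
      (ν-mono λ x∈ → let a , b = x∈p─q⁻ Y X x∈ in x∈p∧x∉q⇒x∈p─q a (b ∘ Z⊆X))))

  separator-trans : ∀ {E F X} → Separator N E F → Separator N F X → Separator N E X
  separator-trans {E} {F} {X} s t = mkSep (S.⊆E ∘ T.⊆E) (begin
    ν N E                                    ≤⟨ S.split ⟩
    ν N F + ν N (E ─ F)                      ≤⟨ ℕ.+-monoˡ-≤ _ T.split ⟩
    (ν N X + ν N (F ─ X)) + ν N (E ─ F)      ≡⟨ ℕ.+-assoc (ν N X) _ _ ⟩
    ν N X + (ν N (F ─ X) + ν N (E ─ F))      ≤⟨ ℕ.+-monoʳ-≤ (ν N X) (split-≥ (F ─ X) (E ─ F)
      (λ x∈ → let a , b = x∈p─q⁻ F X x∈ in x∈p∧x∉q⇒x∈p─q (S.⊆E a) b)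
      (λ x∈ → let a , b = x∈p─q⁻ E F x∈ in x∈p∧x∉q⇒x∈p─q a (b ∘ T.⊆E))
      λ a b → x∈p─q⇒x∉q E F b (p─q⊆p F X a)) ⟩
    ν N X + ν N (E ─ X)                      ∎)
    where
    open ℕ.≤-Reasoning
    module S = Separator s
    module T = Separator t

  separator-─ : ∀ {E X} → Separator N E X → Separator N E (E ─ X)
  separator-─ {E} {X} s = mkSep (p─q⊆p E X) (ℕ.≤-trans split (ℕ.≤-trans (ℕ.≤-reflexive (ℕ.+-comm (ν N X) _))
    (ℕ.+-monoʳ-≤ (ν N (E ─ X)) (ν-mono λ x∈ → x∈p∧x∉q⇒x∈p─q (⊆E x∈) λ x∈' → x∈p─q⇒x∉q E X x∈' x∈))))
    where open Separator s

  component-widen : ∀ {E F Q} → F ⊆ E → Separator N E Q → Component N F Q → Component N E Q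
  component-widen F⊆E s c = record
    { nonempty = nonempty
    ; sep      = s
    ; minimal  = λ X⊆Q ne t → minimal X⊆Q ne
        (separator-restrict t F⊆E (⊆E ∘ X⊆Q) (λ x∈ → x∈) (λ _ x∈ → x∈))
    }
    where open Component c

  component-lift : ∀ {E F Q} → Separator N E F → Component N F Q → Component N E Q
  component-lift s c = component-widen (Separator.⊆E s) (separator-trans s (Component.sep c)) c

  -- If `K` met both sides of the separator, `K ∩ X` and `K ─ X` would both miss a point of `K` and
  -- have nullity 0, while `split-⊆` makes their nullities add up to at least 1.
  circuit-separator : ∀ {E X K} → Separator N E X → Cyclic N K → ν N K ≡ 1 → K ⊆ E →
                      ∀ {x} → x ∈ K → x ∈ X → K ⊆ X
  circuit-separator {E} {X} {K} s cyc one K⊆E {x} x∈K x∈X {y} y∈K with y ∈? X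
  ... | yes y∈X = y∈X
  ... | no  y∉X = contradiction (split-⊆ s K⊆E) (ℕ.<⇒≱ (subst₂ (λ a b → a + b < ν N K) (sym zero₁) (sym zero₂)
                    (subst (0 <_) (sym one) ℕ.0<1+n)))
    where
    small : ∀ {z L} → z ∈ K → L ⊆ K - z → ν N L ≡ 0
    small {z} z∈ L⊆ = ℕ.n<1⇒n≡0 (ℕ.≤-<-trans (ν-mono L⊆) (subst (ν N (K - z) <_) one (cyc z∈)))
    zero₁ : ν N (K ∩ X) ≡ 0
    zero₁ = small y∈K λ z∈ → let a , b = x∈p∩q⁻ K X z∈ in x∈p∧x≢y⇒x∈p-y a λ { refl → y∉X b }
    zero₂ : ν N (K ─ X) ≡ 0
    zero₂ = small x∈K λ z∈ → let a , b = x∈p─q⁻ K X z∈ in x∈p∧x≢y⇒x∈p-y a λ { refl → b x∈X }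

  -- `X`, `Y` come from a separation of the deletion of `e`, and `X′`, `Y′` from one of the
  -- contraction. Supermodularity for `X` with `X′ ∪ ⁅ e ⁆` and for `Y` with `Y′ ∪ ⁅ e ⁆` bounds the
  -- four corner terms below by `2 ν E - 1`. If neither corner separated, they would sum to at most
  -- `2 ν E - 2`.
  uncross : ∀ {E} e X Y X′ Y′ → e ∈ E → X ⊆ E - e → Y ⊆ E - e → X′ ⊆ E - e → Y′ ⊆ E - e →
            (∀ {x} → x ∈ X → x ∉ Y) → (∀ {x} → x ∈ X′ → x ∉ Y′) →
            ν N E ≤ suc (ν N X + ν N Y) → ν N E ≤ ν N (X′ ∪ ⁅ e ⁆) + ν N (Y′ ∪ ⁅ e ⁆) →
            Separator N E (X ∩ X′) ⊎ Separator N E (Y ∩ Y′)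
  uncross {E} e X Y X′ Y′ e∈E X⊆ Y⊆ X′⊆ Y′⊆ dis dis′ h h′
    with ν N E ℕ.≤? ν N (X ∩ X′) + ν N (E ─ (X ∩ X′)) | ν N E ℕ.≤? ν N (Y ∩ Y′) + ν N (E ─ (Y ∩ Y′))
  ... | yes p | _     = inj₁ (mkSep (p─q⊆p E _ ∘ X⊆ ∘ p∩q⊆p X X′) p)
  ... | no _  | yes q = inj₂ (mkSep (p─q⊆p E _ ∘ Y⊆ ∘ p∩q⊆p Y Y′) q)
  ... | no ¬p | no ¬q = ⊥-elim (arith (ν N X) (ν N Y) (ν N (X′ ∪ ⁅ e ⁆)) (ν N (Y′ ∪ ⁅ e ⁆)) 
          (ν N (Y ∩ Y′)) (ν N (E ─ (Y ∩ Y′))) (ν N (X ∩ X′)) (ν N (E ─ (X ∩ X′))) h h′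
          (half X X′ Y Y′ X⊆ Y⊆ X′⊆ Y′⊆ dis dis′)
          (half Y Y′ X X′ Y⊆ X⊆ Y′⊆ X′⊆ (λ a b → dis b a) (λ a b → dis′ b a)) (ℕ.≰⇒> ¬p) (ℕ.≰⇒> ¬q))
    where
    half : ∀ X X′ Y Y′ → X ⊆ E - e → Y ⊆ E - e → X′ ⊆ E - e → Y′ ⊆ E - e →
           (∀ {x} → x ∈ X → x ∉ Y) → (∀ {x} → x ∈ X′ → x ∉ Y′) →
           ν N X + ν N (X′ ∪ ⁅ e ⁆) ≤ ν N (E ─ (Y ∩ Y′)) + ν N (X ∩ X′)
    half X X′ Y Y′ X⊆ Y⊆ X′⊆ Y′⊆ dis dis′ = ν-super X (X′ ∪ ⁅ e ⁆) (E ─ (Y ∩ Y′)) (X ∩ X′)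
      (λ a → x∈p∧x∉q⇒x∈p─q (p─q⊆p E _ (X⊆ a)) λ b → dis a (p∩q⊆p Y Y′ b))
      (p∪⁅y⁆⊆q (λ a → x∈p∧x∉q⇒x∈p─q (p─q⊆p E _ (X′⊆ a)) λ b → dis′ a (p∩q⊆q Y Y′ b))
        (x∈p∧x∉q⇒x∈p─q e∈E λ b → y∉p-y E e (Y⊆ (p∩q⊆p Y Y′ b))))
      λ a b → x∈p∩q⁺ (a , [ (λ c → c) , (λ { refl → ⊥-elim (y∉p-y E e (X⊆ a)) }) ]′ (x∈p∪⁅y⁆⁻ X′ e b))
    arith : ∀ {t} x y x′ y′ a b c d → t ≤ suc (x + y) → t ≤ x′ + y′ → x + x′ ≤ b + c → y + y′ ≤ d + a →
            c + d < t → ¬ (a + b < t)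
    arith {t} x y x′ y′ a b c d p q r s u v = ℕ.<-irrefl refl
      (ℕ.+-cancelˡ-≤ (x + y + x′ + y′ + (t + t)) _ _ (subst₂ _≤_ (lhs t x y x′ y′ a b c d) (rhs t x y x′ y′ a b c d)
        (ℕ.+-mono-≤ (ℕ.+-mono-≤ (ℕ.+-mono-≤ p q) (ℕ.+-mono-≤ r s)) (ℕ.+-mono-≤ u v))))
      where
      lhs : ∀ t x y x′ y′ a b c d → (t + t) + ((x + x′) + (y + y′)) + (suc (c + d) + suc (a + b)) ≡
            (x + y + x′ + y′ + (t + t)) + suc (suc (a + b + c + d))
      lhs = solve-∀
      rhs : ∀ t x y x′ y′ a b c d → (suc (x + y) + (x′ + y′)) + ((b + c) + (d + a)) + (t + t) ≡
            (x + y + x′ + y′ + (t + t)) + suc (a + b + c + d)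
      rhs = solve-∀

  -- No remaining cycle passes through `e`, and `e` is not a coloop, so the nullity and the number
  -- of cycles both drop by exactly one.
  delete-system : ∀ {E} {C : Fin g → Subset n} {σ} → System N E C σ → (p : Pick C σ) →
                  let open Pick p in System N (E - e) C (σ - j)
  delete-system {E = E} {C} {σ} S p = record
    { family = Family-⊆ (p─q⊆p σ _) family
    ; C⊆E    = λ i∈ x∈ → let i∈σ , i≢j = x∈p-y⁻ σ j i∈ in
                 x∈p∧x≢y⇒x∈p-y (C⊆E i∈σ x∈) λ { refl → i≢j (unique i∈σ x∈) }
    ; size   = ℕ.suc-injective (trans (sym (ν-delete e (cyclic-delete (cyclic j∈σ) (C⊆E j∈σ) e∈Cj)))
                 (trans size (∣p∣≡suc∣p-x∣ j∈σ)))
    }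
    where
    open System S
    open Pick p

  contract-cyclic : ∀ {K} e (nl : ν N ⁅ e ⁆ ≡ 0) → Cyclic N K → Cyclic (contract N e nl) (K - e)
  contract-cyclic {K} e nl cyc {x} x∈ with x∈p-y⁻ K e x∈
  ... | x∈K , x≢e = ℕ.≤-<-trans (ν-mono shrink) (ℕ.<-≤-trans
      (cyclic-delete {E = K ∪ ⁅ e ⁆} cyc (p⊆p∪q ⁅ e ⁆) x∈K)
      (ν-mono (p∪⁅y⁆⊆q (p⊆q∪⁅y⁆ e x∈p∧x≢y⇒x∈p-y) (y∈p∪⁅y⁆ (K - e) e))))
    where
    shrink : (K - e - x) ∪ ⁅ e ⁆ ⊆ (K ∪ ⁅ e ⁆) - x
    shrink = p∪⁅y⁆⊆q
      (λ y∈ → let a , b = x∈p-y⁻ (K - e) x y∈ in x∈p∧x≢y⇒x∈p-y (x∈p⇒x∈p∪q (p─q⊆p K _ a)) b)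
      (x∈p∧x≢y⇒x∈p-y (y∈p∪⁅y⁆ K e) (x≢e ∘ sym))

  uniqueUnion-─ : (C : Fin g → Subset n) (Z : Subset n) (τ : Subset g) →
                  uniqueUnion C τ ─ Z ⊆ uniqueUnion (λ i → C i ─ Z) τ
  uniqueUnion-─ C Z τ x∈ with x∈p─q⁻ (uniqueUnion C τ) Z x∈
  ... | x∈U , x∉Z with ∈uniqueUnion⁻ C τ x∈U
  ... | i , i∈ , x∈C , u = ∈uniqueUnion⁺ _ τ i∈ (x∈p∧x∉q⇒x∈p─q x∈C x∉Z)
                             λ {k} k∈ x∈k → u k∈ (p─q⊆p (C k) Z x∈k)

  -- Contraction of a nonloop preserves the nullity of the ground set, so every index survives.
  -- Dependence survives because putting `e` back into the new unique union covers the old one.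
  contract-system : ∀ {E e} {C : Fin g → Subset n} {σ} → System N E C σ → e ∈ E → (nl : ν N ⁅ e ⁆ ≡ 0) →
                    System (contract N e nl) (E - e) (λ i → C i - e) σ
  contract-system {E = E} {e} {C} {σ} S e∈E nl = record
    { family = record
      { cyclic    = λ i∈ → contract-cyclic e nl (cyclic i∈)
      ; dependent = λ τ τ⊆ ne → ℕ.<-≤-trans (dependent τ τ⊆ ne)
          (ν-mono (p⊆q∪⁅y⁆ e λ x∈ x≢e → uniqueUnion-─ C ⁅ e ⁆ τ (x∈p∧x≢y⇒x∈p-y x∈ x≢e)))
      }
    ; C⊆E  = λ {i} i∈ x∈ → let a , b = x∈p-y⁻ (C i) e x∈ in x∈p∧x≢y⇒x∈p-y (C⊆E i∈ a) b
    ; size = trans (ℕ.≤-antisym (ν-mono (p∪⁅y⁆⊆q (p─q⊆p E _) e∈E)) (ν-mono (p⊆q∪⁅y⁆ e x∈p∧x≢y⇒x∈p-y))) size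
    }
    where open System S

  -- A picked element lies in one cycle only. Removing it from `X` costs that cycle and at least one
  -- unit of nullity.
  family-bound : ∀ k {X} {C : Fin g → Subset n} {σ} → ∣ σ ∣ ≡ k → Family N C σ →
                 (∀ {i} → i ∈ σ → C i ⊆ X) → k ≤ ν N X
  family-bound zero    eq F C⊆ = z≤n
  family-bound (suc k) {X} {C} {σ} eq F C⊆ = ℕ.≤-<-trans
    (family-bound k {X - e} (ℕ.suc-injective (trans (sym (∣p∣≡suc∣p-x∣ j∈σ)) eq)) (Family-⊆ (p─q⊆p σ _) F)
      λ i∈ x∈ → let i∈σ , i≢j = x∈p-y⁻ σ j i∈ in x∈p∧x≢y⇒x∈p-y (C⊆ i∈σ x∈) λ { refl → i≢j (unique i∈σ x∈) })
    (cyclic-delete (Family.cyclic F j∈σ) (C⊆ j∈σ) e∈Cj)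
    where
    open Pick (pick F (0<∣p∣⇒Nonempty σ (subst (0 <_) (sym eq) ℕ.0<1+n)))

-- Finding a component tiled by circuits of the family

module _ (N : Nullity n) where
  open Nullity N hiding (ν)

  separator-≡ : ∀ {E X Y} → Separator N E X → X ⊆ Y → Y ⊆ X → Separator N E Y
  separator-≡ {E} s X⊆Y Y⊆X = subst (Separator N E) (⊆-antisym X⊆Y Y⊆X) s

  contract-separator : ∀ {E X e} (nl : ν N ⁅ e ⁆ ≡ 0) → e ∈ E → Separator N E X →
                       Separator (contract N e nl) (E - e) (X - e)
  contract-separator {E} {X} {e} nl e∈E s = mkSep
    (λ x∈ → let a , b = x∈p-y⁻ X e x∈ in x∈p∧x≢y⇒x∈p-y (⊆E a) b)
    (ℕ.≤-trans (ν-mono (p∪⁅y⁆⊆q (p─q⊆p E _) e∈E)) (ℕ.≤-trans split (ℕ.+-mono-≤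
      (ν-mono (p⊆q∪⁅y⁆ e x∈p∧x≢y⇒x∈p-y))
      (ν-mono (p⊆q∪⁅y⁆ e λ x∈ x≢e → let a , b = x∈p─q⁻ E X x∈ in
        x∈p∧x∉q⇒x∈p─q (x∈p∧x≢y⇒x∈p-y a x≢e) (b ∘ p─q⊆p X _))))))
    where open Separator s

  -- An element that is neither a loop nor a coloop does not form a separator by itself.
  cyclic-bridge : ∀ {E X e} → ν N ⁅ e ⁆ ≡ 0 → ν N (E - e) < ν N E → Separator N E X → Nonempty X →
                  Nonempty (X - e)
  cyclic-bridge {E} {X} {e} nl lt s (x , x∈) with nonempty? (X - e)
  ... | yes ne = ne
  ... | no ¬ne = contradiction (ℕ.≤-trans split (ℕ.+-mono-≤ (ν-mono X⊆e) (ν-mono E─X⊆)))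
                   (ℕ.<⇒≱ (subst (λ a → a + ν N (E - e) < ν N E) (sym nl) lt))
    where
    open Separator s
    only : ∀ {y} → y ∈ X → y ≡ e
    only {y} y∈ with y ≟ᶠ e
    ... | yes y≡e = y≡e
    ... | no  y≢e = ⊥-elim (¬ne (y , x∈p∧x≢y⇒x∈p-y y∈ y≢e))
    X⊆e : X ⊆ ⁅ e ⁆
    X⊆e y∈ = subst (_∈ ⁅ e ⁆) (sym (only y∈)) (x∈⁅x⁆ e)
    E─X⊆ : E ─ X ⊆ E - e
    E─X⊆ y∈ = let a , b = x∈p─q⁻ E X y∈ in x∈p∧x≢y⇒x∈p-y a λ { refl → b (subst (_∈ X) (only x∈) x∈) }

  -- A nonempty separator inside `Q ∪ ⁅ e ⁆` has a point other than `e` by `cyclic-bridge`, hence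
  -- contains `Q`. It contains `e` as well, for otherwise it would equal `Q`, which does not
  -- separate.
  component-extend : ∀ {E Q e} → ν N ⁅ e ⁆ ≡ 0 → ν N (E - e) < ν N E → ¬ Separator N E Q →
                     Separator N E (Q ∪ ⁅ e ⁆) →
                     (∀ {Z} → Separator N E Z → Z - e ⊆ Q → Nonempty (Z - e) → Q ⊆ Z) →
                     Component N E (Q ∪ ⁅ e ⁆)
  component-extend {E} {Q} {e} nl lt ¬s s h = record
    { nonempty = e , y∈p∪⁅y⁆ Q e
    ; sep      = s
    ; minimal  = min
    }
    where
    min : ∀ {X} → X ⊆ Q ∪ ⁅ e ⁆ → Nonempty X → Separator N E X → Q ∪ ⁅ e ⁆ ⊆ X
    min {X} X⊆ ne t = p∪⁅y⁆⊆q Q⊆X e∈X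
      where
      strip : ∀ {x} → x ∈ X → x ≢ e → x ∈ Q
      strip x∈ x≢e = [ (λ a → a) , (λ a → contradiction a x≢e) ]′ (x∈p∪⁅y⁆⁻ Q e (X⊆ x∈))
      Q⊆X : Q ⊆ X
      Q⊆X = h t (λ x∈ → let a , b = x∈p-y⁻ X e x∈ in strip a b) (cyclic-bridge nl lt t ne)
      e∈X : e ∈ X
      e∈X with e ∈? X
      ... | yes e∈ = e∈
      ... | no  e∉ = ⊥-elim (¬s (separator-≡ t (λ x∈ → strip x∈ λ { refl → e∉ x∈ }) Q⊆X))

  0<νC : ∀ {C : Fin g → Subset n} {σ i} → Family N C σ → i ∈ σ → 0 < ν N (C i)
  0<νC {C = C} {σ} {i} F i∈ = ℕ.<-≤-trans (Family.dependent F ⁅ i ⁆ (⁅x⁆⊆p i∈) (i , x∈⁅x⁆ i))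
    (ν-mono λ {x} x∈ → let k , k∈ , x∈k , _ = ∈uniqueUnion⁻ C ⁅ i ⁆ x∈ in
      subst (λ k → x ∈ C k) (x∈⁅y⁆⇒x≡y i k∈) x∈k)

  single-block : ∀ {E} {C : Fin g → Subset n} {σ} → System N E C σ → Pick C σ → ∣ σ ∣ ≡ 1 → Block N E C σ
  single-block {E = E} {C} {σ} S p one = record
    { Q         = C j
    ; τ         = ⁅ j ⁆
    ; component = record
      { nonempty = e , e∈Cj
      ; sep      = mkSep (C⊆E j∈σ) (ℕ.≤-trans (ℕ.≤-reflexive νE≡1) (ℕ.≤-trans 0<νCj (ℕ.m≤m+n _ _)))
      ; minimal  = min
      }
    ; τ⊆σ       = ⁅x⁆⊆p j∈σ
    ; size      = trans νCj≡1 (sym (∣⁅x⁆∣≡1 j))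
    ; C⊆Q       = λ {i} i∈ {x} → subst (λ k → x ∈ C k) (x∈⁅y⁆⇒x≡y j i∈)
    ; νC≡1      = λ i∈ → trans (cong (λ k → ν N (C k)) (x∈⁅y⁆⇒x≡y j i∈)) νCj≡1
    }
    where
    open System S
    open Pick p
    νE≡1 : ν N E ≡ 1
    νE≡1 = trans size one
    0<νCj : 0 < ν N (C j)
    0<νCj = 0<νC family j∈σ
    νCj≡1 : ν N (C j) ≡ 1
    νCj≡1 = ℕ.≤-antisym (subst (ν N (C j) ≤_) νE≡1 (ν-mono (C⊆E j∈σ))) 0<νCj
    min : ∀ {X} → X ⊆ C j → Nonempty X → Separator N E X → C j ⊆ X
    min {X} X⊆ (x , x∈X) s = circuit-separator N s (cyclic j∈σ) νCj≡1 (C⊆E j∈σ) (X⊆ x∈X) x∈X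

  -- A loop carries exactly the unit of nullity lost by its deletion, so `E - e` is a separator and
  -- components of the deletion are components of `E`.
  block-loop : ∀ {E} {C : Fin g → Subset n} {σ} → System N E C σ → (p : Pick C σ) →
               let open Pick p in 0 < ν N ⁅ e ⁆ → Block N (E - e) C (σ - j) → Block N E C σ
  block-loop {E = E} {σ = σ} S p loop b = record
    { Q         = Q
    ; τ         = τ
    ; component = component-lift N sepE-e component
    ; τ⊆σ       = p─q⊆p σ _ ∘ τ⊆σ
    ; size      = size
    ; C⊆Q       = C⊆Q
    ; νC≡1      = νC≡1
    }
    where
    open System S using (cyclic; C⊆E)
    open Pick p
    open Block b
    sepE-e : Separator N E (E - e)
    sepE-e = mkSep (p─q⊆p E _) (begin
      ν N E                              ≡⟨ ν-delete N e (cyclic-delete N (cyclic j∈σ) (C⊆E j∈σ) e∈Cj) ⟩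
      suc (ν N (E - e))                  ≡⟨ ℕ.+-comm 1 _ ⟩
      ν N (E - e) + 1                    ≤⟨ ℕ.+-monoʳ-≤ (ν N (E - e)) (ℕ.≤-trans loop
                                              (ν-mono (⁅x⁆⊆p (x∈p∧x∉q⇒x∈p─q (C⊆E j∈σ e∈Cj) (y∉p-y E e))))) ⟩
      ν N (E - e) + ν N (E ─ (E - e))    ∎)
      where open ℕ.≤-Reasoning

  -- `Q` is a component of the contraction. If `e` is a coloop of `Q ∪ ⁅ e ⁆`, then `Q` already
  -- separates `E`. If `e` is a coloop of `E ─ Q`, then `Q ∪ ⁅ e ⁆` separates `E`. Otherwise neither
  -- set separates: contracting `e` has broken up the component containing it, and the block `B₂` of
  -- the deletion is called on.
  module Nonloop {E : Subset n} {C : Fin g → Subset n} {σ : Subset g} (S : System N E C σ) (p : Pick C σ)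
    (nl : ν N ⁅ Pick.e p ⁆ ≡ 0)
    (B : Block (contract N (Pick.e p) nl) (E - Pick.e p) (λ i → C i - Pick.e p) σ)
    (B₂ : Block N (E - Pick.e p) C (σ - Pick.j p)) where

    open Pick p
    open System S
    open Block B using (Q; τ; τ⊆σ)
    module B  = Block B
    module Q  = Component B.component
    module B₂ = Block B₂
    module Q₂ = Component B₂.component

    e∈E : e ∈ E
    e∈E = C⊆E j∈σ e∈Cj

    lt : ν N (E - e) < ν N E
    lt = cyclic-delete N (cyclic j∈σ) (C⊆E j∈σ) e∈Cj

    contract-split : ν N E ≤ ν N (Q ∪ ⁅ e ⁆) + ν N ((E - e ─ Q) ∪ ⁅ e ⁆)
    contract-split = ℕ.≤-trans (ν-mono (p⊆q∪⁅y⁆ e x∈p∧x≢y⇒x∈p-y)) Q.split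

    E─Q⊆ : E ─ Q ⊆ (E - e ─ Q) ∪ ⁅ e ⁆
    E─Q⊆ = p⊆q∪⁅y⁆ e λ x∈ x≢e → let a , b = x∈p─q⁻ E Q x∈ in x∈p∧x∉q⇒x∈p─q (x∈p∧x≢y⇒x∈p-y a x≢e) b

    ⊆E─Q : (E - e ─ Q) ∪ ⁅ e ⁆ ⊆ E ─ Q
    ⊆E─Q = p∪⁅y⁆⊆q (λ x∈ → let a , b = x∈p─q⁻ (E - e) Q x∈ in x∈p∧x∉q⇒x∈p─q (p─q⊆p E _ a) b)
                    (x∈p∧x∉q⇒x∈p─q e∈E (y∉p-y E e ∘ Q.⊆E))

    split≤ : ν N E ≤ ν N (Q ∪ ⁅ e ⁆) + ν N (E ─ Q)
    split≤ = ℕ.≤-trans contract-split (ℕ.+-monoʳ-≤ _ (ν-mono ⊆E─Q))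

    split≥ : ν N (Q ∪ ⁅ e ⁆) + ν N (E ─ Q) ≤ ν N E
    split≥ = ℕ.≤-trans (ℕ.+-monoʳ-≤ _ (ν-mono E─Q⊆))
      (ℕ.≤-trans (ℕ.≤-reflexive (sym (split-≡ _ Q.sep))) (ν-mono (p∪⁅y⁆⊆q (p─q⊆p E _) e∈E)))

    minimalQ : ∀ {Z} → Separator N E Z → Z - e ⊆ Q → Nonempty (Z - e) → Q ⊆ Z
    minimalQ {Z} s Z⊆ ne = p─q⊆p Z _ ∘ Q.minimal Z⊆ ne (contract-separator nl e∈E s)

    C⊆Q∪e : ∀ {i} → i ∈ τ → C i ⊆ Q ∪ ⁅ e ⁆
    C⊆Q∪e i∈ = p⊆q∪⁅y⁆ e λ x∈ x≢e → B.C⊆Q i∈ (x∈p∧x≢y⇒x∈p-y x∈ x≢e)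

    νC≡1 : ∀ {i} → i ∈ τ → ν N (C i) ≡ 1
    νC≡1 {i} i∈ = ℕ.≤-antisym
      (ℕ.≤-trans (ν-mono (p⊆q∪⁅y⁆ e x∈p∧x≢y⇒x∈p-y)) (ℕ.≤-reflexive (B.νC≡1 i∈)))
      (0<νC family (τ⊆σ i∈))

    block-coloop : ν N (Q ∪ ⁅ e ⁆) ≤ ν N Q → Block N E C σ
    block-coloop h = record
      { Q         = Q
      ; τ         = τ
      ; component = record
        { nonempty = Q.nonempty
        ; sep      = mkSep (p─q⊆p E _ ∘ Q.⊆E) (ℕ.≤-trans split≤ (ℕ.+-monoˡ-≤ _ h))
        ; minimal  = λ X⊆Q (x , x∈) s → minimalQ s (X⊆Q ∘ p─q⊆p _ _)
            (x , x∈p∧x≢y⇒x∈p-y x∈ λ { refl → e∉Q (X⊆Q x∈) })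
        }
      ; τ⊆σ       = τ⊆σ
      ; size      = trans (ℕ.≤-antisym (ν-mono (p⊆p∪q ⁅ e ⁆)) h) B.size
      ; C⊆Q       = λ i∈ x∈ → B.C⊆Q i∈ (x∈p∧x≢y⇒x∈p-y x∈ λ { refl → contradiction h (ℕ.<⇒≱ (grow i∈ x∈)) })
      ; νC≡1      = νC≡1
      }
      where
      e∉Q : e ∉ Q
      e∉Q = y∉p-y E e ∘ Q.⊆E
      grow : ∀ {i} → i ∈ τ → e ∈ C i → ν N Q < ν N (Q ∪ ⁅ e ⁆)
      grow i∈ e∈ = ℕ.≤-<-trans (ν-mono λ x∈ → x∈p∧x≢y⇒x∈p-y (x∈p⇒x∈p∪q x∈) λ { refl → e∉Q x∈ })
        (cyclic-delete N (cyclic (τ⊆σ i∈)) (C⊆Q∪e i∈) e∈)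

    module _ (grow : ν N Q < ν N (Q ∪ ⁅ e ⁆)) where

      -- Otherwise all cycles of `τ` would avoid `e` and lie in `Q`, whose nullity is smaller than
      -- the size of `τ`, against `family-bound`. This membership is what gives `C j` nullity 1.
      j∈τ : j ∈ τ
      j∈τ with j ∈? τ
      ... | yes j∈ = j∈
      ... | no  j∉ = contradiction (family-bound N ∣ τ ∣ refl (Family-⊆ τ⊆σ family) inQ)
                       (ℕ.<⇒≱ (subst (ν N Q <_) B.size grow))
        where
        inQ : ∀ {i} → i ∈ τ → C i ⊆ Q
        inQ i∈ x∈ = B.C⊆Q i∈ (x∈p∧x≢y⇒x∈p-y x∈ λ { refl → j∉ (subst (_∈ τ) (unique (τ⊆σ i∈) x∈) i∈) })

      ¬sepQ : ¬ Separator N E Q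
      ¬sepQ s = ℕ.<⇒≱ (ℕ.+-monoˡ-< (ν N (E ─ Q)) grow) (ℕ.≤-trans split≥ (Separator.split s))

      inQ : ∀ {Z} → Separator N E Z → Z ⊆ Q → Empty Z
      inQ s Z⊆ (z , z∈) = ¬sepQ (separator-≡ s Z⊆ (minimalQ s (Z⊆ ∘ p─q⊆p _ _)
        (z , x∈p∧x≢y⇒x∈p-y z∈ λ { refl → y∉p-y E e (Q.⊆E (Z⊆ z∈)) })))

      block-bridge : ν N (E ─ Q) ≤ ν N (E - e ─ Q) → Block N E C σ
      block-bridge h = record
        { Q         = Q ∪ ⁅ e ⁆
        ; τ         = τ
        ; component = component-extend nl lt ¬sepQ
            (mkSep (p∪⁅y⁆⊆q (p─q⊆p E _ ∘ Q.⊆E) e∈E)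
              (ℕ.≤-trans split≤ (ℕ.+-monoʳ-≤ _ (ℕ.≤-trans h (ν-mono λ x∈ →
                let a , b = x∈p─q⁻ (E - e) Q x∈ ; c , d = x∈p-y⁻ E e a in
                x∈p∧x∉q⇒x∈p─q c ([ b , d ]′ ∘ x∈p∪⁅y⁆⁻ Q e))))))
            minimalQ
        ; τ⊆σ       = τ⊆σ
        ; size      = B.size
        ; C⊆Q       = C⊆Q∪e
        ; νC≡1      = νC≡1
        }

      module _ (h : ν N (E - e ─ Q) < ν N (E ─ Q)) (¬sepQ₂ : ¬ Separator N E B₂.Q) where

        P₂ Y Y₂ : Subset n
        P₂ = B₂.Q
        Y  = E - e ─ Q
        Y₂ = E - e ─ P₂

        ¬sepY : ¬ Separator N E Y
        ¬sepY s = ℕ.<⇒≱ (ℕ.+-monoʳ-< (ν N (Q ∪ ⁅ e ⁆)) h) (ℕ.≤-trans split≥ (ℕ.≤-trans (Separator.split s)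
          (ℕ.≤-trans (ℕ.≤-reflexive (ℕ.+-comm (ν N Y) _)) (ℕ.+-monoˡ-≤ (ν N Y) (ν-mono
            (p⊆q∪⁅y⁆ e λ {x} x∈ x≢e → inside-Q x∈ x≢e))))))
          where
          inside-Q : ∀ {x} → x ∈ E ─ Y → x ≢ e → x ∈ Q
          inside-Q {x} x∈ x≢e with x ∈? Q
          ... | yes x∈Q = x∈Q
          ... | no  x∉Q = let a , b = x∈p─q⁻ E Y x∈ in ⊥-elim (b (x∈p∧x∉q⇒x∈p─q (x∈p∧x≢y⇒x∈p-y a x≢e) x∉Q))

        inP₂ : ∀ {Z} → Separator N E Z → Z ⊆ P₂ → Empty Z
        inP₂ s Z⊆ ne = ¬sepQ₂ (separator-≡ s Z⊆ (Q₂.minimal Z⊆ ne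
          (separator-restrict N s (p─q⊆p E _) (Q₂.⊆E ∘ Z⊆) (λ x∈ → x∈) (λ _ x∈ → x∈))))

        νE : ν N E ≡ suc (ν N P₂ + ν N Y₂)
        νE = trans (ν-delete N e lt) (cong suc (split-≡ N Q₂.sep))

        Y₂⊆ : Y₂ ⊆ E - e
        Y₂⊆ = p─q⊆p (E - e) P₂

        Y⊆ : Y ⊆ E - e
        Y⊆ = p─q⊆p (E - e) Q

        -- The separation `P₂`, `Y₂` of the deletion is uncrossed with `Q`, `Y` in both orders. A
        -- separator of `E` inside `P₂` or inside `Q` is empty. Three of the four outcomes therefore
        -- empty `P₂`, empty `Q`, or turn `Y` into a separator; in the last one `Y₂` coincides with
        -- `Y₂ ∩ Y`.
        sepY₂ : Separator N E Y₂
        sepY₂ with uncross N e P₂ Y₂ Q Y e∈E Q₂.⊆E Y₂⊆ Q.⊆E Y⊆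
                     (λ a b → x∈p─q⇒x∉q (E - e) P₂ b a) (λ a b → x∈p─q⇒x∉q (E - e) Q b a)
                     (ℕ.≤-reflexive νE) contract-split
                 | uncross N e P₂ Y₂ Y Q e∈E Q₂.⊆E Y₂⊆ Y⊆ Q.⊆E
                     (λ a b → x∈p─q⇒x∉q (E - e) P₂ b a) (λ a b → x∈p─q⇒x∉q (E - e) Q a b)
                     (ℕ.≤-reflexive νE) (ℕ.≤-trans contract-split (ℕ.≤-reflexive (ℕ.+-comm (ν N (Q ∪ ⁅ e ⁆)) _)))
        ... | inj₁ s | inj₁ t = let x , x∈ = Q₂.nonempty in
          ⊥-elim (inP₂ t (p∩q⊆p P₂ Y) (x , x∈p∩q⁺ (x∈ , x∈p∧x∉q⇒x∈p─q (Q₂.⊆E x∈)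
            λ x∈Q → inP₂ s (p∩q⊆p P₂ Q) (x , x∈p∩q⁺ (x∈ , x∈Q)))))
        ... | inj₁ s | inj₂ t = let x , x∈ = Q.nonempty in
          ⊥-elim (inQ t (p∩q⊆q Y₂ Q) (x , x∈p∩q⁺ (x∈p∧x∉q⇒x∈p─q (Q.⊆E x∈)
            (λ x∈P → inP₂ s (p∩q⊆p P₂ Q) (x , x∈p∩q⁺ (x∈P , x∈))) , x∈)))
        ... | inj₂ s | inj₁ t = ⊥-elim (¬sepY (separator-≡ s (p∩q⊆q Y₂ Y) λ {x} x∈ →
          x∈p∩q⁺ (x∈p∧x∉q⇒x∈p─q (Y⊆ x∈) (λ x∈P → inP₂ t (p∩q⊆p P₂ Y) (x , x∈p∩q⁺ (x∈P , x∈))) , x∈)))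
        ... | inj₂ s | inj₂ t = separator-≡ s (p∩q⊆p Y₂ Y) λ {x} x∈ →
          x∈p∩q⁺ (x∈ , x∈p∧x∉q⇒x∈p─q (Y₂⊆ x∈) (λ x∈Q → inQ t (p∩q⊆q Y₂ Q) (x , x∈p∩q⁺ (x∈ , x∈Q))))

        P₂∪e≡ : E ─ Y₂ ≡ P₂ ∪ ⁅ e ⁆
        P₂∪e≡ = ⊆-antisym
          (p⊆q∪⁅y⁆ e λ {x} x∈ x≢e → inside-P₂ x∈ x≢e)
          (p∪⁅y⁆⊆q (λ x∈ → x∈p∧x∉q⇒x∈p─q (p─q⊆p E _ (Q₂.⊆E x∈)) λ x∈Y → x∈p─q⇒x∉q (E - e) P₂ x∈Y x∈)
                   (x∈p∧x∉q⇒x∈p─q e∈E (y∉p-y E e ∘ Y₂⊆)))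
          where
          inside-P₂ : ∀ {x} → x ∈ E ─ Y₂ → x ≢ e → x ∈ P₂
          inside-P₂ {x} x∈ x≢e with x ∈? P₂
          ... | yes x∈P = x∈P
          ... | no  x∉P = let a , b = x∈p─q⁻ E Y₂ x∈ in ⊥-elim (b (x∈p∧x∉q⇒x∈p─q (x∈p∧x≢y⇒x∈p-y a x≢e) x∉P))

        sepP₂∪e : Separator N E (P₂ ∪ ⁅ e ⁆)
        sepP₂∪e = subst (Separator N E) P₂∪e≡ (separator-─ N sepY₂)

        νP₂∪e : ν N (P₂ ∪ ⁅ e ⁆) ≡ suc (ν N P₂)
        νP₂∪e = ℕ.+-cancelˡ-≡ (ν N Y₂) _ _ (trans (cong (λ X → ν N Y₂ + ν N X) (sym P₂∪e≡))
          (trans (sym (split-≡ N sepY₂)) (trans νE (trans (cong suc (ℕ.+-comm (ν N P₂) _)) (sym (ℕ.+-suc _ _))))))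

        block-tutte : Block N E C σ
        block-tutte = record
          { Q         = P₂ ∪ ⁅ e ⁆
          ; τ         = B₂.τ ∪ ⁅ j ⁆
          ; component = component-extend nl lt ¬sepQ₂ sepP₂∪e λ {Z} s Z⊆ ne → p─q⊆p Z _ ∘ Q₂.minimal Z⊆ ne
              (separator-restrict N s (p─q⊆p E _) (Q₂.⊆E ∘ Z⊆) (p─q⊆p Z _)
                λ a b → x∈p∧x≢y⇒x∈p-y b (proj₂ (x∈p-y⁻ E e a)))
          ; τ⊆σ       = p∪⁅y⁆⊆q (p─q⊆p σ _ ∘ B₂.τ⊆σ) j∈σ
          ; size      = trans νP₂∪e (trans (cong suc B₂.size) (sym (∣p∪⁅x⁆∣≡suc∣p∣ B₂.τ (y∉p-y σ j ∘ B₂.τ⊆σ))))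
          ; C⊆Q       = λ i∈ → [ (λ a x∈ → x∈p⇒x∈p∪q (B₂.C⊆Q a x∈))
              -- `C j` contains `e` and has nullity 1, so it cannot straddle the separator
              -- `P₂ ∪ ⁅ e ⁆`. It supplies the one cycle by which the count for `P₂` falls short.
              , (λ { refl → circuit-separator N sepP₂∪e (cyclic j∈σ) (νC≡1 j∈τ) (C⊆E j∈σ) e∈Cj (y∈p∪⁅y⁆ P₂ e) }) ]′
              (x∈p∪⁅y⁆⁻ B₂.τ j i∈)
          ; νC≡1      = λ i∈ → [ B₂.νC≡1 , (λ { refl → νC≡1 j∈τ }) ]′ (x∈p∪⁅y⁆⁻ B₂.τ j i∈)
          }

      block-delete : ν N (E - e ─ Q) < ν N (E ─ Q) → Block N E C σ
      block-delete h with ν N E ℕ.≤? ν N B₂.Q + ν N (E ─ B₂.Q)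
      ... | no ¬s = block-tutte h (¬s ∘ Separator.split)
      ... | yes s = record
        { Q         = B₂.Q
        ; τ         = B₂.τ
        ; component = component-widen N (p─q⊆p E _) (mkSep (p─q⊆p E _ ∘ Q₂.⊆E) s) B₂.component
        ; τ⊆σ       = p─q⊆p σ _ ∘ B₂.τ⊆σ
        ; size      = B₂.size
        ; C⊆Q       = B₂.C⊆Q
        ; νC≡1      = B₂.νC≡1
        }

    block-nonloop : Block N E C σ
    block-nonloop with ν N (Q ∪ ⁅ e ⁆) ℕ.≤? ν N Q | ν N (E ─ Q) ℕ.≤? ν N (E - e ─ Q)
    ... | yes h | _     = block-coloop h
    ... | no ¬h | yes h = block-bridge (ℕ.≰⇒> ¬h) h
    ... | no ¬h | no ¬k = block-delete (ℕ.≰⇒> ¬h) (ℕ.≰⇒> ¬k)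

block : ∀ k {N : Nullity n} {E} {C : Fin g → Subset n} {σ} → ∣ E ∣ < k → System N E C σ → Nonempty σ → Block N E C σ
block (suc k) {N} {E} {C} {σ} (s≤s E≤k) S ne = cases (∣ σ ∣ ℕ.≟ 1) (ν N ⁅ e ⁆ ℕ.≟ 0)
  where
  open System S
  p : Pick C σ
  p = pick family ne
  open Pick p
  smaller : ∣ E - e ∣ < k
  smaller = ℕ.<-≤-trans (x∈p⇒∣p-x∣<∣p∣ (C⊆E j∈σ e∈Cj)) E≤k
  deleted : ∣ σ ∣ ≢ 1 → Block N (E - e) C (σ - j)
  deleted ≢1 = block k smaller (delete-system N S p)
    (0<∣p∣⇒Nonempty (σ - j) (ℕ.n≢0⇒n>0 λ z → ≢1 (trans (∣p∣≡suc∣p-x∣ j∈σ) (cong suc z))))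
  cases : Dec (∣ σ ∣ ≡ 1) → Dec (ν N ⁅ e ⁆ ≡ 0) → Block N E C σ
  -- With a single cycle the deletion would have an empty index set, to which the induction does not
  -- apply.
  cases (yes one) _         = single-block N S p one
  cases (no ≢1)   (no loop) = block-loop N S p (ℕ.n≢0⇒n>0 loop) (deleted ≢1)
  cases (no ≢1)   (yes nl)  = Nonloop.block-nonloop N S p nl
    (block k smaller (contract-system N S (C⊆E j∈σ e∈Cj) nl) ne) (deleted ≢1)

-- Elimination and decomposition

-- D ρ is a set depending on ρ ⊆ [g] whose membership at x is decided by
-- {i ∈ ρ : x ∈ C i}, and from which x is removed by adding to ρ one more C j through x.
record Toggling (C : Fin g → Subset n) (D : Subset g → Subset n) : Set where
  field
    local  : ∀ {ρ ρ′ x} → (∀ {i} → x ∈ C i → i ∈ ρ → i ∈ ρ′) → (∀ {i} → x ∈ C i → i ∈ ρ′ → i ∈ ρ) →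
             x ∈ D ρ → x ∈ D ρ′
    toggle : ∀ {ρ j x} → x ∈ C j → j ∉ ρ → x ∈ D ρ → x ∉ D (ρ ∪ ⁅ j ⁆)

uniqueUnion-toggling : (C : Fin g → Subset n) → Toggling C (uniqueUnion C)
uniqueUnion-toggling C = record
  { local  = λ {ρ} {ρ′} f b x∈ → let i , i∈ , x∈i , u = ∈uniqueUnion⁻ C ρ x∈ in
      ∈uniqueUnion⁺ C ρ′ (f x∈i i∈) x∈i λ k∈ x∈k → u (b x∈k k∈) x∈k
  ; toggle = λ {ρ} {j} x∈j j∉ x∈ x∈′ →
      let i , i∈ , x∈i , _ = ∈uniqueUnion⁻ C ρ x∈
          k , _ , _ , u = ∈uniqueUnion⁻ C (ρ ∪ ⁅ j ⁆) x∈′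
      in j∉ (subst (_∈ ρ) (trans (u (x∈p⇒x∈p∪q i∈) x∈i) (sym (u (y∈p∪⁅y⁆ ρ j) x∈j))) i∈)
  }

toggle-off : {C : Fin g → Subset n} {D : Subset g → Subset n} → Toggling C D → ∀ ρ₀ {j e} → e ∈ C j → j ∉ ρ₀ →
             ∃[ ρ ] e ∉ D ρ × (∀ {i} → i ≢ j → (i ∈ ρ → i ∈ ρ₀) × (i ∈ ρ₀ → i ∈ ρ))
toggle-off {D = D} t ρ₀ {j} {e} e∈Cj j∉ with e ∈? D ρ₀
... | no e∉  = ρ₀ , e∉ , λ _ → (λ x → x) , (λ x → x)
... | yes e∈ = ρ₀ ∪ ⁅ j ⁆ , Toggling.toggle t e∈Cj j∉ e∈ ,
  λ i≢j → (λ i∈ → [ (λ a → a) , (λ a → contradiction a i≢j) ]′ (x∈p∪⁅y⁆⁻ ρ₀ j i∈)) , x∈p⇒x∈p∪q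

-- Elements are deleted one at a time, each lying in a single remaining C j; toggling j keeps the
-- deleted element out of D ρ, until the ground set is independent.
eliminate : ∀ k {N : Nullity n} {E} {C : Fin g → Subset n} {σ ρ₀ D} → ∣ σ ∣ ≡ k → System N E C σ → Toggling C D →
            (∀ {i} → i ∈ σ → i ∉ ρ₀) →
            ∃[ ρ ] (∀ {i} → i ∉ σ → (i ∈ ρ → i ∈ ρ₀) × (i ∈ ρ₀ → i ∈ ρ)) × ν N (D ρ ∩ E) ≡ 0
eliminate zero {N} {E} {ρ₀ = ρ₀} {D} eq S t dis = ρ₀ , (λ _ → (λ x → x) , (λ x → x)) ,
  ℕ.n≤0⇒n≡0 (ℕ.≤-trans (ν-mono (p∩q⊆q (D ρ₀) E)) (ℕ.≤-reflexive (trans (System.size S) eq)))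
  where open Nullity N using (ν-mono)
eliminate (suc k) {N} {E} {C} {σ} {ρ₀} {D} eq S t dis =
  let ρ′ , e∉ , agree = toggle-off t ρ₀ e∈Cj (dis j∈σ)
      ρ , agree′ , zero-ν = eliminate k (ℕ.suc-injective (trans (sym (∣p∣≡suc∣p-x∣ j∈σ)) eq)) (delete-system N S p) t
        (λ i∈ i∈ρ′ → let i∈σ , i≢j = x∈p-y⁻ σ j i∈ in dis i∈σ (proj₁ (agree i≢j) i∈ρ′))
      -- `C j` was the only live cycle through `e`, so the later toggles do not involve `e` and
      -- `local` preserves its absence.
      e∉ρ : e ∉ D ρ
      e∉ρ e∈ = e∉ (local (λ e∈i → proj₁ (agree′ (off e∈i))) (λ e∈i → proj₂ (agree′ (off e∈i))) e∈)
  in ρ , (λ i∉ → let a , b = agree′ (i∉ ∘ p─q⊆p σ _)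
                     c , d = agree λ { refl → i∉ j∈σ }
                 in c ∘ a , b ∘ d)
       , ℕ.n≤0⇒n≡0 (subst (ν N (D ρ ∩ E) ≤_) zero-ν (ν-mono λ x∈ → let a , b = x∈p∩q⁻ (D ρ) E x∈ in
           x∈p∩q⁺ (a , x∈p∧x≢y⇒x∈p-y b λ { refl → e∉ρ a })))
  where
  open Nullity N using (ν-mono)
  open System S
  open Toggling t
  p : Pick C σ
  p = pick family (0<∣p∣⇒Nonempty σ (subst (0 <_) (sym eq) ℕ.0<1+n))
  open Pick p
  off : ∀ {i} → e ∈ C i → i ∉ σ - j
  off e∈i i∈ = let i∈σ , i≢j = x∈p-y⁻ σ j i∈ in i≢j (unique i∈σ e∈i)

module _ (N : Nullity n) where
  open Nullity N hiding (ν)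

  -- When `L` and `L′` together carry all the nullity of `K`, a coloop of `L` would be a coloop of
  -- `K`.
  cyclic-part : ∀ {K L L′} → Cyclic N K → L ⊆ K → L′ ⊆ K → (∀ {x} → x ∈ L → x ∉ L′) →
                ν N K ≤ ν N L + ν N L′ → Cyclic N L
  cyclic-part {K} {L} {L′} cyc L⊆ L′⊆ dis h {x} x∈ = ℕ.+-cancelʳ-< (ν N L′) _ _ (begin-strict
    ν N (L - x) + ν N L′ ≤⟨ split-≥ N (L - x) L′
                              (λ y∈ → let a , b = x∈p-y⁻ L x y∈ in x∈p∧x≢y⇒x∈p-y (L⊆ a) b)
                              (λ y∈ → x∈p∧x≢y⇒x∈p-y (L′⊆ y∈) λ { refl → dis x∈ y∈ })
                              (dis ∘ p─q⊆p L _) ⟩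
    ν N (K - x)          <⟨ cyc (L⊆ x∈) ⟩
    ν N K                ≤⟨ h ⟩
    ν N L + ν N L′       ∎)
    where open ℕ.≤-Reasoning

  cyclic-∩ : ∀ {E X K} → Separator N E X → K ⊆ E → Cyclic N K → Cyclic N (K ∩ X)
  cyclic-∩ {E} {X} {K} s K⊆E cyc = cyclic-part cyc (p∩q⊆p K X) (p─q⊆p K X)
    (λ a b → x∈p─q⇒x∉q K X b (p∩q⊆q K X a)) (split-⊆ N s K⊆E)

  cyclic-─ : ∀ {E X K} → Separator N E X → K ⊆ E → Cyclic N K → Cyclic N (K ─ X)
  cyclic-─ {E} {X} {K} s K⊆E cyc = cyclic-part cyc (p─q⊆p K X) (p∩q⊆p K X)
    (λ a b → x∈p─q⇒x∉q K X a (p∩q⊆q K X b))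
    (ℕ.≤-trans (split-⊆ N s K⊆E) (ℕ.≤-reflexive (ℕ.+-comm (ν N (K ∩ X)) _)))

  quotient-system : ∀ {E} {C : Fin g → Subset n} {σ} → System N E C σ → (B : Block N E C σ) → let open Block B in
                    System N (E ─ Q) (λ i → C i ─ Q) (σ ─ τ)
  quotient-system {E = E} {C} {σ} S B = record
    { family = record
      { cyclic    = λ i∈ → cyclic-─ sep (C⊆E (p─q⊆p σ τ i∈)) (cyclic (p─q⊆p σ τ i∈))
      ; dependent = λ ρ ρ⊆ ne → ℕ.<-≤-trans (dep ρ ρ⊆ ne) (ν-mono (uniqueUnion-─ N C Q ρ))
      }
    ; C⊆E  = λ {i} i∈ x∈ → let a , b = x∈p─q⁻ (C i) Q x∈ in x∈p∧x∉q⇒x∈p─q (C⊆E (p─q⊆p σ τ i∈) a) b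
    ; size = ℕ.+-cancelˡ-≡ ∣ τ ∣ _ _ (trans (cong (_+ ν N (E ─ Q)) (sym Blk.size))
        (trans (sym (split-≡ N sep)) (trans size (∣q∣≡∣p∣+∣q─p∣ τ σ τ⊆σ))))
    }
    where
    module Blk = Block B
    open Block B hiding (size)
    open Component component using (sep)
    open System S
    blockSystem : System N Q C τ
    blockSystem = record { family = Family-⊆ τ⊆σ family ; C⊆E = C⊆Q ; size = Blk.size }
    dep : ∀ ρ → ρ ⊆ σ ─ τ → Nonempty ρ → 0 < ν N (uniqueUnion C ρ ─ Q)
    dep ρ ρ⊆ (i , i∈) =
      let ρ′ , agree , zero-ν = eliminate ∣ τ ∣ {ρ₀ = ρ} refl blockSystem (uniqueUnion-toggling C)
            (λ k∈τ k∈ρ → x∈p─q⇒x∉q σ τ (ρ⊆ k∈ρ) k∈τ)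
          U = uniqueUnion C ρ′
          ρ′⊆σ : ρ′ ⊆ σ
          ρ′⊆σ {k} k∈ = case k ∈? τ of λ
            { (yes k∈τ) → τ⊆σ k∈τ
            ; (no k∉τ)  → p─q⊆p σ τ (ρ⊆ (proj₁ (agree k∉τ) k∈)) }
          U⊆E : U ⊆ E
          U⊆E x∈ = let k , k∈ , x∈k , _ = ∈uniqueUnion⁻ C ρ′ x∈ in C⊆E (ρ′⊆σ k∈) x∈k
          -- Only indices in `τ` are changed, and their cycles stay inside `Q`. Off `Q` the unique
          -- unions over `ρ` and `ρ′` thus agree, so the nullity found for `ρ′` is nullity for `ρ`.
          off : ∀ {k x} → x ∉ Q → x ∈ C k → k ∉ τ
          off x∉Q x∈k k∈τ = x∉Q (C⊆Q k∈τ x∈k)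
      in ℕ.<-≤-trans (dependent ρ′ ρ′⊆σ (i , proj₂ (agree (x∈p─q⇒x∉q σ τ (ρ⊆ i∈))) i∈))
        (ℕ.≤-trans (split-⊆ N sep U⊆E) (subst (λ a → a + ν N (U ─ Q) ≤ ν N (uniqueUnion C ρ ─ Q)) (sym zero-ν)
          (ν-mono λ x∈ → let a , b = x∈p─q⁻ U Q x∈ in x∈p∧x∉q⇒x∈p─q
            (Toggling.local (uniqueUnion-toggling C) (λ x∈k → proj₁ (agree (off b x∈k)))
              (λ x∈k → proj₂ (agree (off b x∈k))) a) b)))

  coloop-block : ∀ {E} {C : Fin g → Subset n} {σ x} → System N E C σ → Empty σ → x ∈ E → Block N E C σ
  coloop-block {g = g} {E} {C} {σ} {x} S ¬ne x∈ = record
    { Q         = ⁅ x ⁆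
    ; τ         = ⊥
    ; component = record
      { nonempty = x , x∈⁅x⁆ x
      ; sep      = mkSep (⁅x⁆⊆p x∈) (ℕ.≤-trans (ℕ.≤-reflexive νE≡0) z≤n)
      ; minimal  = λ {X} X⊆ (y , y∈) _ → ⁅x⁆⊆p (subst (_∈ X) (x∈⁅y⁆⇒x≡y x (X⊆ y∈)) y∈)
      }
    ; τ⊆σ       = ⊆-min σ
    ; size      = trans (ℕ.n≤0⇒n≡0 (subst (ν N ⁅ x ⁆ ≤_) νE≡0 (ν-mono (⁅x⁆⊆p x∈)))) (sym (∣⊥∣≡0 g))
    ; C⊆Q       = λ i∈ → ⊥-elim (∉⊥ i∈)
    ; νC≡1      = λ i∈ → ⊥-elim (∉⊥ i∈)
    }
    where
    νE≡0 : ν N E ≡ 0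
    νE≡0 = trans (System.size S) (trans (cong ∣_∣ (Empty-unique ¬ne)) (∣⊥∣≡0 g))

record Decomposition (N : Nullity n) (E : Subset n) (C : Fin g → Subset n) (σ : Subset g) : Set where
  field
    size      : ℕ
    T         : Fin size → Subset n
    τ         : Fin size → Subset g
    component : ∀ l → Component N E (T l)
    cover     : ∀ {x} → x ∈ E → ∃[ l ] x ∈ T l
    disjoint  : ∀ {l m x} → x ∈ T l → x ∈ T m → l ≡ m
    indices   : ∀ {i} → i ∈ σ → ∃[ l ] i ∈ τ l
    τ⊆σ       : ∀ l → τ l ⊆ σ
    size-τ    : ∀ l → ν N (T l) ≡ ∣ τ l ∣
    order     : ∀ {l m i x} → i ∈ τ l → x ∈ C i → x ∈ T m → toℕ m ≤ toℕ l
    νC∩T≡1    : ∀ {l i} → i ∈ τ l → ν N (C i ∩ T l) ≡ 1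
    dependent : ∀ l ρ → ρ ⊆ τ l → Nonempty ρ → 0 < ν N (uniqueUnion C ρ ∩ T l)

-- The cycles of the block stay inside `Q`, whereas the others may spill into it. Giving the block
-- index zero is what makes `order` hold.
prepend : {N : Nullity n} {E : Subset n} {C : Fin g → Subset n} {σ : Subset g} → System N E C σ →
          (B : Block N E C σ) (let open Block B) →
          Decomposition N (E ─ Q) (λ i → C i ─ Q) (σ ─ τ) → Decomposition N E C σ
prepend {N = N} {E} {C} {σ} S B D = record
  { size      = suc D.size
  ; T         = T′
  ; τ         = τ′
  ; component = λ { zero → component ; (suc l) → component-lift N (separator-─ N sep) (D.component l) }
  ; cover     = cover
  ; disjoint  = λ { {zero} {zero} a b → refl
                  ; {zero} {suc m} a b → ⊥-elim (T∌Q m b a)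
                  ; {suc l} {zero} a b → ⊥-elim (T∌Q l a b)
                  ; {suc l} {suc m} a b → cong suc (D.disjoint a b) }
  ; indices   = indices
  ; τ⊆σ       = λ { zero → τ⊆σ ; (suc l) → p─q⊆p σ τ ∘ D.τ⊆σ l }
  ; size-τ    = λ { zero → size ; (suc l) → D.size-τ l }
  ; order     = λ { {zero} {zero} i∈ a b → z≤n
                  ; {zero} {suc m} i∈ a b → ⊥-elim (T∌Q m b (C⊆Q i∈ a))
                  ; {suc l} {zero} i∈ a b → z≤n
                  ; {suc l} {suc m} i∈ a b → s≤s (D.order i∈ (x∈p∧x∉q⇒x∈p─q a (T∌Q m b)) b) }
  ; νC∩T≡1    = λ { {zero} i∈ → trans (cong (ν N) (⊆-antisym (p∩q⊆p _ Q) λ y∈ → x∈p∩q⁺ (y∈ , C⊆Q i∈ y∈))) (νC≡1 i∈)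
                  ; {suc l} {i} i∈ → trans (cong (ν N) (⊆-antisym
                      (λ y∈ → let a , b = x∈p∩q⁻ (C i) (D.T l) y∈ in x∈p∩q⁺ (x∈p∧x∉q⇒x∈p─q a (T∌Q l b) , b))
                      (λ y∈ → let a , b = x∈p∩q⁻ (C i ─ Q) (D.T l) y∈ in x∈p∩q⁺ (p─q⊆p (C i) Q a , b)))) (D.νC∩T≡1 i∈) }
  ; dependent = λ { zero ρ ρ⊆ ne → ℕ.<-≤-trans (System.dependent S ρ (τ⊆σ ∘ ρ⊆) ne) (ν-mono λ y∈ →
                      let k , k∈ , y∈k , _ = ∈uniqueUnion⁻ C ρ y∈ in x∈p∩q⁺ (y∈ , C⊆Q (ρ⊆ k∈) y∈k))
                  ; (suc l) ρ ρ⊆ ne → ℕ.<-≤-trans (D.dependent l ρ ρ⊆ ne) (ν-mono λ y∈ →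
                      let a , b = x∈p∩q⁻ (uniqueUnion (λ i → C i ─ Q) ρ) (D.T l) y∈
                          i , i∈ , y∈i , u = ∈uniqueUnion⁻ (λ i → C i ─ Q) ρ a
                      in x∈p∩q⁺ (∈uniqueUnion⁺ C ρ i∈ (p─q⊆p (C i) Q y∈i)
                           (λ k∈ y∈k → u k∈ (x∈p∧x∉q⇒x∈p─q y∈k (T∌Q l b))) , b)) }
  }
  where
  open Nullity N using (ν-mono)
  open Block B
  open Component component using (sep)
  module D = Decomposition D
  T′ : Fin (suc D.size) → Subset _
  T′ zero    = Q
  T′ (suc l) = D.T l
  τ′ : Fin (suc D.size) → Subset _
  τ′ zero    = τ
  τ′ (suc l) = D.τ l
  T∌Q : ∀ l {y} → y ∈ D.T l → y ∉ Q
  T∌Q l y∈ = x∈p─q⇒x∉q E Q (Component.⊆E (D.component l) y∈)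
  cover : ∀ {y} → y ∈ E → ∃[ l ] y ∈ T′ l
  cover {y} y∈ with y ∈? Q
  ... | yes y∈Q = zero , y∈Q
  ... | no  y∉Q = let l , y∈T = D.cover (x∈p∧x∉q⇒x∈p─q y∈ y∉Q) in suc l , y∈T
  indices : ∀ {i} → i ∈ σ → ∃[ l ] i ∈ τ′ l
  indices {i} i∈ with i ∈? τ
  ... | yes i∈τ = zero , i∈τ
  ... | no  i∉τ = let l , i∈l = D.indices (x∈p∧x∉q⇒x∈p─q i∈ i∉τ) in suc l , i∈l

decompose : ∀ k {N : Nullity n} {E} {C : Fin g → Subset n} {σ} → ∣ E ∣ < k → System N E C σ → Decomposition N E C σ
decompose (suc k) {N} {E} {C} {σ} (s≤s E≤k) S with nonempty? E
... | no ¬ne = record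
  { size = 0
  ; T = λ () ; τ = λ () ; component = λ ()
  ; cover = λ x∈ → ⊥-elim (¬ne (_ , x∈))
  ; disjoint = λ { {()} }
  ; indices = λ {i} i∈ → contradiction (trans (sym size) (trans (cong (ν N) (Empty-unique ¬ne)) ν-⊥))
      (ℕ.>⇒≢ (Nonempty⇒0<∣p∣ (i , i∈)))
  ; τ⊆σ = λ () ; size-τ = λ () ; order = λ { {()} } ; νC∩T≡1 = λ { {()} } ; dependent = λ ()
  }
  where
  open System S
  open Nullity N using (ν-⊥)
... | yes (x , x∈) = prepend S B (decompose k
    (ℕ.<-≤-trans (p∩q≢∅⇒∣p─q∣<∣p∣ E Q (let y , y∈ = nonempty in y , x∈p∩q⁺ (⊆E y∈ , y∈))) E≤k) (quotient-system N S B))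
  where
  blk : Dec (Nonempty σ) → Block N E C σ
  blk (yes ne) = block _ ℕ.≤-refl S ne
  blk (no ¬ne) = coloop-block N S ¬ne x∈
  B : Block N E C σ
  B = blk (nonempty? σ)
  open Block B
  open Component component using (nonempty; ⊆E)

-- Circuits through two elements of a component

Irreducible : Nullity n → Subset n → Set
Irreducible N E = ∀ {X} → Separator N E X → Nonempty X → E ⊆ X

record Circuit-through (N : Nullity n) (E : Subset n) (e f : Fin n) : Set where
  field
    D      : Subset n
    D⊆E    : D ⊆ E
    cyclic : Cyclic N D
    ν≡1    : ν N D ≡ 1
    e∈D    : e ∈ D
    f∈D    : f ∈ D

component-irreducible : ∀ {E Q} → Component N E Q → Irreducible N Q
component-irreducible {N = N} c s ne = Component.minimal c (Separator.⊆E s) ne (separator-trans N (Component.sep c) s)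

separator? : (N : Nullity n) (E X : Subset n) → Dec (Separator N E X)
separator? N E X = dec (X ⊆? E) (ν N E ℕ.≤? ν N X + ν N (E ─ X))
  where
  dec : Dec (X ⊆ E) → Dec (ν N E ≤ ν N X + ν N (E ─ X)) → Dec (Separator N E X)
  dec (yes X⊆E) (yes split) = yes (mkSep X⊆E split)
  dec (no X⊈E)  _           = no (λ s → X⊈E (Separator.⊆E s))
  dec _         (no ¬split) = no (¬split ∘ Separator.split)

irreducible-⁅⁆ : (N : Nullity n) {E : Subset n} {e f : Fin n} → Irreducible N E → e ∈ E → f ∈ E → e ≢ f →
                 ν N ⁅ e ⁆ + ν N (E - e) < ν N E
irreducible-⁅⁆ N {e = e} irr e∈ f∈ e≢f = ℕ.≰⇒> λ h →
  e≢f (sym (x∈⁅y⁆⇒x≡y e (irr (mkSep (⁅x⁆⊆p e∈) h) (e , x∈⁅x⁆ e) f∈)))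

-- Tutte's theorem.
irreducible-contract : (N : Nullity n) {E X : Subset n} {x : Fin n} (nl : ν N ⁅ x ⁆ ≡ 0) → Irreducible N E → x ∈ E →
                       Separator N (E - x) X → Nonempty X → ¬ (E - x ⊆ X) → Irreducible (contract N x nl) (E - x)
irreducible-contract N {E} {X} {x} nl irr x∈E s (a , a∈X) ¬⊆ {X′} s′ (a′ , a′∈X′) {y} y∈ with y ∈? X′
... | yes y∈X′ = y∈X′
... | no  y∉X′ = ⊥-elim (¬⊆ λ {z} z∈ → member z∈ (z ∈? X))
  where
  open Nullity N hiding (ν)
  E′ Y Y′ : Subset _
  E′ = E - x
  Y  = E′ ─ X
  Y′ = E′ ─ X′
  X⊆ : X ⊆ E′
  X⊆ = Separator.⊆E s
  X′⊆ : X′ ⊆ E′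
  X′⊆ = Separator.⊆E s′
  y∈Y′ : y ∈ Y′
  y∈Y′ = x∈p∧x∉q⇒x∈p─q y∈ y∉X′
  νE≤ : ν N E ≤ suc (ν N X + ν N Y)
  νE≤ = ℕ.≤-trans (ν-step x x∈p∧x≢y⇒x∈p-y) (s≤s (Separator.split s))
  νE≤′ : ν N E ≤ ν N (X′ ∪ ⁅ x ⁆) + ν N (Y′ ∪ ⁅ x ⁆)
  νE≤′ = ℕ.≤-trans (ν-mono (p⊆q∪⁅y⁆ x x∈p∧x≢y⇒x∈p-y)) (Separator.split s′)
  empty : ∀ {Z} → Separator N E Z → Z ⊆ E′ → Empty Z
  empty t Z⊆ ne = y∉p-y E x (Z⊆ (irr t ne x∈E))
  member : ∀ {z} → z ∈ E′ → Dec (z ∈ X) → z ∈ X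
  member z∈ (yes z∈X) = z∈X
  member {z} z∈ (no z∉X)
    -- In each of the four outcomes two corners are separators avoiding `x`, hence empty by
    -- irreducibility. Together they make up `X`, `X′`, `Y′` or `Y`, each of which has a known
    -- point: `a`, `a′`, `y` or `z`.
    with uncross N x X Y X′ Y′ x∈E X⊆ (p─q⊆p E′ X) X′⊆ (p─q⊆p E′ X′)
           (λ a b → x∈p─q⇒x∉q E′ X b a) (λ a b → x∈p─q⇒x∉q E′ X′ b a) νE≤ νE≤′
       | uncross N x X Y Y′ X′ x∈E X⊆ (p─q⊆p E′ X) (p─q⊆p E′ X′) X′⊆
           (λ a b → x∈p─q⇒x∉q E′ X b a) (λ a b → x∈p─q⇒x∉q E′ X′ a b) νE≤
           (ℕ.≤-trans νE≤′ (ℕ.≤-reflexive (ℕ.+-comm (ν N (X′ ∪ ⁅ x ⁆)) _)))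
  ... | inj₁ t | inj₁ u = ⊥-elim (empty u (X⊆ ∘ p∩q⊆p X Y′) (a , x∈p∩q⁺ (a∈X , x∈p∧x∉q⇒x∈p─q (X⊆ a∈X)
    λ a∈X′ → empty t (X⊆ ∘ p∩q⊆p X X′) (a , x∈p∩q⁺ (a∈X , a∈X′)))))
  ... | inj₁ t | inj₂ u = ⊥-elim (empty u (X′⊆ ∘ p∩q⊆q Y X′) (a′ , x∈p∩q⁺ (x∈p∧x∉q⇒x∈p─q (X′⊆ a′∈X′)
    (λ a′∈X → empty t (X⊆ ∘ p∩q⊆p X X′) (a′ , x∈p∩q⁺ (a′∈X , a′∈X′))) , a′∈X′)))
  ... | inj₂ t | inj₁ u = ⊥-elim (empty t (p─q⊆p E′ X ∘ p∩q⊆p Y Y′) (y , x∈p∩q⁺ (x∈p∧x∉q⇒x∈p─q y∈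
    (λ y∈X → empty u (X⊆ ∘ p∩q⊆p X Y′) (y , x∈p∩q⁺ (y∈X , y∈Y′))) , y∈Y′)))
  ... | inj₂ t | inj₂ u = ⊥-elim (empty t (p─q⊆p E′ X ∘ p∩q⊆p Y Y′) (z , x∈p∩q⁺ (z∈Y , x∈p∧x∉q⇒x∈p─q z∈
    λ z∈X′ → empty u (X′⊆ ∘ p∩q⊆q Y X′) (z , x∈p∩q⁺ (z∈Y , z∈X′)))))
    where
    z∈Y : z ∈ Y
    z∈Y = x∈p∧x∉q⇒x∈p─q z∈ z∉X

-- A circuit of the contraction either has nullity 1 already before contraction, or has nullity 0
-- there and becomes a circuit on adding `x`.
circuit-lift : (N : Nullity n) {E : Subset n} {e f x : Fin n} (nl : ν N ⁅ x ⁆ ≡ 0) → x ∈ E →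
               Circuit-through (contract N x nl) (E - x) e f → Circuit-through N E e f
circuit-lift N {E} {e} {f} {x} nl x∈E c with ν N (Circuit-through.D c) ℕ.≟ 0
... | no ≢0 = record
  { D      = D
  ; D⊆E    = p─q⊆p E _ ∘ D⊆E
  ; cyclic = λ {y} y∈ → subst (ν N (D - y) <_) (sym νD≡1) (ℕ.≤-<-trans (ν-mono (p⊆p∪q ⁅ x ⁆))
      (subst (ν N ((D - y) ∪ ⁅ x ⁆) <_) ν≡1 (cyclic y∈)))
  ; ν≡1    = νD≡1
  ; e∈D    = e∈D
  ; f∈D    = f∈D
  }
  where
  open Nullity N hiding (ν)
  open Circuit-through c
  νD≡1 : ν N D ≡ 1
  νD≡1 = ℕ.≤-antisym (subst (ν N D ≤_) ν≡1 (ν-mono (p⊆p∪q ⁅ x ⁆))) (ℕ.n≢0⇒n>0 ≢0)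
... | yes ≡0 = record
  { D      = D ∪ ⁅ x ⁆
  ; D⊆E    = p∪⁅y⁆⊆q (p─q⊆p E _ ∘ D⊆E) x∈E
  ; cyclic = λ {y} y∈ → subst (ν N ((D ∪ ⁅ x ⁆) - y) <_) (sym ν≡1) (s≤s (ℕ.≤-reflexive (small (x∈p∪⁅y⁆⁻ D x y∈))))
  ; ν≡1    = ν≡1
  ; e∈D    = x∈p⇒x∈p∪q e∈D
  ; f∈D    = x∈p⇒x∈p∪q f∈D
  }
  where
  open Nullity N hiding (ν)
  open Circuit-through c
  small : ∀ {y} → y ∈ D ⊎ y ≡ x → ν N ((D ∪ ⁅ x ⁆) - y) ≡ 0
  small {y} (inj₁ y∈D) = ℕ.n<1⇒n≡0 (ℕ.≤-<-trans
    (ν-mono (λ z∈ → let a , b = x∈p-y⁻ (D ∪ ⁅ x ⁆) y z∈ in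
      [ (λ z∈D → x∈p⇒x∈p∪q (x∈p∧x≢y⇒x∈p-y z∈D b)) , (λ { refl → y∈p∪⁅y⁆ (D - y) x }) ]′ (x∈p∪⁅y⁆⁻ D x a)))
    (subst (ν N ((D - y) ∪ ⁅ x ⁆) <_) ν≡1 (cyclic y∈D)))
  small (inj₂ refl) = ℕ.n≤0⇒n≡0 (subst (ν N ((D ∪ ⁅ x ⁆) - x) ≤_) ≡0 (ν-mono λ z∈ →
    let a , b = x∈p-y⁻ (D ∪ ⁅ x ⁆) x z∈ in [ (λ z∈D → z∈D) , (λ z≡x → contradiction z≡x b) ]′ (x∈p∪⁅y⁆⁻ D x a)))

-- As long as a third element remains, deleting or contracting it leaves an irreducible minor
-- containing `e` and `f`. With only `e` and `f` left, irreducibility makes the pair itself a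
-- circuit.
circuit-through : ∀ k {N : Nullity n} {E e f} → ∣ E ∣ < k → Irreducible N E → e ∈ E → f ∈ E → e ≢ f →
                  Circuit-through N E e f
circuit-through (suc k) {N} {E} {e} {f} (s≤s E≤k) irr e∈ f∈ e≢f with nonempty? (E - e - f)
... | no none = record
  { D      = E
  ; D⊆E    = λ x∈ → x∈
  ; cyclic = cyc
  ; ν≡1    = ν≡1
  ; e∈D    = e∈
  ; f∈D    = f∈
  }
  where
  open Nullity N hiding (ν)
  two : ∀ {x} → x ∈ E → x ≢ e → x ≡ f
  two {x} x∈ x≢e with x ≟ᶠ f
  ... | yes x≡f = x≡f
  ... | no  x≢f = ⊥-elim (none (x , x∈p∧x≢y⇒x∈p-y (x∈p∧x≢y⇒x∈p-y x∈ x≢e) x≢f))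
  νE-≡0 : ∀ {x y} → x ∈ E → y ∈ E → x ≢ y → (∀ {z} → z ∈ E → z ≢ y → z ≡ x) → ν N (E - x) ≡ 0
  -- Here `E` consists of `x` and `y`, so `ν E` is at most `ν ⁅ x ⁆ + 1`; since `⁅ x ⁆` does not
  -- separate, nothing is left for `E - x`.
  νE-≡0 {x} {y} x∈ y∈ x≢y only = ℕ.n<1⇒n≡0 (ℕ.+-cancelˡ-< (ν N ⁅ x ⁆) _ 1 (ℕ.<-≤-trans (irreducible-⁅⁆ N irr x∈ y∈ x≢y)
    (ℕ.≤-trans (ν-step y λ z∈ z≢y → subst (_∈ ⁅ x ⁆) (sym (only z∈ z≢y)) (x∈⁅x⁆ x)) (ℕ.≤-reflexive (ℕ.+-comm 1 _)))))
  at-e : ν N (E - e) ≡ 0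
  at-e = νE-≡0 e∈ f∈ e≢f λ {z} z∈ z≢f → case z ≟ᶠ e of λ
    { (yes z≡e) → z≡e
    ; (no z≢e)  → contradiction (two z∈ z≢e) z≢f }
  at-f : ν N (E - f) ≡ 0
  at-f = νE-≡0 f∈ e∈ (e≢f ∘ sym) two
  ν≡1 : ν N E ≡ 1
  ν≡1 = ℕ.≤-antisym (ℕ.≤-trans (ν-step e x∈p∧x≢y⇒x∈p-y) (s≤s (ℕ.≤-reflexive at-e)))
    (ℕ.≤-<-trans z≤n (irreducible-⁅⁆ N irr e∈ f∈ e≢f))
  cyc : Cyclic N E
  cyc {x} x∈ with x ≟ᶠ e
  ... | yes refl = subst₂ _<_ (sym at-e) (sym ν≡1) ℕ.0<1+n
  ... | no x≢e rewrite two x∈ x≢e = subst₂ _<_ (sym at-f) (sym ν≡1) ℕ.0<1+n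
... | yes (x , x∈) = result
  where
  open Nullity N hiding (ν)
  x∈E-e = proj₁ (x∈p-y⁻ (E - e) f x∈)
  x≢f = proj₂ (x∈p-y⁻ (E - e) f x∈)
  x∈E = proj₁ (x∈p-y⁻ E e x∈E-e)
  x≢e = proj₂ (x∈p-y⁻ E e x∈E-e)
  e∈′ : e ∈ E - x
  e∈′ = x∈p∧x≢y⇒x∈p-y e∈ (x≢e ∘ sym)
  f∈′ : f ∈ E - x
  f∈′ = x∈p∧x≢y⇒x∈p-y f∈ (x≢f ∘ sym)
  smaller : ∣ E - x ∣ < k
  smaller = ℕ.<-≤-trans (x∈p⇒∣p-x∣<∣p∣ x∈E) E≤k
  nl : ν N ⁅ x ⁆ ≡ 0
  nl = ℕ.n<1⇒n≡0 (ℕ.+-cancelʳ-< (ν N (E - x)) _ 1 (ℕ.<-≤-trans (irreducible-⁅⁆ N irr x∈E e∈ x≢e)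
    (ν-step x x∈p∧x≢y⇒x∈p-y)))
  result : Circuit-through N E e f
  result with anySubset? (λ X → separator? N (E - x) X ×-dec nonempty? X ×-dec ¬? (E - x ⊆? X))
  ... | yes (X , s , ne , ¬⊆) = circuit-lift N nl x∈E
    (circuit-through k smaller (irreducible-contract N nl irr x∈E s ne ¬⊆) e∈′ f∈′ e≢f)
  ... | no none = record
    { D = D ; D⊆E = p─q⊆p E _ ∘ D⊆E ; cyclic = cyclic ; ν≡1 = ν≡1 ; e∈D = e∈D ; f∈D = f∈D }
    where
    irr′ : Irreducible N (E - x)
    irr′ {X} s ne with E - x ⊆? X
    ... | yes ⊆X = ⊆X
    ... | no  ¬⊆ = ⊥-elim (none (X , s , ne , ¬⊆))
    open Circuit-through (circuit-through k {N} smaller irr′ e∈′ f∈′ e≢f)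

-- The nullity function of a matroid

∈-subsets : (X : Subset n) → X ∈ₗ subsets n
∈-subsets []            = Any.here refl
∈-subsets (outside ∷ X) = ∈-++⁺ˡ (∈-map⁺ (outside ∷_) (∈-subsets X))
∈-subsets (inside ∷ X)  = ∈-++⁺ʳ _ (∈-map⁺ (inside ∷_) (∈-subsets X))

rank-attained : (M : Matroid n) → ∃[ B ] Indep M B × ∣ B ∣ ≡ rank M
rank-attained {n} M with argmax-sel (λ x → x) 0 (List.map ∣_∣ (filter (Indep? M) (subsets n)))
-- The default value 0 of `max` is attained by the empty set.
... | inj₁ eq = ⊥ , indep-⊥ M , trans (∣⊥∣≡0 n) (sym eq)
... | inj₂ r∈ with ∈-map⁻ ∣_∣ r∈
...   | B , B∈ , eq = B , proj₂ (∈-filter⁻ (Indep? M) {xs = subsets n} B∈) , sym eq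

∣indep∣≤rank : (M : Matroid n) {I : Subset n} → Indep M I → ∣ I ∣ ≤ rank M
∣indep∣≤rank M {I} i = All.lookup (xs≤max 0 _) (∈-map⁺ ∣_∣ (∈-filter⁺ (Indep? M) (∈-subsets I) i))

rank-mono : (M M′ : Matroid n) → (∀ {I} → Indep M I → Indep M′ I) → rank M ≤ rank M′
rank-mono M M′ h = let B , b , eq = rank-attained M in subst (_≤ rank M′) eq (∣indep∣≤rank M′ (h b))

module Rank (M : Matroid n) where

  r : Subset n → ℕ
  r X = rank (M ↾ X)

  indep≤r : ∀ {I X} → Indep M I → I ⊆ X → ∣ I ∣ ≤ r X
  indep≤r {X = X} i I⊆X = ∣indep∣≤rank (M ↾ X) (i , I⊆X)

  extend : ∀ k {I X} → Indep M I → I ⊆ X → r X ≤ k + ∣ I ∣ →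
           ∃[ B ] Indep M B × I ⊆ B × B ⊆ X × ∣ B ∣ ≡ r X
  extend zero    {I} i I⊆X h = I , i , (λ x∈ → x∈) , I⊆X , ℕ.≤-antisym (indep≤r i I⊆X) h
  extend (suc k) {I} {X} i I⊆X h with rank-attained (M ↾ X) | ∣ I ∣ ℕ.<? r X
  ... | _ | no ≮ = I , i , (λ x∈ → x∈) , I⊆X , ℕ.≤-antisym (indep≤r i I⊆X) (ℕ.≮⇒≥ ≮)
  ... | B₀ , (b₀ , B₀⊆X) , eq | yes lt with augment M i b₀ (subst (∣ I ∣ <_) (sym eq) lt)
  ...   | e , e∈B₀ , e∉I , ie with extend k ie (p∪⁅y⁆⊆q I⊆X (B₀⊆X e∈B₀))
            (subst (λ a → r X ≤ k + a) (sym (∣p∪⁅x⁆∣≡suc∣p∣ I e∉I)) (subst (r X ≤_) (sym (ℕ.+-suc k _)) h))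
  ...     | B , b , I⊆B , B⊆X , eq′ = B , b , I⊆B ∘ x∈p⇒x∈p∪q , B⊆X , eq′

  basis : ∀ {I X} → Indep M I → I ⊆ X → ∃[ B ] Indep M B × I ⊆ B × B ⊆ X × ∣ B ∣ ≡ r X
  basis {I} {X} i I⊆X = extend (r X) i I⊆X (ℕ.m≤m+n _ _)

  r≤∣∣ : ∀ X → r X ≤ ∣ X ∣
  r≤∣∣ X = let B , (_ , B⊆X) , eq = rank-attained (M ↾ X) in subst (_≤ ∣ X ∣) eq (p⊆q⇒∣p∣≤∣q∣ B⊆X)

  r-mono : ∀ {X Y} → X ⊆ Y → r X ≤ r Y
  r-mono {X} {Y} X⊆Y = rank-mono (M ↾ X) (M ↾ Y) λ (i , I⊆) → i , λ x∈ → X⊆Y (I⊆ x∈)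

  r-sub : ∀ X Y → r (X ∪ Y) + r (X ∩ Y) ≤ r X + r Y
  r-sub X Y =
    let B , b , _ , B⊆ , ∣B∣ = basis {X = X ∩ Y} (indep-⊥ M) (⊆-min _)
        B′ , b′ , B⊆B′ , B′⊆ , ∣B′∣ = basis {X = X ∪ Y} b (x∈p⇒x∈p∪q ∘ p∩q⊆p X Y ∘ B⊆)
        cover : B′ ⊆ (B′ ∩ X) ∪ (B′ ∩ Y)
        cover x∈ = x∈p∪q⁺ ([ (λ a → inj₁ (x∈p∩q⁺ (x∈ , a))) , (λ a → inj₂ (x∈p∩q⁺ (x∈ , a))) ]′ (x∈p∪q⁻ X Y (B′⊆ x∈)))
        meet : B ⊆ (B′ ∩ X) ∩ (B′ ∩ Y)
        meet x∈ = let a , c = x∈p∩q⁻ X Y (B⊆ x∈) in x∈p∩q⁺ (x∈p∩q⁺ (B⊆B′ x∈ , a) , x∈p∩q⁺ (B⊆B′ x∈ , c))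
    in begin
      r (X ∪ Y) + r (X ∩ Y)                                  ≡⟨ cong₂ _+_ ∣B′∣ ∣B∣ ⟨
      ∣ B′ ∣ + ∣ B ∣                                         ≤⟨ ℕ.+-mono-≤ (p⊆q⇒∣p∣≤∣q∣ cover) (p⊆q⇒∣p∣≤∣q∣ meet) ⟩
      ∣ (B′ ∩ X) ∪ (B′ ∩ Y) ∣ + ∣ (B′ ∩ X) ∩ (B′ ∩ Y) ∣      ≡⟨ ∣p∪q∣+∣p∩q∣ (B′ ∩ X) (B′ ∩ Y) ⟩
      ∣ B′ ∩ X ∣ + ∣ B′ ∩ Y ∣                                ≤⟨ ℕ.+-mono-≤
                                                                  (indep≤r (hereditary M b′ (p∩q⊆p B′ X)) (p∩q⊆q B′ X))
                                                                  (indep≤r (hereditary M b′ (p∩q⊆p B′ Y)) (p∩q⊆q B′ Y)) ⟩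
      r X + r Y                                              ∎
    where open ℕ.≤-Reasoning

  null : Subset n → ℕ
  null X = ∣ X ∣ ∸ r X

  null+r : ∀ X → null X + r X ≡ ∣ X ∣
  null+r X = ℕ.m∸n+n≡m (r≤∣∣ X)

  null-≡ : ∀ {X} a → a + r X ≡ ∣ X ∣ → null X ≡ a
  null-≡ {X} a eq = ℕ.+-cancelʳ-≡ (r X) _ _ (trans (null+r X) (sym eq))

  null-mono : ∀ {X Y} → X ⊆ Y → null X ≤ null Y
  null-mono {X} {Y} X⊆Y = arith (null+r X) (null+r Y) (∣q∣≡∣p∣+∣q─p∣ X Y X⊆Y) (begin
    r Y                    ≡⟨ proj₂ (proj₂ (proj₂ (proj₂ bs))) ⟨
    ∣ B ∣                  ≤⟨ p⊆q⇒∣p∣≤∣q∣ {q = (B ∩ X) ∪ (Y ─ X)} cover ⟩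
    ∣ (B ∩ X) ∪ (Y ─ X) ∣  ≤⟨ ℕ.m≤m+n _ ∣ (B ∩ X) ∩ (Y ─ X) ∣ ⟩
    _                      ≡⟨ ∣p∪q∣+∣p∩q∣ (B ∩ X) (Y ─ X) ⟩
    ∣ B ∩ X ∣ + ∣ Y ─ X ∣  ≤⟨ ℕ.+-monoˡ-≤ _ (indep≤r (hereditary M (proj₁ (proj₂ bs)) (p∩q⊆p B X)) (p∩q⊆q B X)) ⟩
    r X + ∣ Y ─ X ∣        ∎)
    where
    open ℕ.≤-Reasoning
    bs = basis {X = Y} (indep-⊥ M) (⊆-min _)
    B = proj₁ bs
    cover : B ⊆ (B ∩ X) ∪ (Y ─ X)
    cover {x} x∈ with x ∈? X
    ... | yes x∈X = x∈p∪q⁺ (inj₁ (x∈p∩q⁺ (x∈ , x∈X)))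
    ... | no  x∉X = x∈p∪q⁺ {p = B ∩ X} (inj₂ (x∈p∧x∉q⇒x∈p─q (proj₁ (proj₂ (proj₂ (proj₂ bs))) x∈) x∉X))
    arith : ∀ {a b rx ry cx cy d} → a + rx ≡ cx → b + ry ≡ cy → cy ≡ cx + d → ry ≤ rx + d → a ≤ b
    arith {a} {b} {rx} {ry} {d = d} refl refl eq h = ℕ.+-cancelʳ-≤ (rx + d) a b
      (ℕ.≤-trans (ℕ.≤-reflexive (trans (sym (ℕ.+-assoc a rx d)) (sym eq))) (ℕ.+-monoʳ-≤ b h))

  null-∪⁅⁆ : ∀ X e → null (X ∪ ⁅ e ⁆) ≤ suc (null X)
  null-∪⁅⁆ X e = ℕ.+-cancelʳ-≤ (r X) _ _ (begin
    null (X ∪ ⁅ e ⁆) + r X              ≤⟨ ℕ.+-monoʳ-≤ (null (X ∪ ⁅ e ⁆)) (r-mono (p⊆p∪q ⁅ e ⁆)) ⟩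
    null (X ∪ ⁅ e ⁆) + r (X ∪ ⁅ e ⁆)    ≡⟨ null+r (X ∪ ⁅ e ⁆) ⟩
    ∣ X ∪ ⁅ e ⁆ ∣                       ≤⟨ ℕ.m≤m+n _ ∣ X ∩ ⁅ e ⁆ ∣ ⟩
    _                                   ≡⟨ ∣p∪q∣+∣p∩q∣ X ⁅ e ⁆ ⟩
    ∣ X ∣ + ∣ ⁅ e ⁆ ∣                   ≡⟨ cong₂ _+_ (sym (null+r X)) (∣⁅x⁆∣≡1 e) ⟩
    (null X + r X) + 1                  ≡⟨ ℕ.+-comm _ 1 ⟩
    suc (null X) + r X                  ∎)
    where open ℕ.≤-Reasoning

  null-super : ∀ X Y → null X + null Y ≤ null (X ∪ Y) + null (X ∩ Y)
  null-super X Y = arith (null X) (null Y) (null (X ∪ Y)) (null (X ∩ Y))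
    (null+r X) (null+r Y) (null+r (X ∪ Y)) (null+r (X ∩ Y))
    (∣p∪q∣+∣p∩q∣ X Y) (r-sub X Y)
    where
    arith : ∀ x y u i {rx ry ru ri cx cy cu ci} → x + rx ≡ cx → y + ry ≡ cy → u + ru ≡ cu → i + ri ≡ ci →
            cu + ci ≡ cx + cy → ru + ri ≤ rx + ry → x + y ≤ u + i
    arith x y u i {rx} {ry} {ru} {ri} refl refl refl refl eq h = ℕ.+-cancelʳ-≤ (rx + ry) (x + y) (u + i) (begin
      (x + y) + (rx + ry)  ≡⟨ swap x y rx ry ⟩
      (x + rx) + (y + ry)  ≡⟨ eq ⟨
      (u + ru) + (i + ri)  ≡⟨ swap u i ru ri ⟨
      (u + i) + (ru + ri)  ≤⟨ ℕ.+-monoʳ-≤ (u + i) h ⟩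
      (u + i) + (rx + ry)  ∎)
      where
      open ℕ.≤-Reasoning
      swap : ∀ a b c d → (a + b) + (c + d) ≡ (a + c) + (b + d)
      swap = solve-∀

  nullity : Nullity n
  nullity = record
    { ν       = null
    ; ν-⊥     = trans (cong (_∸ r ⊥) (∣⊥∣≡0 n)) (ℕ.0∸n≡0 (r ⊥))
    ; ν-mono  = null-mono
    ; ν-step  = λ {X} e h → ℕ.≤-trans (null-mono (p⊆q∪⁅y⁆ e h)) (null-∪⁅⁆ X e)
    ; ν-super = λ X Y U I X⊆U Y⊆U h → ℕ.≤-trans (null-super X Y) (ℕ.+-mono-≤
        (null-mono ([ X⊆U , Y⊆U ]′ ∘ x∈p∪q⁻ X Y))
        (null-mono λ x∈ → let a , b = x∈p∩q⁻ X Y x∈ in h a b))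
    }

  indep⇒null≡0 : ∀ {I} → Indep M I → null I ≡ 0
  indep⇒null≡0 {I} i = null-≡ 0 (ℕ.≤-antisym (r≤∣∣ I) (indep≤r i λ x∈ → x∈))

  null≡0⇒indep : ∀ {X} → null X ≡ 0 → Indep M X
  null≡0⇒indep {X} eq with rank-attained (M ↾ X)
  ... | B , (b , B⊆X) , ∣B∣ = hereditary M b X⊆B
    where
    X⊆B : X ⊆ B
    X⊆B {x} x∈ with x ∈? B
    ... | yes x∈B = x∈B
    ... | no  x∉B = contradiction (p⊂q⇒∣p∣<∣q∣ ((λ y∈ → B⊆X y∈) , x , x∈ , x∉B))
                      (ℕ.≤⇒≯ (ℕ.≤-reflexive (trans (sym (null+r X)) (trans (cong (_+ r X) eq) (sym ∣B∣)))))

  dependent⇒0<null : ∀ {X} → ¬ Indep M X → 0 < null X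
  dependent⇒0<null ¬i = ℕ.n≢0⇒n>0 (¬i ∘ null≡0⇒indep)

  0<null⇒dependent : ∀ {X} → 0 < null X → ¬ Indep M X
  0<null⇒dependent 0<ν i = ℕ.>⇒≢ 0<ν (indep⇒null≡0 i)

  null-E : null (E M) ≡ corank M
  null-E = cong (∣ E M ∣ ∸_) (ℕ.≤-antisym
    (rank-mono (M ↾ E M) M proj₁)
    (rank-mono M (M ↾ E M) λ i → i , indep⊆E M i))

  corank-↾ : ∀ {X} → X ⊆ E M → corank (M ↾ X) ≡ null X
  corank-↾ {X} X⊆E = cong (λ Y → ∣ Y ∣ ∸ r X) (⊆-antisym (p∩q⊆q (E M) X) λ x∈ → x∈p∩q⁺ (X⊆E x∈ , x∈))

  circuit-null≡1 : ∀ {D} → IsCircuit M D → null D ≡ 1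
  circuit-null≡1 {D} ((_ , ¬i) , min) with Nullity.ν-Nonempty nullity D (dependent⇒0<null ¬i)
  ... | x , x∈ = ℕ.≤-antisym (ℕ.≤-trans (Nullity.ν-step nullity x x∈p∧x≢y⇒x∈p-y)
                   (s≤s (ℕ.≤-reflexive (indep⇒null≡0 (min (x∈p⇒p-x⊂p x∈)))))) (dependent⇒0<null ¬i)

  circuit-cyclic : ∀ {D} → IsCircuit M D → Cyclic nullity D
  circuit-cyclic {D} c@((_ , ¬i) , min) {x} x∈ =
    subst (_< null D) (sym (indep⇒null≡0 (min (x∈p⇒p-x⊂p x∈)))) (dependent⇒0<null ¬i)

  isCircuit : ∀ {D} → D ⊆ E M → Cyclic nullity D → null D ≡ 1 → IsCircuit M D
  isCircuit {D} D⊆E cyc one = (D⊆E , 0<null⇒dependent (subst (0 <_) (sym one) ℕ.0<1+n)) , min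
    where
    min : ∀ {F} → F ⊂ D → Indep M F
    min {F} (F⊆D , x , x∈D , x∉F) = null≡0⇒indep (ℕ.n<1⇒n≡0 (ℕ.≤-<-trans
      (null-mono λ y∈ → x∈p∧x≢y⇒x∈p-y (F⊆D y∈) λ { refl → x∉F y∈ })
      (subst (null (D - x) <_) one (cyc x∈D))))

  cycle⊆E : ∀ {K} → IsCycle M K → K ⊆ E M
  cycle⊆E (Cs , cs , refl) = go Cs cs
    where
    go : ∀ Cs → All (IsCircuit M) Cs → ⋃ₛ Cs ⊆ E M
    go []       []       x∈ = ⊥-elim (∉⊥ x∈)
    go (C ∷ Cs) (c ∷ cs) x∈ = [ (λ a → proj₁ (proj₁ c) a) , (λ a → go Cs cs a) ]′ (x∈p∪q⁻ C (⋃ₛ Cs) x∈)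

  cycle-cyclic : ∀ {K} → IsCycle M K → Cyclic nullity K
  cycle-cyclic {K} (Cs , cs , refl) {x} x∈ = go Cs cs (λ x∈ → x∈) x∈
    where
    go : ∀ Ds → All (IsCircuit M) Ds → ⋃ₛ Ds ⊆ K → x ∈ ⋃ₛ Ds → null (K - x) < null K
    go []       []       ⊆K x∈ = ⊥-elim (∉⊥ x∈)
    go (D ∷ Ds) (d ∷ ds) ⊆K x∈ with x∈p∪q⁻ D (⋃ₛ Ds) x∈
    ... | inj₁ x∈D  = cyclic-delete nullity (circuit-cyclic d) (⊆K ∘ x∈p⇒x∈p∪q) x∈D
    ... | inj₂ x∈Ds = go Ds ds (⊆K ∘ q⊆p∪q D (⋃ₛ Ds)) x∈Ds

-- Circuits inside dependent sets, and cycles as unions of circuits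

circuit-inside : ∀ k (N : Nullity n) {X} → ∣ X ∣ < k → 0 < ν N X → ∃[ D ] D ⊆ X × Cyclic N D × ν N D ≡ 1
circuit-inside (suc k) N {X} (s≤s X≤k) 0<ν with any? (λ x → (x ∈? X) ×-dec (0 ℕ.<? ν N (X - x)))
... | yes (x , x∈ , 0<ν′) =
  let D , D⊆ , rest = circuit-inside k N (ℕ.<-≤-trans (x∈p⇒∣p-x∣<∣p∣ x∈) X≤k) 0<ν′
  in D , p─q⊆p X _ ∘ D⊆ , rest
... | no none = X , (λ x∈ → x∈) , (λ {x} x∈ → subst (_< ν N X) (sym (small x∈)) 0<ν) , ν≡1
  where
  small : ∀ {x} → x ∈ X → ν N (X - x) ≡ 0
  small x∈ = ℕ.n≤0⇒n≡0 (ℕ.≮⇒≥ λ 0<ν′ → none (_ , x∈ , 0<ν′))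
  ν≡1 : ν N X ≡ 1
  ν≡1 = let x , x∈ = Nullity.ν-Nonempty N X 0<ν in
    ℕ.≤-antisym (ℕ.≤-trans (Nullity.ν-step N x x∈p∧x≢y⇒x∈p-y) (s≤s (ℕ.≤-reflexive (small x∈)))) 0<ν

-- If `X - x` has nullity 0, any circuit inside `X` must use `x`. Otherwise a point `y` of a circuit
-- avoiding `x` is discarded: this lowers the nullity of `X` and of `X - x` by one each, so `x` is
-- still not a coloop.
circuit-at : ∀ k (N : Nullity n) {X x} → ∣ X ∣ < k → x ∈ X → ν N (X - x) < ν N X →
             ∃[ D ] D ⊆ X × Cyclic N D × ν N D ≡ 1 × x ∈ D
circuit-at (suc k) N {X} {x} (s≤s X≤k) x∈ lt with ν N (X - x) ℕ.≟ 0
... | yes ≡0 =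
  let D , D⊆ , cyc , one = circuit-inside _ N ℕ.≤-refl (ℕ.≤-<-trans z≤n lt)
      x∈D : x ∈ D
      x∈D = case x ∈? D of λ
        { (yes x∈D) → x∈D
        ; (no x∉D)  → contradiction (ℕ.≤-trans (ℕ.≤-reflexive (sym one)) (Nullity.ν-mono N {D} {X - x} λ y∈ →
            x∈p∧x≢y⇒x∈p-y (D⊆ y∈) λ { refl → x∉D y∈ })) (ℕ.<⇒≱ (subst (_< 1) (sym ≡0) ℕ.0<1+n)) }
  in D , D⊆ , cyc , one , x∈D
... | no ≢0 =
  let F , F⊆ , cyc , one = circuit-inside _ N ℕ.≤-refl (ℕ.n≢0⇒n>0 ≢0)
      y , y∈F = Nullity.ν-Nonempty N F (subst (0 <_) (sym one) ℕ.0<1+n)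
      y∈X , y≢x = x∈p-y⁻ X x (F⊆ y∈F)
      d = cyclic-delete N cyc (p─q⊆p X _ ∘ F⊆) y∈F
      lt′ : ν N (X - y - x) < ν N (X - y)
      lt′ = s≤s⁻¹ (ℕ.≤-<-trans (subst (_≤ ν N (X - x)) (cong (suc ∘ ν N) (p─x─y≡p─y─x X x y))
        (cyclic-delete N cyc F⊆ y∈F))
        (subst (ν N (X - x) <_) (ν-delete N y d) lt))
      D , D⊆ , rest = circuit-at k N (ℕ.<-≤-trans (x∈p⇒∣p-x∣<∣p∣ y∈X) X≤k) (x∈p∧x≢y⇒x∈p-y x∈ (y≢x ∘ sym)) lt′
  in D , p─q⊆p X _ ∘ D⊆ , rest

cyclic-cycle : (M : Matroid n) {K : Subset n} → K ⊆ E M → Cyclic (Rank.nullity M) K → IsCycle M K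
cyclic-cycle {n} M {K} K⊆E cyc =
  let Cs , cs , K⊆ , ⊆K = cover _ ℕ.≤-refl (λ x∈ → x∈) in Cs , cs , ⊆-antisym ⊆K K⊆
  where
  open Rank M
  cover : ∀ k {L} → ∣ L ∣ < k → L ⊆ K → ∃[ Cs ] All (IsCircuit M) Cs × L ⊆ ⋃ₛ Cs × ⋃ₛ Cs ⊆ K
  cover (suc k) {L} (s≤s L≤k) L⊆K with nonempty? L
  ... | no ¬ne = [] , [] , (λ x∈ → ⊥-elim (¬ne (_ , x∈))) , ⊆-min K
  ... | yes (x , x∈) =
    let D , D⊆K , c , one , x∈D = circuit-at _ nullity ℕ.≤-refl (L⊆K x∈) (cyc (L⊆K x∈))
        Cs , cs , L⊆ , ⊆K = cover k (ℕ.<-≤-trans (x∈p⇒∣p-x∣<∣p∣ x∈) L≤k) (L⊆K ∘ p─q⊆p L _)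
    in D ∷ Cs , isCircuit (K⊆E ∘ D⊆K) c one ∷ cs
       , (λ {y} y∈ → x∈p∪q⁺ (case y ≟ᶠ x of λ
           { (yes refl) → inj₁ x∈D
           ; (no y≢x)   → inj₂ (L⊆ (x∈p∧x≢y⇒x∈p-y y∈ y≢x)) }))
       , [ D⊆K , ⊆K ]′ ∘ x∈p∪q⁻ D (⋃ₛ Cs)

circuit-transfer : (M M′ : Matroid n) {K : Subset n} → K ⊆ E M′ → (∀ {I} → I ⊆ K → Indep M I ⇔ Indep M′ I) →
                   ∀ {D} → D ⊆ K → IsCircuit M D → IsCircuit M′ D
circuit-transfer M M′ K⊆ h {D} D⊆K ((_ , ¬i) , min) =
  (K⊆ ∘ D⊆K , ¬i ∘ Equivalence.from (h D⊆K)) ,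
  λ {F} F⊂D → Equivalence.to (h (D⊆K ∘ p⊂q⇒p⊆q F⊂D)) (min F⊂D)

cycle-transfer : (M M′ : Matroid n) {K : Subset n} → K ⊆ E M′ → (∀ {I} → I ⊆ K → Indep M I ⇔ Indep M′ I) →
                 IsCycle M K → IsCycle M′ K
cycle-transfer M M′ {K} K⊆ h (Cs , cs , refl) = Cs , go Cs cs (λ x∈ → x∈) , refl
  where
  go : ∀ Ds → All (IsCircuit M) Ds → ⋃ₛ Ds ⊆ K → All (IsCircuit M′) Ds
  go []       []       _  = []
  go (D ∷ Ds) (d ∷ ds) ⊆K = circuit-transfer M M′ K⊆ h (⊆K ∘ x∈p⇒x∈p∪q) d ∷ go Ds ds (⊆K ∘ q⊆p∪q D (⋃ₛ Ds))

-- Reindexing subfamilies by the corank of a minor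

record Enumeration (k : ℕ) (τ : Subset g) : Set where
  field
    index      : Fin k → Fin g
    index∈     : ∀ c → index c ∈ τ
    injective  : ∀ {c d} → index c ≡ index d → c ≡ d
    surjective : ∀ {i} → i ∈ τ → ∃[ c ] index c ≡ i

enumerate : (τ : Subset g) → Enumeration ∣ τ ∣ τ
enumerate [] = record { index = λ () ; index∈ = λ () ; injective = λ { {()} } ; surjective = λ () }
enumerate (outside ∷ τ) = record
  { index      = suc ∘ index
  ; index∈     = there ∘ index∈
  ; injective  = injective ∘ suc-injective
  ; surjective = λ { (there i∈) → let c , eq = surjective i∈ in c , cong suc eq }
  }
  where open Enumeration (enumerate τ)
enumerate (inside ∷ τ) = record
  { index      = λ { zero → zero ; (suc c) → suc (index c) }
  ; index∈     = λ { zero → here ; (suc c) → there (index∈ c) }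
  ; injective  = λ { {zero} {zero} _ → refl ; {suc c} {suc d} eq → cong suc (injective (suc-injective eq)) }
  ; surjective = λ { here → zero , refl ; (there i∈) → let c , eq = surjective i∈ in suc c , cong suc eq }
  }
  where open Enumeration (enumerate τ)

-- A cycle system must be indexed by `Fin (corank M)`, while the proof produces families over a
-- subset `τ` of other indices. Injectivity of the enumeration matters: it places the unique union
-- over the image of `σ` inside the reindexed one, so dependence carries over.
reindex : (M : Matroid n) {τ : Subset g} (A : Fin g → Subset n) (en : Enumeration (corank M) τ) →
          (∀ {i} → i ∈ τ → IsCycle M (A i)) →
          (∀ ρ → ρ ⊆ τ → Nonempty ρ → ¬ Indep M (uniqueUnion A ρ)) →
          IsCycleSystem M (A ∘ Enumeration.index en)
reindex {g = g} M {τ} A en cyc dep = (λ c → cyc (index∈ c)) , λ σ ne →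
  (λ x∈ → let c , _ , x∈c , _ = ∈uniqueUnion⁻ (A ∘ index) σ x∈ in Rank.cycle⊆E M (cyc (index∈ c)) x∈c) ,
  λ i → dep (image σ) (λ k∈ → let c , _ , eq = ∈image⁻ σ k∈ in subst (_∈ τ) eq (index∈ c))
    (let c , c∈ = ne in index c , ∈image⁺ σ c∈)
    (hereditary M i λ {x} x∈ →
      let k , k∈ , x∈k , u = ∈uniqueUnion⁻ A (image σ) x∈
          c , c∈ , eq = ∈image⁻ σ k∈
      in ∈uniqueUnion⁺ (A ∘ index) σ c∈ (subst (λ k → x ∈ A k) (sym eq) x∈k)
           λ d∈ x∈d → injective (trans (u (∈image⁺ σ d∈) x∈d) (sym eq)))
  where
  open Enumeration en
  image? : ∀ σ i → Dec (∃[ c ] c ∈ σ × index c ≡ i)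
  image? σ i = any? λ c → (c ∈? σ) ×-dec (index c ≟ᶠ i)
  image : Subset (corank M) → Subset g
  image σ = comprehension (image? σ)
  ∈image⁻ : ∀ σ {i} → i ∈ image σ → ∃[ c ] c ∈ σ × index c ≡ i
  ∈image⁻ σ = Equivalence.to (∈-comprehension (image? σ))
  ∈image⁺ : ∀ σ {c} → c ∈ σ → index c ∈ image σ
  ∈image⁺ σ {c} c∈ = Equivalence.from (∈-comprehension (image? σ)) (c , c∈ , refl)

matroid-system : (M : Matroid n) {𝒞 : Fin (corank M) → Subset n} → IsCycleSystem M 𝒞 →
                 System (Rank.nullity M) (E M) 𝒞 ⊤
matroid-system M {𝒞} (cycles , dep) = record
  { family = record
    { cyclic    = λ {i} _ → cycle-cyclic (cycles i)
    ; dependent = λ τ _ ne → dependent⇒0<null (proj₂ (dep τ ne))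
    }
  ; C⊆E  = λ {i} _ → cycle⊆E (cycles i)
  ; size = trans null-E (sym (∣⊤∣≡n (corank M)))
  }
  where open Rank M

-- Minors and components

indep-↾ : (M : Matroid n) {X I : Subset n} → I ⊆ X → Indep M I ⇔ Indep (M ↾ X) I
indep-↾ M I⊆X = mk⇔ (λ i → i , λ {_} → I⊆X) proj₁

cycle-↾ : (M : Matroid n) {X K : Subset n} → K ⊆ X → IsCycle M K → IsCycle (M ↾ X) K
cycle-↾ M {X} K⊆X c = cycle-transfer M (M ↾ X) (λ x∈ → x∈p∩q⁺ (Rank.cycle⊆E M c x∈ , K⊆X x∈))
  (λ I⊆K → indep-↾ M (λ x∈ → K⊆X (I⊆K x∈))) c

reindexed : (M : Matroid n) {τ : Subset g} (A : Fin g → Subset n) → corank M ≡ ∣ τ ∣ →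
            (∀ {i} → i ∈ τ → IsCycle M (A i)) → (∀ ρ → ρ ⊆ τ → Nonempty ρ → ¬ Indep M (uniqueUnion A ρ)) →
            ∃[ 𝒟 ] IsCycleSystem M 𝒟
reindexed M {τ} A eq cyc dep =
  _ , reindex M A (subst (λ k → Enumeration k τ) (sym eq) (enumerate τ)) cyc dep

module _ (M : Matroid n) {𝒞 : Fin (corank M) → Subset n} (sys : IsCycleSystem M 𝒞) where
  open Rank M

  deletion-system : ∀ {e} τ → (∀ {i} → i ∈ τ → e ∉ 𝒞 i) → null (E M - e) ≡ ∣ τ ∣ → ∃[ 𝒟 ] IsCycleSystem (M ∖ e) 𝒟
  deletion-system {e} τ e∉ eq = reindexed (M ∖ e) 𝒞 (trans (corank-↾ (p─q⊆p (E M) _)) eq)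
    (λ {i} i∈ → cycle-↾ M (λ x∈ → x∈p∧x≢y⇒x∈p-y (cycle⊆E (proj₁ sys i) x∈) λ { refl → e∉ i∈ x∈ }) (proj₁ sys i))
    λ ρ _ ne → proj₂ (proj₂ sys ρ ne) ∘ proj₁

  module _ {e : Fin n} (i : Indep M ⁅ e ⁆) where

    private
      M/e = contractNonloop M e i
      module M/e = Rank M/e

    contract-rank : ∀ {X} → e ∉ X → suc (M/e.r X) ≡ r (X ∪ ⁅ e ⁆)
    contract-rank {X} e∉X = ℕ.≤-antisym lower upper
      where
      lower : suc (M/e.r X) ≤ r (X ∪ ⁅ e ⁆)
      lower with rank-attained (M/e ↾ X)
      ... | B , ((e∉B , b) , B⊆X) , eq =
        subst (_≤ r (X ∪ ⁅ e ⁆)) (trans (∣p∪⁅x⁆∣≡suc∣p∣ B e∉B) (cong suc eq)) (indep≤r b (p∪⁅y⁆-mono e B⊆X))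
      upper : r (X ∪ ⁅ e ⁆) ≤ suc (M/e.r X)
      upper with basis i (q⊆p∪q X ⁅ e ⁆)
      ... | B , b , e⊆B , B⊆ , eq = subst (_≤ suc (M/e.r X)) (trans (sym (∣p∣≡suc∣p-x∣ (e⊆B (x∈⁅x⁆ e)))) eq)
        (s≤s (M/e.indep≤r (y∉p-y B e , hereditary M b (p∪⁅y⁆⊆q (p─q⊆p B _) (e⊆B (x∈⁅x⁆ e))))
          λ x∈ → let a , c = x∈p-y⁻ B e x∈ in [ (λ d → d) , (λ d → contradiction d c) ]′ (x∈p∪⁅y⁆⁻ X e (B⊆ a))))

    -- Adding `e` raises the size and, by `contract-rank`, the rank by one. Hence the nullity of the
    -- contracted matroid is given by the formula in `contract`, and `contract-cyclic` applies to
    -- it.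
    contract-null : ∀ {X} → e ∉ X → null (X ∪ ⁅ e ⁆) ≡ M/e.null X
    contract-null {X} e∉X = null-≡ (M/e.null X) (trans (cong (M/e.null X +_) (sym (contract-rank e∉X)))
      (trans (ℕ.+-suc _ _) (trans (cong suc (M/e.null+r X)) (sym (∣p∪⁅x⁆∣≡suc∣p∣ X e∉X)))))

    contraction-system : ∃[ 𝒟 ] IsCycleSystem M/e 𝒟
    contraction-system = reindexed M/e {⊤} (λ k → 𝒞 k - e)
      (trans (sym M/e.null-E) (trans (sym (contract-null (y∉p-y (E M) e)))
        (trans (cong null (⊆-antisym (p∪⁅y⁆⊆q (p─q⊆p (E M) _) (indep⊆E M i (x∈⁅x⁆ e))) (p⊆q∪⁅y⁆ e x∈p∧x≢y⇒x∈p-y)))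
          (trans null-E (sym (∣⊤∣≡n (corank M)))))))
      (λ {k} _ → cyclic-cycle M/e
        (λ x∈ → let a , b = x∈p-y⁻ (𝒞 k) e x∈ in x∈p∧x≢y⇒x∈p-y (cycle⊆E (proj₁ sys k) a) b)
        λ {x} x∈ → subst₂ _<_ (contract-null (y∉p-y (𝒞 k) e ∘ p─q⊆p _ _)) (contract-null (y∉p-y (𝒞 k) e))
          (contract-cyclic nullity e (indep⇒null≡0 i) (cycle-cyclic (proj₁ sys k)) x∈))
      λ ρ _ ne (_ , j) → proj₂ (proj₂ sys ρ ne) (hereditary M j
        (p⊆q∪⁅y⁆ e λ x∈ x≢e → uniqueUnion-─ nullity 𝒞 ⁅ e ⁆ ρ (x∈p∧x≢y⇒x∈p-y x∈ x≢e)))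

  ⧸-system : ∀ {e} → ∃[ 𝒟 ] IsCycleSystem (M ∖ e) 𝒟 → ∃[ 𝒟 ] IsCycleSystem (M ⧸ e) 𝒟
  ⧸-system {e} del with Indep? M ⁅ e ⁆
  ... | yes i = contraction-system i
  ... | no  _ = del

  minor-systems : Nonempty (E M) →
                  ∃[ e ] e ∈ E M × (∃[ 𝒟 ] IsCycleSystem (M ∖ e) 𝒟) × (∃[ 𝒟 ] IsCycleSystem (M ⧸ e) 𝒟)
  minor-systems (x , x∈) with nonempty? (⊤ {n = corank M})
  -- In corank 0 any element will do: the nullity stays 0 and the empty family is a cycle system.
  ... | no ¬ne = x , x∈ , del , ⧸-system del
    where
    del = deletion-system ⊤ (λ {i} _ → ⊥-elim (¬ne (i , ∈⊤))) (trans
      (ℕ.n≤0⇒n≡0 (ℕ.≤-trans (null-mono (p─q⊆p (E M) _))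
        (ℕ.≤-reflexive (trans (System.size (matroid-system M sys)) no-index)))) (sym no-index))
      where
      no-index : ∣ ⊤ {n = corank M} ∣ ≡ 0
      no-index = trans (cong ∣_∣ (Empty-unique ¬ne)) (∣⊥∣≡0 (corank M))
  ... | yes ne = e , C⊆E j∈σ e∈Cj , del , ⧸-system del
    where
    S = matroid-system M sys
    open System S using (C⊆E; family)
    p = pick family ne
    open Pick p
    del = deletion-system (⊤ - j) (λ i∈ e∈ → let _ , i≢j = x∈p-y⁻ ⊤ j i∈ in i≢j (unique ∈⊤ e∈))
      (System.size (delete-system nullity S p))

  separator-connected : ∀ {S X x} → S ⊆ E M →
                        (∀ {e f} → e ∈ S → f ∈ S → e ≢ f → ∃[ C ] IsCircuit M C × e ∈ C × f ∈ C) →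
                        Separator nullity (E M) X → x ∈ S → x ∈ X → S ⊆ X
  separator-connected {X = X} {x} S⊆E conn s x∈S x∈X {y} y∈S with x ≟ᶠ y
  ... | yes refl = x∈X
  ... | no  x≢y  = let C , c , x∈C , y∈C = conn x∈S y∈S x≢y in
    circuit-separator nullity s (circuit-cyclic c) (circuit-null≡1 c) (proj₁ (proj₁ c)) x∈C x∈X y∈C

  connected-circuits : Connected M → ∀ i → IsCircuit M (𝒞 i)
  connected-circuits conn i = isCircuit (C⊆E ∈⊤) (cyclic ∈⊤) (νC≡1 (subst (i ∈_) (sym τ≡⊤) ∈⊤))
    where
    open System (matroid-system M sys) using (C⊆E; cyclic)
    open Block (block _ ℕ.≤-refl (matroid-system M sys) (i , ∈⊤))
    open Component component using (nonempty; sep; ⊆E)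
    E⊆Q : E M ⊆ Q
    E⊆Q = let x , x∈ = nonempty in separator-connected (λ x∈ → x∈) conn sep (⊆E x∈) x∈
    -- With `Q` the whole ground set, `τ` has as many elements as there are indices.
    τ≡⊤ : τ ≡ ⊤
    τ≡⊤ = ∣p∣≡n⇒p≡⊤ (trans (sym size) (trans (cong null (⊆-antisym ⊆E E⊆Q)) null-E))

  -- A dependent `I` would contain a circuit, which lies wholly in the separator through any of its
  -- points and so makes that piece of `I` dependent.
  indep-pieces : ∀ {I} → I ⊆ E M →
                 (∀ {x} → x ∈ I → ∃[ X ] x ∈ X × Separator nullity (E M) X × Indep M (I ∩ X)) → Indep M I
  indep-pieces {I} I⊆E pieces = null≡0⇒indep (ℕ.n≤0⇒n≡0 (ℕ.≮⇒≥ λ 0<ν →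
    let D , D⊆I , cyc , one = circuit-inside _ nullity ℕ.≤-refl 0<ν
        x , x∈ = Nullity.ν-Nonempty nullity D (subst (0 <_) (sym one) ℕ.0<1+n)
        X , x∈X , s , i = pieces (D⊆I x∈)
        D⊆X = circuit-separator nullity s cyc one (I⊆E ∘ D⊆I) x∈ x∈X
    in 0<null⇒dependent (subst (0 <_) (sym one) ℕ.0<1+n) (hereditary M i λ y∈ → x∈p∩q⁺ (D⊆I y∈ , D⊆X y∈))))

-- The direct sum of the connected components

∈⋃ᶠ⁻ : (A : Fin k → Subset n) {x : Fin n} → x ∈ ⋃ᶠ A → ∃[ j ] x ∈ A j
∈⋃ᶠ⁻ {zero}  A x∈ = ⊥-elim (∉⊥ x∈)
∈⋃ᶠ⁻ {suc k} A x∈ with x∈p∪q⁻ (A zero) _ x∈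
... | inj₁ x∈₀ = zero , x∈₀
... | inj₂ x∈₁ = let j , x∈j = ∈⋃ᶠ⁻ (A ∘ suc) x∈₁ in suc j , x∈j

∈⋃ᶠ⁺ : (A : Fin k → Subset n) (j : Fin k) {x : Fin n} → x ∈ A j → x ∈ ⋃ᶠ A
∈⋃ᶠ⁺ A zero    x∈ = x∈p∪q⁺ (inj₁ x∈)
∈⋃ᶠ⁺ A (suc j) x∈ = q⊆p∪q (A zero) _ (∈⋃ᶠ⁺ (A ∘ suc) j x∈)

module Components (M : Matroid n) (ne : Nonempty (E M))
  (𝒞 : Fin (corank M) → Subset n) (sys : IsCycleSystem M 𝒞) where
  open Rank M
  private
    S = matroid-system M sys
    module D = Decomposition (decompose _ ℕ.≤-refl S)
  open D using (T; τ)
  module _ (l : Fin D.size) where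
    open Component (D.component l) public using () renaming (sep to T-sep; ⊆E to T⊆E; nonempty to T-nonempty)

  circuit-↾ : ∀ {X D} → D ⊆ X → IsCircuit M D → IsCircuit (M ↾ X) D
  circuit-↾ {X} D⊆X c = circuit-transfer M (M ↾ X) (λ x∈ → x∈p∩q⁺ (proj₁ (proj₁ c) x∈ , D⊆X x∈))
    (λ I⊆D → indep-↾ M (λ x∈ → D⊆X (I⊆D x∈))) (λ x∈ → x∈) c

  ↾-circuit : ∀ {X D} → IsCircuit (M ↾ X) D → IsCircuit M D
  ↾-circuit {X} {D} c@((D⊆ , _) , _) = circuit-transfer (M ↾ X) M (λ x∈ → p∩q⊆p (E M) X (D⊆ x∈))
    (λ I⊆D → mk⇔ proj₁ (λ i → i , λ {_} x∈ → p∩q⊆q (E M) X (D⊆ (I⊆D x∈)))) (λ x∈ → x∈) c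

  T-connected : ∀ l → Connected (M ↾ T l)
  T-connected l e∈ f∈ e≢f =
    D , circuit-↾ D⊆E (isCircuit (T⊆E l ∘ D⊆E) cyclic ν≡1) , e∈D , f∈D
    where
    open Circuit-through (circuit-through _ {N = nullity} ℕ.≤-refl (component-irreducible (D.component l))
      (p∩q⊆q (E M) (T l) e∈) (p∩q⊆q (E M) (T l) f∈) e≢f)

  connected-⊆ : ∀ {X} l {x} → X ⊆ E M → Connected (M ↾ X) → x ∈ X → x ∈ T l → X ⊆ T l
  connected-⊆ l X⊆E conn = separator-connected M sys X⊆E
    (λ e∈ f∈ e≢f → let C , c , e∈C , f∈C = conn (x∈p∩q⁺ (X⊆E e∈ , e∈)) (x∈p∩q⁺ (X⊆E f∈ , f∈)) e≢f
                   in C , ↾-circuit c , e∈C , f∈C)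
    (T-sep l)

  T-component : ∀ l → IsComponent M (T l)
  T-component l = T⊆E l , T-connected l , λ X⊆E conn T⊆X →
    let x , x∈ = T-nonempty l in ⊆-antisym (connected-⊆ l X⊆E conn (T⊆X x∈) x∈) T⊆X

  component⇒T : ∀ {X} → IsComponent M X → Range T X
  component⇒T {X} (X⊆E , conn , max) with nonempty? X
  ... | yes (x , x∈) = let l , x∈T = D.cover (X⊆E x∈) in
    l , max (T⊆E l) (T-connected l) (connected-⊆ l X⊆E conn x∈ x∈T)
  -- The nonempty ground set enters here: over an empty one `⊥` would be a component although the
  -- decomposition has no parts.
  ... | no ¬ne = let l , _ = D.cover (proj₂ ne) in
    l , max (T⊆E l) (T-connected l) λ x∈ → ⊥-elim (¬ne (_ , x∈))

  indep-sum : ∀ {I} → I ⊆ E M → (∀ {x} → x ∈ I → ∃[ l ] x ∈ T l × Indep M (I ∩ (E M ∩ T l))) → Indep M I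
  indep-sum {I} I⊆E h = indep-pieces M sys I⊆E λ x∈ → let l , x∈T , i = h x∈ in
    T l , x∈T , T-sep l , hereditary M i λ y∈ → let a , b = x∈p∩q⁻ I (T l) y∈ in x∈p∩q⁺ (a , x∈p∩q⁺ (I⊆E a , b))

  decomposition : ComponentDecomposition M
  decomposition = record
    { size       = D.size
    ; T          = T
    ; components = λ X → mk⇔ component⇒T λ { (l , refl) → T-component l }
    ; injective  = λ {l} {m} eq → let x , x∈ = T-nonempty l in D.disjoint x∈ (subst (x ∈_) eq x∈)
    ; disjoint   = λ {l} {m} l≢m x∈l x∈m → l≢m (D.disjoint (p∩q⊆q (E M) (T l) x∈l) (p∩q⊆q (E M) (T m) x∈m))
    ; isSum      = E≡ , λ I → mk⇔
        (λ i → (λ {_} x∈ → subst (_ ∈_) E≡ (indep⊆E M i x∈)) ,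
               λ l → hereditary M i (p∩q⊆p I _) , λ {_} x∈ → p∩q⊆q (E M) (T l) (p∩q⊆q I _ x∈))
        (λ (I⊆ , is) → indep-sum (λ x∈ → subst (_ ∈_) (sym E≡) (I⊆ x∈)) λ x∈ →
          let l , x∈l = ∈⋃ᶠ⁻ (λ l → E M ∩ T l) (I⊆ x∈) in l , p∩q⊆q (E M) (T l) x∈l , proj₁ (is l))
    }
    where
    E≡ : E M ≡ ⋃ᶠ (λ l → E M ∩ T l)
    E≡ = ⊆-antisym
      (λ x∈ → let l , x∈T = D.cover x∈ in ∈⋃ᶠ⁺ (λ l → E M ∩ T l) l (x∈p∩q⁺ (x∈ , x∈T)))
      (λ x∈ → let l , x∈l = ∈⋃ᶠ⁻ (λ l → E M ∩ T l) x∈ in p∩q⊆p (E M) (T l) x∈l)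

  open ComponentDecomposition decomposition using (summand; precedingSum)

  en : ∀ l → Enumeration (corank (summand l)) (τ l)
  en l = subst (λ k → Enumeration k (τ l)) (sym (trans (corank-↾ (T⊆E l)) (D.size-τ l))) (enumerate (τ l))
  module En l = Enumeration (en l)

  circuits remainders : ∀ l → Fin (corank (summand l)) → Subset n
  circuits   l c = 𝒞 (En.index l c) ∩ T l
  remainders l c = 𝒞 (En.index l c) ─ T l

  C∩T-circuit : ∀ l {i} → i ∈ τ l → IsCircuit (summand l) (𝒞 i ∩ T l)
  C∩T-circuit l {i} i∈ = circuit-↾ (p∩q⊆q (𝒞 i) (T l)) (isCircuit (T⊆E l ∘ p∩q⊆q (𝒞 i) (T l))
    (cyclic-∩ nullity (T-sep l) (System.C⊆E S ∈⊤) (System.cyclic S ∈⊤)) (D.νC∩T≡1 i∈))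

  circuit-system : ∀ l → IsCircuitSystem (summand l) (circuits l)
  circuit-system l =
    reindex (summand l) (λ i → 𝒞 i ∩ T l) (en l)
      (λ {i} i∈ → 𝒞 i ∩ T l List.∷ List.[] , C∩T-circuit l i∈ ∷ [] , ∪-identityʳ (𝒞 i ∩ T l))
      (λ ρ ρ⊆ ne (i , _) → 0<null⇒dependent (D.dependent l ρ ρ⊆ ne) (hereditary M i λ x∈ →
        let a , b = x∈p∩q⁻ (uniqueUnion 𝒞 ρ) (T l) x∈
            k , k∈ , x∈k , u = ∈uniqueUnion⁻ 𝒞 ρ a
        in ∈uniqueUnion⁺ (λ i → 𝒞 i ∩ T l) ρ k∈ (x∈p∩q⁺ (x∈k , b)) λ {k′} k∈ x∈k → u k∈ (p∩q⊆p (𝒞 k′) (T l) x∈k))) ,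
    λ c → C∩T-circuit l (En.index∈ l c)

  -- Cutting off the separator `T l` leaves a set without coloops, and `D.order` confines it to
  -- earlier components. An empty remainder needs no separate treatment, being the union of no
  -- circuits.
  remainder-cycle : ∀ l c → IsCycle (precedingSum l) (remainders l c)
  remainder-cycle l c = cycle-transfer M (precedingSum l) ⊆preceding
    (λ {I} I⊆K → mk⇔
      (λ i → (λ {_} x∈ → ⊆preceding (I⊆K x∈)) , λ j → hereditary M i (p∩q⊆p I _) , λ {_} x∈ →
        p∩q⊆q (E M) (T (inject j)) (p∩q⊆q I _ x∈))
      (λ (I⊆ , is) → indep-sum (λ x∈ → C⊆E (p─q⊆p K₀ (T l) (I⊆K x∈))) λ x∈ →
        let j , x∈j = ∈⋃ᶠ⁻ (λ (j : Fin′ l) → E M ∩ T (inject j)) (I⊆ x∈)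
        in inject j , p∩q⊆q (E M) (T (inject j)) x∈j , proj₁ (is j)))
    (cyclic-cycle M (C⊆E ∘ p─q⊆p K₀ (T l)) (cyclic-─ nullity (T-sep l) C⊆E (System.cyclic S ∈⊤)))
    where
    K₀ : Subset n
    K₀ = 𝒞 (En.index l c)
    C⊆E : K₀ ⊆ E M
    C⊆E = System.C⊆E S ∈⊤
    ⊆preceding : remainders l c ⊆ ⋃ᶠ (λ (j : Fin′ l) → E M ∩ T (inject j))
    ⊆preceding {x} x∈ =
      let x∈C , x∉T = x∈p─q⁻ K₀ (T l) x∈
          m , x∈m = D.cover (C⊆E x∈C)
          m<l = ℕ.≤∧≢⇒< (D.order (En.index∈ l c) x∈C x∈m) λ eq → x∉T (subst (λ m → x ∈ T m) (toℕ-injective eq) x∈m)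
          eq = toℕ-injective (trans (toℕ-inject {i = l} (fromℕ< m<l)) (toℕ-fromℕ< m<l))
      in ∈⋃ᶠ⁺ (λ (j : Fin′ l) → E M ∩ T (inject j)) (fromℕ< m<l)
           (x∈p∩q⁺ (C⊆E x∈C , subst (λ m → x ∈ T m) (sym eq) x∈m))

  remainder∪circuit : ∀ l c → remainders l c ∪ circuits l c ≡ 𝒞 (En.index l c)
  remainder∪circuit l c = ⊆-antisym
    ([ p─q⊆p K₀ (T l) , p∩q⊆p K₀ (T l) ]′ ∘ x∈p∪q⁻ (K₀ ─ T l) (K₀ ∩ T l))
    λ {x} x∈ → x∈p∪q⁺ (case x ∈? T l of λ
      { (yes x∈T) → inj₂ (x∈p∩q⁺ (x∈ , x∈T))
      ; (no x∉T)  → inj₁ (x∈p∧x∉q⇒x∈p─q x∈ x∉T) })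
    where
    K₀ = 𝒞 (En.index l c)

  first-remainder : ∀ l c → toℕ l ≡ 0 → remainders l c ∪ circuits l c ≡ circuits l c
  first-remainder l c l≡0 = trans (remainder∪circuit l c) (⊆-antisym
    (λ {x} x∈ → let m , x∈m = D.cover (System.C⊆E S ∈⊤ x∈)
                    m≤0 = subst (toℕ m ≤_) l≡0 (D.order (En.index∈ l c) x∈ x∈m)
                in x∈p∩q⁺ (x∈ , subst (λ m → x ∈ T m) (toℕ-injective (trans (ℕ.n≤0⇒n≡0 m≤0) (sym l≡0))) x∈m))
    (p∩q⊆p (𝒞 (En.index l c)) (T l)))

  -- The component of index l is the last one met by the cycles of the l-th block.
  blocks-≤ : ∀ {l m i k} → i ∈ τ l → k ∈ τ m → 𝒞 i ≡ 𝒞 k → toℕ l ≤ toℕ m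
  blocks-≤ {l} {m} {i} i∈ k∈ eq =
    let x , x∈ = Nullity.ν-Nonempty nullity (𝒞 i ∩ T l) (subst (0 <_) (sym (D.νC∩T≡1 i∈)) ℕ.0<1+n)
        x∈C , x∈T = x∈p∩q⁻ (𝒞 i) (T l) x∈
    in D.order k∈ (subst (x ∈_) eq x∈C) x∈T

  blocks-disjoint : ∀ {l m c d} → remainders l c ∪ circuits l c ≡ remainders m d ∪ circuits m d → l ≡ m
  blocks-disjoint {l} {m} {c} {d} eq = toℕ-injective (ℕ.≤-antisym
    (blocks-≤ (En.index∈ l c) (En.index∈ m d) eq′) (blocks-≤ (En.index∈ m d) (En.index∈ l c) (sym eq′)))
    where
    eq′ : 𝒞 (En.index l c) ≡ 𝒞 (En.index m d)
    eq′ = trans (sym (remainder∪circuit l c)) (trans eq (remainder∪circuit m d))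

  𝒞-blocks : Range 𝒞 ≐ ⋃ (Fin D.size) (λ l → Range (λ c → remainders l c ∪ circuits l c))
  𝒞-blocks =
    (λ { (i , refl) → let l , i∈ = D.indices {i} ∈⊤
                          c , eq = En.surjective l i∈
                      in l , c , trans (remainder∪circuit l c) (cong 𝒞 eq) }) ,
    λ { (l , c , refl) → En.index l c , sym (remainder∪circuit l c) }

-- Binary matroids

∧-distribʳ-xor : ∀ a b c → (a xor b) ∧ c ≡ (a ∧ c) xor (b ∧ c)
∧-distribʳ-xor true  true  true  = refl
∧-distribʳ-xor true  true  false = refl
∧-distribʳ-xor true  false c     = sym (Bool.xor-identityʳ c)
∧-distribʳ-xor false b     c     = refl

xor-interchange : ∀ a b c d → (a xor b) xor (c xor d) ≡ (a xor c) xor (b xor d)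
xor-interchange false false c     d = refl
xor-interchange false true  false d = refl
xor-interchange false true  true  d = refl
xor-interchange true  false false d = refl
xor-interchange true  false true  d = Bool.not-involutive d
xor-interchange true  true  false d = sym (Bool.not-involutive d)
xor-interchange true  true  true  d = refl

xor≡false⇒≡ : ∀ a b → a xor b ≡ false → b ≡ a
xor≡false⇒≡ true  true  _ = refl
xor≡false⇒≡ false false _ = refl

sum-cong : {f h : Vector 𝔽₂ k} → (∀ i → f i ≡ h i) → sum f ≡ sum h
sum-cong {zero}  eq = refl
sum-cong {suc k} eq = cong₂ _xor_ (eq zero) (sum-cong (eq ∘ suc))

sum-false : (f : Vector 𝔽₂ k) → (∀ i → f i ≡ false) → sum f ≡ false
sum-false {zero}  f eq = refl
sum-false {suc k} f eq rewrite eq zero = sum-false (f ∘ suc) (eq ∘ suc)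

sum-xor : (f h : Vector 𝔽₂ k) → sum (λ i → f i xor h i) ≡ sum f xor sum h
sum-xor {zero}  f h = refl
sum-xor {suc k} f h = trans (cong ((f zero xor h zero) xor_) (sum-xor (f ∘ suc) (h ∘ suc)))
  (xor-interchange (f zero) (h zero) _ _)

sum-single : (f : Vector 𝔽₂ k) (j : Fin k) → (∀ i → i ≢ j → f i ≡ false) → sum f ≡ f j
sum-single f zero    eq = trans (cong (f zero xor_) (sum-false (f ∘ suc) λ i → eq (suc i) λ ())) (Bool.xor-identityʳ _)
sum-single f (suc j) eq rewrite eq zero (λ ()) = sum-single (f ∘ suc) j λ i i≢j → eq (suc i) (i≢j ∘ suc-injective)

linComb-xor : (a b : Vector 𝔽₂ k) (v : Vector (Vector 𝔽₂ n) k) (e : Fin n) →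
              linComb (λ i → a i xor b i) v e ≡ linComb a v e xor linComb b v e
linComb-xor a b v e = trans (sum-cong λ i → ∧-distribʳ-xor (a i) (b i) (v i e))
  (sum-xor (λ i → a i ∧ v i e) (λ i → b i ∧ v i e))

∉⇒lookup≡false : {X : Subset n} {x : Fin n} → x ∉ X → lookup X x ≡ false
∉⇒lookup≡false {X = X} {x} x∉ with lookup X x in eq
... | false = refl
... | true  = ⊥-elim (x∉ (lookup⇒[]= x X eq))

∈tabulate⁻ : (a : Vector 𝔽₂ n) {x : Fin n} → x ∈ tabulate a → a x ≡ true
∈tabulate⁻ a {x} x∈ = trans (sym (lookup∘tabulate a x)) ([]=⇒lookup x∈)

∈tabulate⁺ : (a : Vector 𝔽₂ n) {x : Fin n} → a x ≡ true → x ∈ tabulate a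
∈tabulate⁺ a {x} eq = lookup⇒[]= x (tabulate a) (trans (lookup∘tabulate a x) eq)

∉tabulate⇒≡false : (a : Vector 𝔽₂ n) {x : Fin n} → x ∉ tabulate a → a x ≡ false
∉tabulate⇒≡false a {x} x∉ with a x in eq
... | false = refl
... | true  = ⊥-elim (x∉ (∈tabulate⁺ a eq))

IsLinear : (Vector 𝔽₂ n → Set) → Set
IsLinear {n} V =
  (∀ {u v} → (∀ e → u e ≡ v e) → V u → V v) × V (λ _ → false) × (∀ {u v} → V u → V v → V (λ e → u e xor v e))

linComb-closed : {V : Vector 𝔽₂ n → Set} → IsLinear V → (a : Vector 𝔽₂ k) (v : Vector (Vector 𝔽₂ n) k) →
                 (∀ i → V (v i)) → V (linComb a v)
linComb-closed {k = zero}  (_ , V0 , _) a v Vv = V0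
linComb-closed {k = suc k} {V} lin@(_ , V0 , Vxor) a v Vv =
  Vxor (scaled (a zero)) (linComb-closed lin (a ∘ suc) (v ∘ suc) (Vv ∘ suc))
  where
  scaled : ∀ c → V (λ e → c ∧ v zero e)
  scaled true  = Vv zero
  scaled false = V0

module Binary (M : Matroid n) {m} (ρ : Fin n → Vector 𝔽₂ m)
  (rep : ∀ I → I ⊆ E M → Indep M I ⇔ LinIndepOn I ρ) where

  Kernel : Vector 𝔽₂ n → Set
  Kernel u = (∀ e → e ∉ E M → u e ≡ false) × IsZero (linComb u ρ)

  kernel-linear : IsLinear Kernel
  kernel-linear =
    (λ eq (out , z) → (λ e e∉ → trans (sym (eq e)) (out e e∉)) ,
       λ x → trans (sum-cong λ e → cong (_∧ ρ e x) (sym (eq e))) (z x)) ,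
    ((λ _ _ → refl) , λ x → sum-false {k = n} _ λ _ → refl) ,
    λ {u} {v} (out , z) (out′ , z′) → (λ e e∉ → cong₂ _xor_ (out e e∉) (out′ e e∉)) ,
      λ x → trans (linComb-xor u v ρ x) (cong₂ _xor_ (z x) (z′ x))

  -- A linear relation among the columns of `C` has a nonempty support `A` inside `C`. Were `A` a
  -- proper subset it would be independent and admit no such relation; so `A` is `C`, and over two
  -- elements the relation is its indicator.
  circuit-kernel : ∀ {C} → IsCircuit M C → Kernel (indicator C)
  circuit-kernel {C} ((C⊆E , ¬i) , min)
    with anySubset? (λ A → (A ⊆? C) ×-dec nonempty? A ×-dec all? (λ x → linComb (indicator A) ρ x Bool.≟ false))
  ... | no none = ⊥-elim (¬i (Equivalence.from (rep C C⊆E) independent))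
    where
    independent : LinIndepOn C ρ
    independent a out z x = ∉tabulate⇒≡false a λ x∈ → none (tabulate a ,
      (λ {y} y∈ → case y ∈? C of λ
        { (yes y∈C) → y∈C
        ; (no y∉C)  → contradiction (trans (sym (∈tabulate⁻ a y∈)) (out y y∉C)) λ () }) ,
      (x , x∈) ,
      λ y → trans (sum-cong λ e → cong (_∧ ρ e y) (lookup∘tabulate a e)) (z y))
  ... | yes (A , A⊆C , (y , y∈) , z) = subst (Kernel ∘ indicator) (⊆-antisym A⊆C C⊆A)
    ((λ e e∉ → ∉⇒lookup≡false (e∉ ∘ C⊆E ∘ A⊆C)) , z)
    where
    C⊆A : C ⊆ A
    C⊆A {x} x∈ with x ∈? A
    ... | yes x∈A = x∈A
    ... | no  x∉A = contradiction
      (trans (sym ([]=⇒lookup y∈)) (Equivalence.to (rep A (C⊆E ∘ A⊆C)) (min ((λ {_} → A⊆C) , x , x∈ , x∉A))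
        (indicator A) (λ e → ∉⇒lookup≡false) z y)) λ ()

  circuitSpace-kernel : ∀ {w} → CircuitSpace M w → Kernel w
  circuitSpace-kernel (_ , v , circuits , a , eq) = proj₁ kernel-linear eq (linComb-closed kernel-linear a v λ i →
    let C , c , v≡ = circuits i in proj₁ kernel-linear (λ e → sym (v≡ e)) (circuit-kernel c))

  kernel-independent : ∀ {u I} → Kernel u → Indep M I → (∀ e → u e ≡ true → e ∈ E M → e ∈ I) → ∀ e → u e ≡ false
  kernel-independent {u} {I} (out , z) i supp = Equivalence.to (rep I (indep⊆E M i)) i u off z
    where
    off : ∀ e → e ∉ I → u e ≡ false
    off e e∉ with u e in eq | e ∈? E M
    ... | false | _      = refl
    ... | true  | yes e∈ = ⊥-elim (e∉ (supp e eq e∈))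
    ... | true  | no e∉E = trans (sym eq) (out e e∉E)

-- At an element of the unique union over the support of `a`, exactly one term of the combination is
-- 1, so the sum cannot vanish.
indicators-independent : {N : Nullity n} {C : Fin g → Subset n} → Family N C ⊤ → LinIndep (indicator ∘ C)
indicators-independent {N = N} {C} F a z i = ∉tabulate⇒≡false a λ i∈ →
  let e , e∈ = Nullity.ν-Nonempty N _ (Family.dependent F (tabulate a) ⊆⊤ (i , i∈))
      j , j∈ , e∈Cj , u = ∈uniqueUnion⁻ C (tabulate a) e∈
      others : ∀ k → k ≢ j → a k ∧ lookup (C k) e ≡ false
      others k k≢j = case e ∈? C k of λ
        { (no e∉)   → trans (cong (a k ∧_) (∉⇒lookup≡false e∉)) (Bool.∧-zeroʳ (a k))
        ; (yes e∈k) → cong (_∧ lookup (C k) e) (∉tabulate⇒≡false a λ k∈ → k≢j (u k∈ e∈k)) }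
  in contradiction (trans (sym (cong₂ _∧_ (∈tabulate⁻ a j∈) ([]=⇒lookup e∈Cj)))
       (trans (sym (sum-single _ j others)) (z e))) λ ()

shift : Vector 𝔽₂ n → (Fin g → Subset n) → Subset g → Vector 𝔽₂ n
shift w C ρ e = w e xor linComb (indicator ρ) (indicator ∘ C) e

⇔⇒lookup≡ : {p q : Subset n} {x : Fin n} → (x ∈ p → x ∈ q) → (x ∈ q → x ∈ p) → lookup p x ≡ lookup q x
⇔⇒lookup≡ {p = p} {q} {x} f b with x ∈? p
... | yes x∈ = trans ([]=⇒lookup x∈) (sym ([]=⇒lookup (f x∈)))
... | no  x∉ = trans (∉⇒lookup≡false x∉) (sym (∉⇒lookup≡false (x∉ ∘ b)))

lookup-∪⁅⁆ : (ρ : Subset g) {j : Fin g} → j ∉ ρ → ∀ i → lookup (ρ ∪ ⁅ j ⁆) i ≡ lookup ρ i xor lookup ⁅ j ⁆ i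
lookup-∪⁅⁆ ρ {j} j∉ i with i ≟ᶠ j
... | yes refl = trans ([]=⇒lookup (y∈p∪⁅y⁆ ρ j)) (sym (cong₂ _xor_ (∉⇒lookup≡false j∉) ([]=⇒lookup (x∈⁅x⁆ j))))
... | no i≢j   = trans (⇔⇒lookup≡ (λ i∈ → [ (λ a → a) , (λ a → contradiction a i≢j) ]′ (x∈p∪⁅y⁆⁻ ρ j i∈)) x∈p⇒x∈p∪q)
  (sym (trans (cong (lookup ρ i xor_) (∉⇒lookup≡false (x≢y⇒x∉⁅y⁆ i≢j))) (Bool.xor-identityʳ _)))

-- Modulo 2, one more cycle through `x` flips the coordinate at `x`, so it clears any coordinate
-- that is set. This lets `eliminate` act as Gaussian elimination on the support of `w`.
shift-toggling : (w : Vector 𝔽₂ n) (C : Fin g → Subset n) → Toggling C (tabulate ∘ shift w C)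
shift-toggling {g = g} w C = record { local = local ; toggle = toggle }
  where
  local : ∀ {ρ ρ′ x} → (∀ {i} → x ∈ C i → i ∈ ρ → i ∈ ρ′) → (∀ {i} → x ∈ C i → i ∈ ρ′ → i ∈ ρ) →
          x ∈ tabulate (shift w C ρ) → x ∈ tabulate (shift w C ρ′)
  local {ρ} {ρ′} {x} f b x∈ = ∈tabulate⁺ (shift w C ρ′)
    (trans (cong (w x xor_) (sum-cong agree)) (∈tabulate⁻ (shift w C ρ) x∈))
    where
    agree : ∀ i → lookup ρ′ i ∧ lookup (C i) x ≡ lookup ρ i ∧ lookup (C i) x
    agree i with x ∈? C i
    ... | yes x∈i = cong (_∧ lookup (C i) x) (⇔⇒lookup≡ (b x∈i) (f x∈i))
    ... | no  x∉i rewrite ∉⇒lookup≡false x∉i = trans (Bool.∧-zeroʳ (lookup ρ′ i)) (sym (Bool.∧-zeroʳ (lookup ρ i)))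
  toggle : ∀ {ρ j x} → x ∈ C j → j ∉ ρ → x ∈ tabulate (shift w C ρ) → x ∉ tabulate (shift w C (ρ ∪ ⁅ j ⁆))
  toggle {ρ} {j} {x} x∈j j∉ x∈ x∈′ =
    contradiction (trans (sym flip) (∈tabulate⁻ (shift w C (ρ ∪ ⁅ j ⁆)) x∈′)) λ ()
    where
    one : linComb (indicator ⁅ j ⁆) (indicator ∘ C) x ≡ true
    one = trans (sum-single _ j λ i i≢j → cong (_∧ lookup (C i) x) (∉⇒lookup≡false (x≢y⇒x∉⁅y⁆ i≢j)))
      (cong₂ _∧_ ([]=⇒lookup (x∈⁅x⁆ j)) ([]=⇒lookup x∈j))
    flip : shift w C (ρ ∪ ⁅ j ⁆) x ≡ false
    flip = trans (cong (w x xor_) (trans (sum-cong λ i → cong (_∧ lookup (C i) x) (lookup-∪⁅⁆ ρ j∉ i))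
      (linComb-xor (indicator ρ) (indicator ⁅ j ⁆) (indicator ∘ C) x)))
      (trans (sym (Bool.xor-assoc (w x) (linComb (indicator ρ) (indicator ∘ C) x) _))
        (cong₂ _xor_ (∈tabulate⁻ (shift w C ρ) x∈) one))

circuits-basis : (M : Matroid n) {𝒞 : Fin (corank M) → Subset n} → IsCycleSystem M 𝒞 → (∀ i → IsCircuit M (𝒞 i)) →
                 IsBinary M → IsBasis (CircuitSpace M) (indicator ∘ 𝒞)
circuits-basis M {𝒞} sys circuits (m , ρ , rep) =
  (λ i → 1 , (λ _ → indicator (𝒞 i)) , (λ _ → 𝒞 i , circuits i , λ _ → refl) ,
    (λ _ → true) , λ e → Bool.xor-identityʳ _) ,
  indicators-independent (System.family S) , span
  where
  open Binary M ρ rep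
  open Rank M
  S = matroid-system M sys
  span : ∀ w → CircuitSpace M w → ∃[ a ] (∀ e → linComb a (indicator ∘ 𝒞) e ≡ w e)
  span w w∈ =
    -- All indices are live, so the run starts from no cycles at all. It leaves `w` plus a sum of
    -- cycles with independent support; this vector lies in the kernel of the representation, so it
    -- is zero.
    let σ , _ , zero-ν = eliminate _ {ρ₀ = ⊥} refl S (shift-toggling w 𝒞) (λ _ → ∉⊥)
        ker = proj₂ (proj₂ kernel-linear) (circuitSpace-kernel w∈)
                (linComb-closed kernel-linear (indicator σ) (indicator ∘ 𝒞) (circuit-kernel ∘ circuits))
        zero = kernel-independent ker (null≡0⇒indep zero-ν)
                λ e eq e∈ → x∈p∩q⁺ (∈tabulate⁺ (shift w 𝒞 σ) eq , e∈)
    in indicator σ , λ e → xor≡false⇒≡ (w e) _ (zero e)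

theorem1 : ∀ {n : ℕ} (M : Matroid n) → Nonempty (E M) →
    ∀ (𝒞 : Fin (corank M) → Subset n) → IsCycleSystem M 𝒞 →
    (∃[ e ] e ∈ E M
    × (∃[ 𝒟 ] IsCycleSystem (M ∖ e) 𝒟)
    × (∃[ 𝒟 ] IsCycleSystem (M ⧸ e) 𝒟))
    × (Connected M → ∀ i → IsCircuit M (𝒞 i))
    × (¬ Connected M →
    Σ[ d ∈ ComponentDecomposition M ] let open ComponentDecomposition d in
    Σ[ D ∈ (∀ i → Fin (corank (summand i)) → Subset n) ]
    Σ[ K ∈ (∀ i → Fin (corank (summand i)) → Subset n) ]
    let 𝒞̃ = λ i → Range (λ c → K i c ∪ D i c) in
    (∀ i → IsCircuitSystem (summand i) (D i))
    × (∀ i c → K i c ≡ ⊥ ⊎ IsCycle (precedingSum i) (K i c))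
    × Range 𝒞 ≐ ⋃ (Fin size) 𝒞̃
    × (∀ {i j} → i ≢ j → 𝒞̃ i disjointFrom 𝒞̃ j)
    × (∀ i → toℕ i ≡ 0 → 𝒞̃ i ≐ Range (D i)))
    × (Connected M → IsBinary M → IsBasis (CircuitSpace M) (indicator ∘ 𝒞))
theorem1 M ne 𝒞 sys =
  minor-systems M sys ne ,
  connected-circuits M sys ,
  (λ _ → decomposition , circuits , remainders , circuit-system , (λ l c → inj₂ (remainder-cycle l c)) , 𝒞-blocks ,
    (λ i≢j ((c , eq) , (d , eq′)) → i≢j (blocks-disjoint (trans eq (sym eq′)))) ,
    λ l l≡0 → (λ (c , eq) → c , trans (sym (first-remainder l c l≡0)) eq) ,
              (λ (c , eq) → c , trans (first-remainder l c l≡0) eq)) ,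
  λ conn → circuits-basis M sys (connected-circuits M sys conn)
  where open Components M ne 𝒞 sys
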